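{- Let $|t|$ be the size of the initial term $t$ of a derivation $d$ (a closed term without explicit substitutions), and let $|d|$ be the number of steps of $d$. (1) (Low-level bilinear implementation) Every derivation $d:t\multimap_{\mathtt{uf}}^*u$ of the Useful Fireball Calculus is implementable on RAM in $O((1+|d|)\cdot|t|)$ steps. (2) (Low + high quadratic implementation) Every derivation $d:t\to_{\mathtt f}^*u$ of the Fireball Calculus is implementable on RAM in $O((1+|d|^2)\cdot|t|)$ steps.
   Context: **Fireball Calculus (FBC).** Terms: $t,u ::= x\mid a\mid\lambda x.t\mid tu$, where $x$ ranges over variables and $a$ over a separate set of symbols (constants, never bound nor substituted). Terms are taken up to $\alpha$-equivalence; $t\{x\leftarrow u\}$ is capture-avoiding substitution; a term is closed if it has no free variables (symbols are allowed). Values $v::=\lambda x.t$; fireballs $f::=v\mid A$; inerts $A::=a\mid Af$. Evaluation contexts $F::=\langle\cdot\rangle\mid tF\mid Ff$. The rule is $F\langle(\lambda x.t)f\rangle\to_{\mathtt f}F\langle t\{x\leftarrow f\}\rangle$. Size: $|x|=|a|=1$, $|\lambda x.t|=|t|+1$, $|tu|=|t|+|u|+1$. **Explicit substitutions (ES).** Terms with ES add the construct $t[x\leftarrow u]$, binding $x$ in $t$. Values are still the abstractions. Unfolding: $x{\downarrow}=x$, $a{\downarrow}=a$, $(tu){\downarrow}=t{\downarrow}\,u{\downarrow}$, $(\lambda x.t){\downarrow}=\lambda x.t{\downarrow}$, $t[x\leftarrow u]{\downarrow}=t{\downarrow}\{x\leftarrow u{\downarrow}\}$. Plugging in a context may capture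 variables. Substitution contexts $L::=\langle\cdot\rangle\mid L[x\leftarrow t]$. Shallow contexts $S::=\langle\cdot\rangle\mid St\mid tS\mid S[x\leftarrow t]$. Weak contexts $W::=\langle\cdot\rangle\mid tW\mid Wt\mid W[x\leftarrow t]\mid t[x\leftarrow W]$. Unfolding of $t$ relative to $S$: $t{\downarrow}_{\langle\cdot\rangle}=t{\downarrow}$, $t{\downarrow}_{uS}=t{\downarrow}_{Su}=t{\downarrow}_S$, $t{\downarrow}_{S[x\leftarrow u]}=t{\downarrow}_S\{x\leftarrow u{\downarrow}\}$. An initial term is a closed term without ES. **Structural equivalence** $\equiv$ is the least equivalence closed under weak contexts containing: $t[x\leftarrow u][y\leftarrow w]\equiv t[y\leftarrow w][x\leftarrow u]$ if $y\notin fv(u)$, $x\notin fv(w)$; $(tw)[x\leftarrow u]\equiv t\,(w[x\leftarrow u])$ if $x\notin fv(t)$; $(tw)[x\leftarrow u]\equiv (t[x\leftarrow u])\,w$ if $x\notin fv(w)$; $t[x\leftarrow u][y\leftarrow w]\equiv t[x\leftarrow u[y\leftarrow w]]$ if $y\notin fv(t)$. **Useful contexts.** Evaluable shallow contexts: $\langle\cdot\rangle$ is evaluable; $St$ is evaluable if $S$ is and $t{\downarrow}$ is a fireball; $tS$ is evaluable if $S$ is; $S[x\leftarrow t]$ is evaluable if $t{\downarrow}$ is a fireball and $S\{x\leftarrow t{\downarrow}\}$ is evaluable. $S$ is applicative if $S=S'\langle L\,u\rangle$ for some $S',L,u$ (the hole of $S$ being the hole of $L$); $S$ is useful if it is evaluable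 and applicative. **Useful FBC.** $\multimap_{\mathtt{uf}}=\multimap_{\mathtt{um}}\cup\multimap_{\mathtt{ue}}$ (up to $\alpha$; the displayed $x$ is bound by the displayed ES on $x$, and moving $L$ outwards captures no variable): - $S\langle L\langle\lambda x.t\rangle u\rangle\multimap_{\mathtt{um}}S\langle L\langle t[x\leftarrow u]\rangle\rangle$ if $S\langle L\,u\rangle$ is useful; - $S\langle S'\langle x\rangle[x\leftarrow L\langle u\rangle]\rangle\multimap_{\mathtt{ue}}S\langle L\langle S'\langle u\rangle[x\leftarrow u]\rangle\rangle$ if $S\langle S'[x\leftarrow L\langle u\rangle]\rangle$ is useful, $u$ is not of the form $u'[y\leftarrow w]$, and $u{\downarrow}_{S\langle L\rangle}$ is a value. **Implementability.** The RAM is a standard random access machine with unit-cost pointer operations; terms are represented by linked structures. The output of a computation is given in shared form, i.e. as a term with ES. "Derivations are implementable on RAM in $O(g)$ steps" means that there is one RAM algorithm which, given an initial term $t$ and the length $n$ of a derivation $d$ of the considered kind from $t$ to $u$, performs $O(g)$ steps and produces (a representation of) a term with ES $w$ such that: $w\equiv u$, for derivations of a calculus with ES; $w{\downarrow}=u$ up to $\alpha$, for $\to_{\mathtt f}$-derivations. -}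

module Defs where

open import Data.Bool using (if_then_else_)
open import Data.Fin using (Fin; zero; suc; lift)
open import Data.List using (List; []; _∷_; _++_; drop; head)
open import Data.List.Relation.Unary.All using (All)
open import Data.List.Relation.Unary.Unique.Propositional using (Unique)
open import Data.Maybe using (Maybe; just; nothing)
open import Data.Nat using (ℕ; zero; suc; _+_; _*_; _∸_; _≤_; _<_; _≟_)
open import Data.Product using (Σ; ∃-syntax; _×_)
open import Data.Sum using (_⊎_)
open import Data.Vec using (Vec; []; _∷_; lookup)
open import Level using (0ℓ)
open import Relation.Binary.Core using (Rel)
open import Relation.Binary.Construct.Closure.ReflexiveTransitive using (Star; fold)
open import Relation.Binary.PropositionalEquality as ≡ using (_≡_)
open import Relation.Nullary using (¬_; does)

-- Well-scoped de Bruijn terms: `Tm φ n` has its free variables in `Fin n`, so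
-- that _≡_ is α-equivalence.  Explicit substitutions exist only in the flavour
-- `shared`; the remaining syntax, renaming and substitution are common to both.

data Flavour : Set where
  pure shared : Flavour

infixl 7 _·_
infixl 6 _[←_]

data Tm : Flavour → ℕ → Set where
  var   : ∀ {φ n} → Fin n → Tm φ n
  sym   : ∀ {φ n} → ℕ → Tm φ n
  lam   : ∀ {φ n} → Tm φ (suc n) → Tm φ n
  _·_   : ∀ {φ n} → Tm φ n → Tm φ n → Tm φ n
  _[←_] : ∀ {n} → Tm shared (suc n) → Tm shared n → Tm shared n

Term ETerm : ℕ → Set
Term  = Tm pure
ETerm = Tm shared

∣_∣ : ∀ {n} → Term n → ℕ
∣ var i ∣ = 1
∣ sym a ∣ = 1
∣ lam t ∣ = ∣ t ∣ + 1
∣ t · u ∣ = ∣ t ∣ + ∣ u ∣ + 1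

embed : ∀ {n} → Term n → ETerm n
embed (var i) = var i
embed (sym a) = sym a
embed (lam t) = lam (embed t)
embed (t · u) = embed t · embed u

rename : ∀ {φ m n} → (Fin m → Fin n) → Tm φ m → Tm φ n
rename ρ (var i)    = var (ρ i)
rename ρ (sym a)    = sym a
rename ρ (lam t)    = lam (rename (lift 1 ρ) t)
rename ρ (t · u)    = rename ρ t · rename ρ u
rename ρ (t [← u ]) = rename (lift 1 ρ) t [← rename ρ u ]

weaken : ∀ {φ n} → Tm φ n → Tm φ (suc n)
weaken = rename suc

Sub : Flavour → ℕ → ℕ → Set
Sub φ m n = Fin m → Tm φ n

liftSub : ∀ {φ m n} → Sub φ m n → Sub φ (suc m) (suc n)
liftSub σ zero    = var zero
liftSub σ (suc i) = weaken (σ i)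

subst : ∀ {φ m n} → Sub φ m n → Tm φ m → Tm φ n
subst σ (var i)    = σ i
subst σ (sym a)    = sym a
subst σ (lam t)    = lam (subst (liftSub σ) t)
subst σ (t · u)    = subst σ t · subst σ u
subst σ (t [← u ]) = subst (liftSub σ) t [← subst σ u ]

single : ∀ {φ n} → Tm φ n → Sub φ (suc n) n
single u zero    = u
single u (suc i) = var i

infixl 8 _⟦_⟧

_⟦_⟧ : ∀ {φ n} → Tm φ (suc n) → Tm φ n → Tm φ n
t ⟦ u ⟧ = subst (single u) t

infix 9 _↓

_↓ : ∀ {n} → ETerm n → Term n
var i ↓      = var i
sym a ↓      = sym a
lam t ↓      = lam (t ↓)
(t · u) ↓    = t ↓ · u ↓
(t [← u ]) ↓ = t ↓ ⟦ u ↓ ⟧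

data Value {n} : Term n → Set where
  lam : ∀ t → Value (lam t)

data Fireball {n} : Term n → Set
data Inert    {n} : Term n → Set

data Fireball {n} where
  value : ∀ {t} → Value t → Fireball t
  inert : ∀ {t} → Inert t → Fireball t

data Inert {n} where
  sym : ∀ a → Inert (sym a)
  _·_ : ∀ {t u} → Inert t → Fireball u → Inert (t · u)

data FCtx (n : ℕ) : Set where
  hole : FCtx n
  argF : Term n → FCtx n → FCtx n
  funF : FCtx n → (f : Term n) → Fireball f → FCtx n

plugF : ∀ {n} → FCtx n → Term n → Term n
plugF hole         r = r
plugF (argF t F)   r = t · plugF F r
plugF (funF F f _) r = plugF F r · f

infix 4 _→f_

data _→f_ {n} : Rel (Term n) 0ℓ where
  step : ∀ (F : FCtx n) t {f} → Fireball f →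
         plugF F (lam t · f) →f plugF F (t ⟦ f ⟧)

-- The scope obtained from n by going under k binders.  The recursion follows
-- the nesting of a context, outermost binder first.

infixl 6 _⊕_

_⊕_ : ℕ → ℕ → ℕ
zero  ⊕ n = n
suc k ⊕ n = k ⊕ suc n

liftVar : ∀ k {n} → Fin n → Fin (k ⊕ n)
liftVar zero    i = i
liftVar (suc k) i = liftVar k (suc i)

weakenBy : ∀ k {φ n} → Tm φ n → Tm φ (k ⊕ n)
weakenBy k = rename (liftVar k)

⊕-assoc : ∀ k {j n} → j ⊕ (k ⊕ n) ≡ (k + j) ⊕ n
⊕-assoc zero    = ≡.refl
⊕-assoc (suc k) = ⊕-assoc k

-- A context in `LCtx n k`, `SCtx n k` or `WCtx n k` lives in scope n and its
-- hole is under k explicit substitutions: it is plugged with terms in scope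
-- k ⊕ n, whose variables it may capture.

data LCtx (n : ℕ) : ℕ → Set where
  hole : LCtx n zero
  esL  : ∀ {k} → LCtx (suc n) k → ETerm n → LCtx n (suc k)

data SCtx (n : ℕ) : ℕ → Set where
  hole : SCtx n zero
  funS : ∀ {k} → SCtx n k → ETerm n → SCtx n k
  argS : ∀ {k} → ETerm n → SCtx n k → SCtx n k
  esS  : ∀ {k} → SCtx (suc n) k → ETerm n → SCtx n (suc k)

data WCtx (n : ℕ) : ℕ → Set where
  hole  : WCtx n zero
  argW  : ∀ {k} → ETerm n → WCtx n k → WCtx n k
  funW  : ∀ {k} → WCtx n k → ETerm n → WCtx n k
  esW   : ∀ {k} → WCtx (suc n) k → ETerm n → WCtx n (suc k)
  inEsW : ∀ {k} → ETerm (suc n) → WCtx n k → WCtx n k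

plugL : ∀ {n k} → LCtx n k → ETerm (k ⊕ n) → ETerm n
plugL hole      r = r
plugL (esL L t) r = plugL L r [← t ]

plugS : ∀ {n k} → SCtx n k → ETerm (k ⊕ n) → ETerm n
plugS hole       r = r
plugS (funS S t) r = plugS S r · t
plugS (argS t S) r = t · plugS S r
plugS (esS S t)  r = plugS S r [← t ]

plugW : ∀ {n k} → WCtx n k → ETerm (k ⊕ n) → ETerm n
plugW hole        r = r
plugW (argW t W)  r = t · plugW W r
plugW (funW W t)  r = plugW W r · t
plugW (esW W t)   r = plugW W r [← t ]
plugW (inEsW t W) r = t [← plugW W r ]

toS : ∀ {n k} → LCtx n k → SCtx n k
toS hole      = hole
toS (esL L t) = esS (toS L) t

infixr 7 _⟨_⟩

_⟨_⟩ : ∀ {n k j} → SCtx n k → SCtx (k ⊕ n) j → SCtx n (k + j)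
hole     ⟨ T ⟩ = T
funS S t ⟨ T ⟩ = funS (S ⟨ T ⟩) t
argS t S ⟨ T ⟩ = argS t (S ⟨ T ⟩)
esS S t  ⟨ T ⟩ = esS (S ⟨ T ⟩) t

renameS : ∀ {m n k} → (Fin m → Fin n) → SCtx m k → SCtx n k
renameS ρ hole       = hole
renameS ρ (funS S t) = funS (renameS ρ S) (rename ρ t)
renameS ρ (argS t S) = argS (rename ρ t) (renameS ρ S)
renameS ρ (esS S t)  = esS (renameS (lift 1 ρ) S) (rename ρ t)

substS : ∀ {m n k} → Sub shared m n → SCtx m k → SCtx n k
substS σ hole       = hole
substS σ (funS S t) = funS (substS σ S) (subst σ t)
substS σ (argS t S) = argS (subst σ t) (substS σ S)
substS σ (esS S t)  = esS (substS (liftSub σ) S) (subst σ t)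

infix 9 _↓[_]

_↓[_] : ∀ {n k} → ETerm (k ⊕ n) → SCtx n k → Term n
t ↓[ hole ]     = t ↓
t ↓[ funS S u ] = t ↓[ S ]
t ↓[ argS u S ] = t ↓[ S ]
t ↓[ esS S u ]  = t ↓[ S ] ⟦ u ↓ ⟧

swap₀₁ : ∀ {n} → Fin (2 + n) → Fin (2 + n)
swap₀₁ zero          = suc zero
swap₀₁ (suc zero)    = zero
swap₀₁ (suc (suc i)) = suc (suc i)

infix 4 _≋_

-- A side condition x ∉ fv(t) is expressed by t being the weakening of a term
-- that does not have x in scope.

data _≋_ {n} : Rel (ETerm n) 0ℓ where
  swap    : ∀ (t : ETerm (2 + n)) u w →
            t [← weaken u ] [← w ] ≋ rename swap₀₁ t [← weaken w ] [← u ]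
  inArg   : ∀ t w u → (weaken t · w) [← u ] ≋ t · (w [← u ])
  inFun   : ∀ t w u → (t · weaken w) [← u ] ≋ (t [← u ]) · w
  nest    : ∀ (t u : ETerm (suc n)) w →
            rename (lift 1 suc) t [← u ] [← w ] ≋ t [← u [← w ] ]
  inCtx   : ∀ {k} (W : WCtx n k) {t u} → t ≋ u → plugW W t ≋ plugW W u
  ≋-refl  : ∀ {t} → t ≋ t
  ≋-sym   : ∀ {t u} → t ≋ u → u ≋ t
  ≋-trans : ∀ {t u w} → t ≋ u → u ≋ w → t ≋ w

data Evaluable {n} : ∀ {k} → SCtx n k → Set where
  hole : Evaluable hole
  funS : ∀ {k} {S : SCtx n k} {t} →
         Evaluable S → Fireball (t ↓) → Evaluable (funS S t)
  argS : ∀ {k} {S : SCtx n k} {t} →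
         Evaluable S → Evaluable (argS t S)
  esS  : ∀ {k} {S : SCtx (suc n) k} {t} →
         Fireball (t ↓) → Evaluable (substS (single (embed (t ↓))) S) →
         Evaluable (esS S t)

data Applicative {n} : ∀ {k} → SCtx n k → Set where
  applicative : ∀ {k j} (S : SCtx n k) (L : LCtx (k ⊕ n) j) u →
                Applicative (S ⟨ funS (toS L) u ⟩)

Useful : ∀ {n k} → SCtx n k → Set
Useful S = Evaluable S × Applicative S

IsES : ∀ {n} → ETerm n → Set
IsES u = ∃[ u′ ] ∃[ w ] u ≡ u′ [← w ]

infix 4 _⊸um_ _⊸ue_ _⊸uf_

data _⊸um_ {n} : Rel (ETerm n) 0ℓ where
  um : ∀ {k j} (S : SCtx n k) (L : LCtx (k ⊕ n) j) t u →
       Useful (S ⟨ funS (toS L) u ⟩) →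
       plugS S (plugL L (lam t) · u) ⊸um
       plugS S (plugL L (t [← weakenBy j u ]))

-- `liftVar i zero` is the variable bound by the displayed explicit
-- substitution, seen from inside the hole of S′.  On the right-hand side S′ is
-- moved under L, and u is moved under that binder and those of S′.

data _⊸ue_ {n} : Rel (ETerm n) 0ℓ where
  ue : ∀ {k i j} (S : SCtx n k) (S′ : SCtx (suc (k ⊕ n)) i)
       (L : LCtx (k ⊕ n) j) u →
       Useful (S ⟨ esS S′ (plugL L u) ⟩) →
       ¬ IsES u →
       Value (≡.subst ETerm (⊕-assoc k) u ↓[ S ⟨ toS L ⟩ ]) →
       plugS S (plugS S′ (var (liftVar i zero)) [← plugL L u ]) ⊸ue
       plugS S (plugL L (plugS (renameS (lift 1 (liftVar j)) S′)
                               (weakenBy (suc i) u)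
                         [← u ]))

_⊸uf_ : ∀ {n} → Rel (ETerm n) 0ℓ
t ⊸uf u = t ⊸um u ⊎ t ⊸ue u

-- Unbounded registers and memory cells, both holding natural numbers.
-- Registers are addressed by the program text, memory cells only indirectly
-- through a register.  Every instruction has unit cost.

data Instr : Set where
  set      : (r c : ℕ)   → Instr
  add      : (r s q : ℕ) → Instr
  sub      : (r s q : ℕ) → Instr
  load     : (r s : ℕ)   → Instr
  store    : (r s : ℕ)   → Instr
  jumpZero : (r ℓ : ℕ)   → Instr

Program : Set
Program = List Instr

record Config : Set where
  constructor ⟪_,_,_⟫
  field
    pc        : ℕ
    registers : ℕ → ℕ
    memory    : ℕ → ℕ

open Config public

infixl 8 _[_≔_]

_[_≔_] : (ℕ → ℕ) → ℕ → ℕ → ℕ → ℕ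
(f [ i ≔ v ]) j = if does (j ≟ i) then v else f j

exec : Instr → Config → Config
exec (set r c)      ⟪ l , R , M ⟫ = ⟪ suc l , R [ r ≔ c ] , M ⟫
exec (add r s q)    ⟪ l , R , M ⟫ = ⟪ suc l , R [ r ≔ R s + R q ] , M ⟫
exec (sub r s q)    ⟪ l , R , M ⟫ = ⟪ suc l , R [ r ≔ R s ∸ R q ] , M ⟫
exec (load r s)     ⟪ l , R , M ⟫ = ⟪ suc l , R [ r ≔ M (R s) ] , M ⟫
exec (store r s)    ⟪ l , R , M ⟫ = ⟪ suc l , R , M [ R r ≔ R s ] ⟫
exec (jumpZero r ℓ) ⟪ l , R , M ⟫ = ⟪ (if does (R r ≟ 0) then ℓ else suc l) , R , M ⟫

fetch : Program → ℕ → Maybe Instr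
fetch P l = head (drop l P)

-- A program halts when its counter leaves the program text.

infix 4 _⊢_⇓[_]_

data _⊢_⇓[_]_ (P : Program) : Config → ℕ → Config → Set where
  halt : ∀ {c} → fetch P (pc c) ≡ nothing → P ⊢ c ⇓[ 0 ] c
  next : ∀ {c c′ k ι} → fetch P (pc c) ≡ just ι →
         P ⊢ exec ι c ⇓[ k ] c′ → P ⊢ c ⇓[ suc k ] c′

-- A node at address p occupies the cells p (tag), p + 1 and p + 2.  A variable
-- points to the node of its binder, an abstraction or an explicit substitution;
-- `binders` gives the nodes of the binders of the free variables.

data Rep (M : ℕ → ℕ) {n} (binders : Vec ℕ n) (p : ℕ) : ETerm n → Set where
  var : ∀ {i} → M p ≡ 0 → M (p + 1) ≡ lookup binders i →
        Rep M binders p (var i)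
  sym : ∀ {a} → M p ≡ 1 → M (p + 1) ≡ a →
        Rep M binders p (sym a)
  lam : ∀ {t} → M p ≡ 2 →
        Rep M (p ∷ binders) (M (p + 1)) t →
        Rep M binders p (lam t)
  app : ∀ {t u} → M p ≡ 3 →
        Rep M binders (M (p + 1)) t → Rep M binders (M (p + 2)) u →
        Rep M binders p (t · u)
  es  : ∀ {t u} → M p ≡ 4 →
        Rep M (p ∷ binders) (M (p + 1)) t → Rep M binders (M (p + 2)) u →
        Rep M binders p (t [← u ])

cells : ∀ {M n p t} {binders : Vec ℕ n} → Rep M binders p t → List ℕ
cells {p = p} r = p ∷ p + 1 ∷ p + 2 ∷ below r
  where
  below : ∀ {M n p t} {binders : Vec ℕ n} → Rep M binders p t → List ℕ
  below (var _ _)   = []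
  below (sym _ _)   = []
  below (lam _ r)   = cells r
  below (app _ r s) = cells r ++ cells s
  below (es _ r s)  = cells r ++ cells s

-- `Unique` makes the nodes pairwise disjoint: apart from the pointers to
-- binders, there is no sharing between subterms.

Stored : (M : ℕ → ℕ) (p : ℕ) → ETerm 0 → Set
Stored M p t = Σ (Rep M [] p t) λ r → Unique (cells r)

-- The cells from address `free` on are at the disposal of the program; their
-- initial contents are arbitrary.

StoredBelow : (free : ℕ) (M : ℕ → ℕ) (p : ℕ) → ETerm 0 → Set
StoredBelow free M p t =
  Σ (Rep M [] p t) λ r → Unique (cells r) × All (_< free) (cells r)

initial : (p n free : ℕ) (M : ℕ → ℕ) → Config
initial p n free M = ⟪ 0 , R , M ⟫
  where
  R : ℕ → ℕ
  R 0 = p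
  R 1 = n
  R 2 = free
  R _ = 0

length : ∀ {A : Set} {_⟶_ : Rel A 0ℓ} {t u} → Star _⟶_ t u → ℕ
length = fold (λ _ _ → ℕ) (λ _ n → suc n) 0

-- `ι` sees initial terms as objects of the calculus _⟶_, `Output w u` says that
-- w is an acceptable result for derivations ending in u, and `g |d| |t|` is the
-- bound.  The program and the constant depend neither on the term nor on the
-- derivation.

Implementable : {A : Set} (ι : Term 0 → A) (_⟶_ : Rel A 0ℓ)
                (Output : ETerm 0 → A → Set) (g : ℕ → ℕ → ℕ) → Set
Implementable ι _⟶_ Output g =
  Σ Program λ P → Σ ℕ λ C →
  ∀ t {u} (d : Star _⟶_ (ι t) u) →
  ∀ {free M p} → StoredBelow free M p (embed t) →
  ∃[ k ] ∃[ c ] ∃[ w ]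
    P ⊢ initial p (length d) free M ⇓[ k ] c ×
    k ≤ C * g (length d) ∣ t ∣ ×
    Stored (memory c) (registers c 0) w ×
    Output w u

{-# OPTIONS --safe #-}
module Submission where

open import Defs
open import Data.Bool using (Bool; T; _∧_; false; if_then_else_; true)
open import Data.Empty using (⊥; ⊥-elim)
open import Data.Fin using (Fin; lift; suc; toℕ; zero)
open import Data.List using (List; []; _++_; _∷_)
open import Data.List.Membership.Propositional using (_∈_)
open import Data.List.Membership.Propositional.Properties using (∈-++⁺ʳ; ∈-++⁺ˡ)
open import Data.List.Relation.Unary.All as All using (All; []; _∷_)
open import Data.List.Relation.Unary.All.Properties using (++⁻ʳ; ++⁻ˡ)
open import Data.List.Relation.Unary.AllPairs using ([]; _∷_)
open import Data.List.Relation.Unary.Any using (here; there)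
open import Data.List.Relation.Unary.Unique.Propositional using (Unique)
open import Data.Maybe using (just)
open import Data.Nat using
  (_%_; _*_; _+_; _<_; _<ᵇ_; _^_; _∸_; _≟_; _≤_; _≤ᵇ_; suc; s≤s; zero; z≤n; ℕ)
open import Data.Nat.DivMod using ([m+kn]%n≡m%n; m<n⇒m%n≡m)
open import Data.Nat.Properties using
  (*-cancelʳ-≡; *-monoʳ-≤; *-monoˡ-≤; +-assoc; +-cancelʳ-≡; +-cancelˡ-≡; +-comm; +-identityʳ;
   +-mono-≤; +-monoʳ-<; +-monoʳ-≤; +-monoˡ-<; +-monoˡ-≤; +-suc; <-irrefl; <-≤-trans; <ᵇ⇒<; <⇒≢;
   <⇒≤; m+n≡0⇒m≡0; m+n≡0⇒n≡0; module ≤-Reasoning; m≤m*n; m≤m+n; m≤n+m; m≤n⇒m≤n+o; m≤n⇒m≤o+n;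
   n≤1+n; ≤-pred; ≤-refl; ≤-reflexive; ≤-trans; ≤ᵇ⇒≤)
open import Data.Nat.Tactic.RingSolver using (solve-∀)
open import Data.Product using (_,_; _×_; proj₁; proj₂; Σ; ∃-syntax)
open import Data.Sum using (_⊎_; inj₁; inj₂)
open import Data.Unit using (tt; ⊤)
open import Data.Vec using (Vec; []; _∷_; lookup; map)
open import Data.Vec.Properties using (lookup-map)
open import Function using (_∘_; id)
open import Relation.Binary.Construct.Closure.ReflexiveTransitive using (Star; _◅_; ε)
open import Relation.Binary.PropositionalEquality as ≡ using
  (_≗_; _≡_; _≢_; cong; cong₂; refl; trans)
open import Relation.Nullary using (Dec; does; no; yes; ¬_)
open import Relation.Nullary.Decidable using (dec-false; dec-true)

-- The machine works in place: its memory always represents exactly the term that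
-- the derivation has reached.  A beta step turns the abstraction into the explicit
-- substitution, to which the variables then already point; a substitution step
-- relinks the floating context L and copies the value.  Redexes are searched from
-- right to left with a stack threaded through the applications.  A term has at most
-- one useful redex, so the one found is the one that the derivation contracts.
--
-- Every explicit substitution is flagged with the length of the chain of variables
-- from its content to a value (0 for an inert content), so that all transitions but
-- copying take constant time.  They are charged to the unexplored code, which only
-- grows by copying, and copies are bounded by the initial term because abstractions
-- are never substituted into.  A new flag exceeds the older ones by at most one, so
-- between two beta steps a →f-derivation of length n needs at most n substitutions.

-- Substitution calculus

-- The program is told only the length of the derivation, so the redex that it finds must be shown
-- to have the contractum that the derivation prescribes. This is proved on terms, independently of
-- memory. To make relative unfolding and evaluability tractable, a position is a zipper inside a
-- closed term: `env` sends each variable in scope to its closed unfolding, and useful contexts turn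
-- into the structural conditions `Ready` and `Applied`. Floating a substitution context changes de
-- Bruijn scopes but no pointer, so terms are first related to graphs of numbered nodes, where
-- renamings disappear, and only these graphs are laid out in memory. Both halves of the theorem use
-- one simulation; they differ in the `Strategy`, which abstracts what a derivation supplies, and in
-- whether a substitution consumes a unit of the step counter. The constants come from blocks of at
-- most 128 instructions: three blocks per explored node and two per copied node make 5 m blocks for
-- each substitution, where m is the size of the initial term.

lift-cong : ∀ {m n} {ρ ρ′ : Fin m → Fin n} → ρ ≗ ρ′ → lift 1 ρ ≗ lift 1 ρ′
lift-cong h zero    = refl
lift-cong h (suc i) = cong suc (h i)

rename-cong : ∀ {φ m n} {ρ ρ′ : Fin m → Fin n} → ρ ≗ ρ′ →
              (t : Tm φ m) → rename ρ t ≡ rename ρ′ t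
rename-cong h (var i)    = cong var (h i)
rename-cong h (sym a)    = refl
rename-cong h (lam t)    = cong lam (rename-cong (lift-cong h) t)
rename-cong h (t · u)    = cong₂ _·_ (rename-cong h t) (rename-cong h u)
rename-cong h (t [← u ]) = cong₂ _[←_] (rename-cong (lift-cong h) t) (rename-cong h u)

lift-id : ∀ {n} → lift 1 (id {A = Fin n}) ≗ id
lift-id zero    = refl
lift-id (suc i) = refl

rename-id : ∀ {φ n} (t : Tm φ n) → rename id t ≡ t
rename-id (var i)    = refl
rename-id (sym a)    = refl
rename-id (lam t)    = cong lam (trans (rename-cong lift-id t) (rename-id t))
rename-id (t · u)    = cong₂ _·_ (rename-id t) (rename-id u)
rename-id (t [← u ]) =
  cong₂ _[←_] (trans (rename-cong lift-id t) (rename-id t)) (rename-id u)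

lift-∘ : ∀ {l m n} (ρ : Fin m → Fin n) (ρ′ : Fin l → Fin m) →
         lift 1 ρ ∘ lift 1 ρ′ ≗ lift 1 (ρ ∘ ρ′)
lift-∘ ρ ρ′ zero    = refl
lift-∘ ρ ρ′ (suc i) = refl

rename-rename : ∀ {φ l m n} (ρ : Fin m → Fin n) (ρ′ : Fin l → Fin m) (t : Tm φ l) →
                rename ρ (rename ρ′ t) ≡ rename (ρ ∘ ρ′) t
rename-rename ρ ρ′ (var i)    = refl
rename-rename ρ ρ′ (sym a)    = refl
rename-rename ρ ρ′ (lam t)    =
  cong lam (trans (rename-rename _ _ t) (rename-cong (lift-∘ ρ ρ′) t))
rename-rename ρ ρ′ (t · u)    = cong₂ _·_ (rename-rename ρ ρ′ t) (rename-rename ρ ρ′ u)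
rename-rename ρ ρ′ (t [← u ]) =
  cong₂ _[←_] (trans (rename-rename _ _ t) (rename-cong (lift-∘ ρ ρ′) t))
              (rename-rename ρ ρ′ u)

liftSub-cong : ∀ {φ m n} {σ τ : Sub φ m n} → σ ≗ τ → liftSub σ ≗ liftSub τ
liftSub-cong h zero    = refl
liftSub-cong h (suc i) = cong weaken (h i)

subst-cong : ∀ {φ m n} {σ τ : Sub φ m n} → σ ≗ τ → (t : Tm φ m) → subst σ t ≡ subst τ t
subst-cong h (var i)    = h i
subst-cong h (sym a)    = refl
subst-cong h (lam t)    = cong lam (subst-cong (liftSub-cong h) t)
subst-cong h (t · u)    = cong₂ _·_ (subst-cong h t) (subst-cong h u)
subst-cong h (t [← u ]) = cong₂ _[←_] (subst-cong (liftSub-cong h) t) (subst-cong h u)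

liftSub-var : ∀ {φ n} → liftSub {φ} {n} var ≗ var
liftSub-var zero    = refl
liftSub-var (suc i) = refl

subst-var : ∀ {φ n} (t : Tm φ n) → subst var t ≡ t
subst-var (var i)    = refl
subst-var (sym a)    = refl
subst-var (lam t)    = cong lam (trans (subst-cong liftSub-var t) (subst-var t))
subst-var (t · u)    = cong₂ _·_ (subst-var t) (subst-var u)
subst-var (t [← u ]) =
  cong₂ _[←_] (trans (subst-cong liftSub-var t) (subst-var t)) (subst-var u)

liftSub-lift : ∀ {φ l m n} (σ : Sub φ m n) (ρ : Fin l → Fin m) →
               liftSub σ ∘ lift 1 ρ ≗ liftSub (σ ∘ ρ)
liftSub-lift σ ρ zero    = refl
liftSub-lift σ ρ (suc i) = refl

subst-rename : ∀ {φ l m n} (σ : Sub φ m n) (ρ : Fin l → Fin m) (t : Tm φ l) →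
               subst σ (rename ρ t) ≡ subst (σ ∘ ρ) t
subst-rename σ ρ (var i)    = refl
subst-rename σ ρ (sym a)    = refl
subst-rename σ ρ (lam t)    =
  cong lam (trans (subst-rename _ _ t) (subst-cong (liftSub-lift σ ρ) t))
subst-rename σ ρ (t · u)    = cong₂ _·_ (subst-rename σ ρ t) (subst-rename σ ρ u)
subst-rename σ ρ (t [← u ]) =
  cong₂ _[←_] (trans (subst-rename _ _ t) (subst-cong (liftSub-lift σ ρ) t))
              (subst-rename σ ρ u)

rename-liftSub : ∀ {φ l m n} (ρ : Fin m → Fin n) (σ : Sub φ l m) →
                 rename (lift 1 ρ) ∘ liftSub σ ≗ liftSub (rename ρ ∘ σ)
rename-liftSub ρ σ zero    = refl
rename-liftSub ρ σ (suc i) =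
  trans (rename-rename (lift 1 ρ) suc (σ i)) (≡.sym (rename-rename suc ρ (σ i)))

rename-subst : ∀ {φ l m n} (ρ : Fin m → Fin n) (σ : Sub φ l m) (t : Tm φ l) →
               rename ρ (subst σ t) ≡ subst (rename ρ ∘ σ) t
rename-subst ρ σ (var i)    = refl
rename-subst ρ σ (sym a)    = refl
rename-subst ρ σ (lam t)    =
  cong lam (trans (rename-subst _ _ t) (subst-cong (rename-liftSub ρ σ) t))
rename-subst ρ σ (t · u)    = cong₂ _·_ (rename-subst ρ σ t) (rename-subst ρ σ u)
rename-subst ρ σ (t [← u ]) =
  cong₂ _[←_] (trans (rename-subst _ _ t) (subst-cong (rename-liftSub ρ σ) t))
              (rename-subst ρ σ u)

liftSub-∘ : ∀ {φ l m n} (τ : Sub φ m n) (σ : Sub φ l m) →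
            subst (liftSub τ) ∘ liftSub σ ≗ liftSub (subst τ ∘ σ)
liftSub-∘ τ σ zero    = refl
liftSub-∘ τ σ (suc i) =
  trans (subst-rename (liftSub τ) suc (σ i)) (≡.sym (rename-subst suc τ (σ i)))

subst-subst : ∀ {φ l m n} (τ : Sub φ m n) (σ : Sub φ l m) (t : Tm φ l) →
              subst τ (subst σ t) ≡ subst (subst τ ∘ σ) t
subst-subst τ σ (var i)    = refl
subst-subst τ σ (sym a)    = refl
subst-subst τ σ (lam t)    =
  cong lam (trans (subst-subst _ _ t) (subst-cong (liftSub-∘ τ σ) t))
subst-subst τ σ (t · u)    = cong₂ _·_ (subst-subst τ σ t) (subst-subst τ σ u)
subst-subst τ σ (t [← u ]) =
  cong₂ _[←_] (trans (subst-subst _ _ t) (subst-cong (liftSub-∘ τ σ) t))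
              (subst-subst τ σ u)

infixr 5 _∷ₛ_

_∷ₛ_ : ∀ {φ m n} → Tm φ n → Sub φ m n → Sub φ (suc m) n
(u ∷ₛ σ) zero    = u
(u ∷ₛ σ) (suc i) = σ i

-- Like `subst-⟦⟧`, this turns an instantiation combined with a substitution into an extended
-- substitution, which is the way `env` grows at an explicit substitution.
subst-single-liftSub : ∀ {φ m n} (σ : Sub φ m n) (u : Tm φ n) (t : Tm φ (suc m)) →
                       subst (liftSub σ) t ⟦ u ⟧ ≡ subst (u ∷ₛ σ) t
subst-single-liftSub σ u t = trans (subst-subst (single u) (liftSub σ) t) (subst-cong eq t)
  where
  eq : subst (single u) ∘ liftSub σ ≗ u ∷ₛ σ
  eq zero    = refl
  eq (suc i) = trans (subst-rename (single u) suc (σ i)) (subst-var (σ i))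

subst-⟦⟧ : ∀ {φ m n} (σ : Sub φ m n) (t : Tm φ (suc m)) (u : Tm φ m) →
           subst σ (t ⟦ u ⟧) ≡ subst (subst σ u ∷ₛ σ) t
subst-⟦⟧ σ t u = trans (subst-subst σ (single u) t) (subst-cong eq t)
  where
  eq : subst σ ∘ single u ≗ subst σ u ∷ₛ σ
  eq zero    = refl
  eq (suc i) = refl

↓-rename : ∀ {m n} (ρ : Fin m → Fin n) (t : ETerm m) → rename ρ t ↓ ≡ rename ρ (t ↓)
↓-rename ρ (var i)    = refl
↓-rename ρ (sym a)    = refl
↓-rename ρ (lam t)    = cong lam (↓-rename (lift 1 ρ) t)
↓-rename ρ (t · u)    = cong₂ _·_ (↓-rename ρ t) (↓-rename ρ u)
↓-rename ρ (t [← u ]) = begin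
  rename (lift 1 ρ) t ↓ ⟦ rename ρ u ↓ ⟧
    ≡⟨ cong₂ _⟦_⟧ (↓-rename (lift 1 ρ) t) (↓-rename ρ u) ⟩
  rename (lift 1 ρ) (t ↓) ⟦ rename ρ (u ↓) ⟧
    ≡⟨ subst-rename _ (lift 1 ρ) (t ↓) ⟩
  subst (single (rename ρ (u ↓)) ∘ lift 1 ρ) (t ↓)
    ≡⟨ subst-cong (λ { zero → refl ; (suc i) → refl }) (t ↓) ⟩
  subst (rename ρ ∘ single (u ↓)) (t ↓)
    ≡⟨ rename-subst ρ _ (t ↓) ⟨
  rename ρ (t ↓ ⟦ u ↓ ⟧) ∎
  where open ≡.≡-Reasoning

embed-rename : ∀ {m n} (ρ : Fin m → Fin n) (t : Term m) → embed (rename ρ t) ≡ rename ρ (embed t)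
embed-rename ρ (var i) = refl
embed-rename ρ (sym a) = refl
embed-rename ρ (lam t) = cong lam (embed-rename (lift 1 ρ) t)
embed-rename ρ (t · u) = cong₂ _·_ (embed-rename ρ t) (embed-rename ρ u)

embed-↓ : ∀ {n} (t : Term n) → embed t ↓ ≡ t
embed-↓ (var i) = refl
embed-↓ (sym a) = refl
embed-↓ (lam t) = cong lam (embed-↓ t)
embed-↓ (t · u) = cong₂ _·_ (embed-↓ t) (embed-↓ u)

liftSub-embed : ∀ {m n} (σ : Sub pure m n) → liftSub (embed ∘ σ) ≗ embed ∘ liftSub σ
liftSub-embed σ zero    = refl
liftSub-embed σ (suc i) = ≡.sym (embed-rename suc (σ i))

-- Evaluability substitutes unfoldings into terms that still have explicit substitutions, hence the
-- mixture of a pure σ with a shared t.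
↓-subst : ∀ {m n} (σ : Sub pure m n) (t : ETerm m) → subst (embed ∘ σ) t ↓ ≡ subst σ (t ↓)
↓-subst-lift : ∀ {m n} (σ : Sub pure m n) (t : ETerm (suc m)) →
               subst (liftSub (embed ∘ σ)) t ↓ ≡ subst (liftSub σ) (t ↓)

↓-subst σ (var i)    = embed-↓ (σ i)
↓-subst σ (sym a)    = refl
↓-subst σ (lam t)    = cong lam (↓-subst-lift σ t)
↓-subst σ (t · u)    = cong₂ _·_ (↓-subst σ t) (↓-subst σ u)
↓-subst σ (t [← u ]) = begin
  subst (liftSub (embed ∘ σ)) t ↓ ⟦ subst (embed ∘ σ) u ↓ ⟧
    ≡⟨ cong₂ _⟦_⟧ (↓-subst-lift σ t) (↓-subst σ u) ⟩
  subst (liftSub σ) (t ↓) ⟦ subst σ (u ↓) ⟧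
    ≡⟨ subst-single-liftSub σ _ (t ↓) ⟩
  subst (subst σ (u ↓) ∷ₛ σ) (t ↓)
    ≡⟨ subst-⟦⟧ σ (t ↓) (u ↓) ⟨
  subst σ (t ↓ ⟦ u ↓ ⟧) ∎
  where open ≡.≡-Reasoning

↓-subst-lift σ t =
  trans (cong _↓ (subst-cong (liftSub-embed σ) t)) (↓-subst (liftSub σ) t)

-- Zippers

data Zip : ℕ → Set where
  top  : Zip 0
  argZ : ∀ {m} → ETerm m → Zip m → Zip m
  funZ : ∀ {m} → Zip m → ETerm m → Zip m
  esZ  : ∀ {m} → Zip m → ETerm m → Zip (suc m)

plug : ∀ {m} → Zip m → ETerm m → ETerm 0
plug top        r = r
plug (argZ t Z) r = plug Z (t · r)
plug (funZ Z u) r = plug Z (r · u)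
plug (esZ Z c)  r = plug Z (r [← c ])

-- A zipper starts from a closed term and never enters an abstraction, so every variable in scope is
-- bound by an explicit substitution and has a closed unfolding.
env : ∀ {m} → Zip m → Sub pure m 0
clo : ∀ {m} → Zip m → ETerm m → Term 0

env (argZ t Z) i       = env Z i
env (funZ Z u) i       = env Z i
env (esZ Z c)  zero    = clo Z c
env (esZ Z c)  (suc i) = env Z i

clo Z t = subst (env Z) (t ↓)

Applied : ∀ {m} → Zip m → Set
Applied top        = ⊥
Applied (argZ t Z) = ⊥
Applied (funZ Z u) = ⊤
Applied (esZ Z c)  = Applied Z

-- Evaluability read from the hole outwards: since closures already account for all outer explicit
-- substitutions, nothing has to be substituted into the rest of the context.
Ready : ∀ {m} → Zip m → Set
Ready top        = ⊤
Ready (argZ t Z) = Ready Z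
Ready (funZ Z u) = Ready Z × Fireball (clo Z u)
Ready (esZ Z c)  = Ready Z × Fireball (clo Z c)

-- The results for unapplied zippers are junk.

unapp : ∀ {m} → Zip m → Zip m × ETerm m
unapp top        = top , sym 0
unapp (argZ t Z) = argZ t Z , sym 0
unapp (funZ Z u) = Z , u
unapp (esZ Z c)  = esZ (proj₁ (unapp Z)) c , weaken (proj₂ (unapp Z))

-- Moving a substitution context outwards inserts binders in the middle of the scope. `ren` takes
-- the old scope to the new one, so that whatever lies further in can be renamed.
record Float (m : ℕ) : Set where
  constructor float
  field
    {scope} : ℕ
    zip     : Zip scope
    ren     : Fin m → Fin scope
    content : ETerm scope

Float-suc : ∀ {m} → Float (suc m) → Float m
Float-suc (float Z ρ u) = float Z (ρ ∘ suc) u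

peel : ∀ {m} → Zip m → ETerm m → Float m
peel Z (var i)    = float Z id (var i)
peel Z (sym a)    = float Z id (sym a)
peel Z (lam t)    = float Z id (lam t)
peel Z (t · u)    = float Z id (t · u)
peel Z (t [← c ]) = Float-suc (peel (esZ Z c) t)

-- The effect of ⊸ue on the context of the variable that it replaces.

floatAt : ∀ {m} → Zip m → Fin m → Float m
floatAt (argZ t Z) i       = let float Z′ ρ u = floatAt Z i in float (argZ (rename ρ t) Z′) ρ u
floatAt (funZ Z a) i       = let float Z′ ρ u = floatAt Z i in float (funZ Z′ (rename ρ a)) ρ u
floatAt (esZ Z c)  zero    = let float Z′ ρ u = peel Z c in float (esZ Z′ u) (lift 1 ρ) (weaken u)
floatAt (esZ Z c)  (suc i) =
  let float Z′ ρ u = floatAt Z i in float (esZ Z′ (rename ρ c)) (lift 1 ρ) (weaken u)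

plugFloat : ∀ {m} → Float m → ETerm 0
plugFloat (float Z ρ u) = plug Z u

-- `env Z i` is the unfolding, relative to its own position, of the content bound to i; this is what
-- the value premise of `⊸ue` tests.
data Redex {m} (Z : Zip m) : ETerm m → Set where
  lam : ∀ t → Redex Z (lam t)
  var : ∀ {i} → Value (env Z i) → Redex Z (var i)

contract : ∀ {m} (Z : Zip m) {h : ETerm m} → Redex Z h → ETerm 0
contract Z (lam t)     = let Z′ , u = unapp Z in plug Z′ (t [← u ])
contract Z (var {i} _) = plugFloat (floatAt Z i)

-- Shallow contexts as zippers

infixl 6 _▹_

_▹_ : ∀ {n k} → Zip n → SCtx n k → Zip (k ⊕ n)
Z ▹ hole     = Z
Z ▹ funS S t = funZ Z t ▹ S
Z ▹ argS t S = argZ t Z ▹ S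
Z ▹ esS S t  = esZ Z t ▹ S

plug-▹ : ∀ {n k} (Z : Zip n) (S : SCtx n k) r → plug (Z ▹ S) r ≡ plug Z (plugS S r)
plug-▹ Z hole       r = refl
plug-▹ Z (funS S t) r = plug-▹ (funZ Z t) S r
plug-▹ Z (argS t S) r = plug-▹ (argZ t Z) S r
plug-▹ Z (esS S t)  r = plug-▹ (esZ Z t) S r

plugS-toS : ∀ {n k} (L : LCtx n k) r → plugS (toS L) r ≡ plugL L r
plugS-toS hole      r = refl
plugS-toS (esL L t) r = cong _[← t ] (plugS-toS L r)

clo-es : ∀ {m} (Z : Zip m) t c → clo Z (t [← c ]) ≡ clo (esZ Z c) t
clo-es Z t c = trans (subst-⟦⟧ (env Z) (t ↓) (c ↓)) (subst-cong eq (t ↓))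
  where
  eq : (clo Z c ∷ₛ env Z) ≗ env (esZ Z c)
  eq zero    = refl
  eq (suc i) = refl

clo-plugL : ∀ {n k} (Z : Zip n) (L : LCtx n k) u → clo Z (plugL L u) ≡ clo (Z ▹ toS L) u
clo-plugL Z hole      u = refl
clo-plugL Z (esL L c) u = trans (clo-es Z (plugL L u) c) (clo-plugL (esZ Z c) L u)

env-▹ : ∀ {n i} (Z : Zip n) (S : SCtx n i) v → env (Z ▹ S) (liftVar i v) ≡ env Z v
env-▹ Z hole       v = refl
env-▹ Z (funS S t) v = env-▹ (funZ Z t) S v
env-▹ Z (argS t S) v = env-▹ (argZ t Z) S v
env-▹ Z (esS S t)  v = env-▹ (esZ Z t) S (suc v)

weakenBy-suc : ∀ {φ n} j (t : Tm φ n) → weakenBy j (weaken t) ≡ weakenBy (suc j) t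
weakenBy-suc j t = rename-rename (liftVar j) suc t

unapp-▹ : ∀ {n j} (Z : Zip n) {Z′ u} (L : LCtx n j) → unapp Z ≡ (Z′ , u) →
          unapp (Z ▹ toS L) ≡ (Z′ ▹ toS L , weakenBy j u)
unapp-▹ Z {u = u} hole eq = trans eq (cong (_ ,_) (≡.sym (rename-id u)))
unapp-▹ Z {u = u} (esL {j} L c) eq = trans
  (unapp-▹ (esZ Z c) L (cong (λ (Z′ , u) → esZ Z′ c , weaken u) eq))
  (cong (_ ,_) (weakenBy-suc j u))

-- The premise that u is not an explicit substitution makes L the maximal substitution context of
-- the content, and `peel` always strips the maximal one.
peel-plugL : ∀ {n j} (Z : Zip n) (L : LCtx n j) {u} → ¬ IsES u →
             peel Z (plugL L u) ≡ float (Z ▹ toS L) (liftVar j) u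
peel-plugL Z hole {var i}    ¬es = refl
peel-plugL Z hole {sym a}    ¬es = refl
peel-plugL Z hole {lam t}    ¬es = refl
peel-plugL Z hole {t · u}    ¬es = refl
peel-plugL Z hole {t [← u ]} ¬es = ⊥-elim (¬es (t , u , refl))
peel-plugL Z (esL L c)       ¬es = cong Float-suc (peel-plugL (esZ Z c) L ¬es)

plugFloat-▹ : ∀ {n i} (Z : Zip n) v {Z′ : Float n} (S : SCtx n i) → floatAt Z v ≡ Z′ →
              plugFloat (floatAt (Z ▹ S) (liftVar i v)) ≡
              plug (Float.zip Z′) (plugS (renameS (Float.ren Z′) S) (weakenBy i (Float.content Z′)))
plugFloat-▹ Z v hole       refl = cong (plug (Float.zip (floatAt Z v))) (≡.sym (rename-id _))
plugFloat-▹ Z v (funS S t) refl = plugFloat-▹ (funZ Z t) v S refl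
plugFloat-▹ Z v (argS t S) refl = plugFloat-▹ (argZ t Z) v S refl
plugFloat-▹ Z v (esS {i} S t) refl = trans
  (plugFloat-▹ (esZ Z t) (suc v) S refl)
  (cong (λ u → plug Z′ (plugS (renameS (lift 1 ρ) S) u [← rename ρ t ])) (weakenBy-suc i u))
  where open Float (floatAt Z v) renaming (zip to Z′; ren to ρ; content to u)

Ready-outer : ∀ {n k} (Z : Zip n) (S : SCtx n k) → Ready (Z ▹ S) → Ready Z
Ready-outer Z hole       r = r
Ready-outer Z (funS S t) r = proj₁ (Ready-outer (funZ Z t) S r)
Ready-outer Z (argS t S) r = Ready-outer (argZ t Z) S r
Ready-outer Z (esS S t)  r = proj₁ (Ready-outer (esZ Z t) S r)

Ready-⟨⟩ : ∀ {n k j} (Z : Zip n) (S : SCtx n k) (T : SCtx (k ⊕ n) j) →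
           Ready (Z ▹ S ⟨ T ⟩) → Ready (Z ▹ S ▹ T)
Ready-⟨⟩ Z hole       T r = r
Ready-⟨⟩ Z (funS S t) T r = Ready-⟨⟩ (funZ Z t) S T r
Ready-⟨⟩ Z (argS t S) T r = Ready-⟨⟩ (argZ t Z) S T r
Ready-⟨⟩ Z (esS S t)  T r = Ready-⟨⟩ (esZ Z t) S T r

Applied-⟨⟩ : ∀ {n k j} (Z : Zip n) (S : SCtx n k) (T : SCtx (k ⊕ n) j) →
             Applied (Z ▹ S ⟨ T ⟩) → Applied (Z ▹ S ▹ T)
Applied-⟨⟩ Z hole       T a = a
Applied-⟨⟩ Z (funS S t) T a = Applied-⟨⟩ (funZ Z t) S T a
Applied-⟨⟩ Z (argS t S) T a = Applied-⟨⟩ (argZ t Z) S T a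
Applied-⟨⟩ Z (esS S t)  T a = Applied-⟨⟩ (esZ Z t) S T a

Applied-toS : ∀ {n j} (Z : Zip n) (L : LCtx n j) → Applied Z → Applied (Z ▹ toS L)
Applied-toS Z hole      a = a
Applied-toS Z (esL L c) a = Applied-toS (esZ Z c) L a

applied : ∀ {n k} (Z : Zip n) {S : SCtx n k} → Applicative S → Applied (Z ▹ S)
applied Z (applicative S L u) = go Z S
  where
  go : ∀ {n k j} (Z : Zip n) (S : SCtx n k) {L : LCtx (k ⊕ n) j} {u} →
       Applied (Z ▹ S ⟨ funS (toS L) u ⟩)
  go Z hole {L}   = Applied-toS (funZ Z _) L tt
  go Z (funS S t) = go (funZ Z t) S
  go Z (argS t S) = go (argZ t Z) S
  go Z (esS S t)  = go (esZ Z t) S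

substS-cong : ∀ {m n k} {σ τ : Sub shared m n} → σ ≗ τ → (S : SCtx m k) → substS σ S ≡ substS τ S
substS-cong h hole       = refl
substS-cong h (funS S t) = cong₂ funS (substS-cong h S) (subst-cong h t)
substS-cong h (argS t S) = cong₂ argS (subst-cong h t) (substS-cong h S)
substS-cong h (esS S t)  = cong₂ esS (substS-cong (liftSub-cong h) S) (subst-cong h t)

substS-substS : ∀ {l m n k} (τ : Sub shared m n) (σ : Sub shared l m) (S : SCtx l k) →
                substS τ (substS σ S) ≡ substS (subst τ ∘ σ) S
substS-substS τ σ hole       = refl
substS-substS τ σ (funS S t) = cong₂ funS (substS-substS τ σ S) (subst-subst τ σ t)
substS-substS τ σ (argS t S) = cong₂ argS (subst-subst τ σ t) (substS-substS τ σ S)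
substS-substS τ σ (esS S t)  = cong₂ esS
  (trans (substS-substS (liftSub τ) (liftSub σ) S) (substS-cong (liftSub-∘ τ σ) S))
  (subst-subst τ σ t)

-- `Evaluable` substitutes each content into the context inside it. The context met in the induction
-- is therefore S with all outer contents substituted, that is, under the embedding of `env Z`.
ready : ∀ {n k} (Z : Zip n) (S : SCtx n k) → Ready Z →
        Evaluable (substS (embed ∘ env Z) S) → Ready (Z ▹ S)
ready Z hole       r hole        = r
ready Z (funS S t) r (funS e fb) =
  ready (funZ Z t) S (r , ≡.subst Fireball (↓-subst (env Z) t) fb) e
ready Z (argS t S) r (argS e)    = ready (argZ t Z) S r e
ready Z (esS S t)  r (esS fb e)  =
  ready (esZ Z t) S (r , ≡.subst Fireball (↓-subst (env Z) t) fb)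
        (≡.subst Evaluable (trans (substS-substS _ _ S) (substS-cong eq S)) e)
  where
  eq : subst (single (embed (subst (embed ∘ env Z) t ↓))) ∘ liftSub (embed ∘ env Z) ≗
       embed ∘ env (esZ Z t)
  eq zero    = cong embed (↓-subst (env Z) t)
  eq (suc i) = trans (subst-rename _ suc (embed (env Z i))) (subst-var _)

substS-var : ∀ {n k} (S : SCtx n k) → substS var S ≡ S
substS-var hole       = refl
substS-var (funS S t) = cong₂ funS (substS-var S) (subst-var t)
substS-var (argS t S) = cong₂ argS (subst-var t) (substS-var S)
substS-var (esS S t)  =
  cong₂ esS (trans (substS-cong liftSub-var S) (substS-var S)) (subst-var t)

ready-top : ∀ {k} {S : SCtx 0 k} → Evaluable S → Ready (top ▹ S)
ready-top {S = S} e =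
  ready top S tt (≡.subst Evaluable (trans (≡.sym (substS-var S)) (substS-cong (λ ()) S)) e)

↓[]-clo : ∀ {n k} (Z : Zip n) (S : SCtx n k) u → subst (env Z) (u ↓[ S ]) ≡ clo (Z ▹ S) u
↓[]-clo Z hole       u = refl
↓[]-clo Z (funS S t) u = ↓[]-clo (funZ Z t) S u
↓[]-clo Z (argS t S) u = ↓[]-clo (argZ t Z) S u
↓[]-clo Z (esS S t)  u = trans
  (trans (subst-⟦⟧ (env Z) (u ↓[ S ]) (t ↓))
         (subst-cong (λ { zero → refl ; (suc i) → refl }) (u ↓[ S ])))
  (↓[]-clo (esZ Z t) S u)

↓[⟨⟩]-clo : ∀ {n k j} (Z : Zip n) (S : SCtx n k) (T : SCtx (k ⊕ n) j) u →
            subst (env Z) (≡.subst ETerm (⊕-assoc k) u ↓[ S ⟨ T ⟩ ]) ≡ clo (Z ▹ S ▹ T) u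
↓[⟨⟩]-clo Z hole       T u = ↓[]-clo Z T u
↓[⟨⟩]-clo Z (funS S t) T u = ↓[⟨⟩]-clo (funZ Z t) S T u
↓[⟨⟩]-clo Z (argS t S) T u = ↓[⟨⟩]-clo (argZ t Z) S T u
↓[⟨⟩]-clo Z (esS {k} S t) T u = trans
  (trans (subst-⟦⟧ (env Z) u′ (t ↓)) (subst-cong (λ { zero → refl ; (suc i) → refl }) u′))
  (↓[⟨⟩]-clo (esZ Z t) S T u)
  where u′ = ≡.subst ETerm (⊕-assoc k) u ↓[ S ⟨ T ⟩ ]

subst-closed : (σ : Sub pure 0 0) (t : Term 0) → subst σ t ≡ t
subst-closed σ t = trans (subst-cong (λ ()) t) (subst-var t)

-- A common form for the steps of both rules: a redex at an applied and ready position, contracted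
-- by an operation on the zipper that no longer mentions S, L or S′.
record Contraction (t u : ETerm 0) : Set where
  constructor contraction
  field
    {scope}   : ℕ
    {zip}     : Zip scope
    {focus}   : ETerm scope
    isReady   : Ready zip
    isApplied : Applied zip
    redex     : Redex zip focus
    source    : plug zip focus ≡ t
    target    : contract zip redex ≡ u

um-contraction : ∀ {t u} → t ⊸um u → Contraction t u
um-contraction (um {j = j} S L t u (e , a)) =
  contraction {zip = Z} (Ready-⟨⟩ top S U (ready-top e)) (Applied-⟨⟩ top S U (applied top a)) (lam t)
    (begin
      plug Z (lam t)                             ≡⟨ plug-▹ (top ▹ S) U _ ⟩
      plug (top ▹ S) (plugS (toS L) (lam t) · u) ≡⟨ cong (λ r → plug (top ▹ S) (r · u))
          (plugS-toS L _) ⟩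
      plug (top ▹ S) (plugL L (lam t) · u)       ≡⟨ plug-▹ top S _ ⟩
      plugS S (plugL L (lam t) · u)              ∎)
    (begin
      contract Z (lam t)
        ≡⟨ cong (λ (Z , u) → plug Z (t [← u ])) (unapp-▹ (funZ (top ▹ S) u) L refl) ⟩
      plug (top ▹ S ▹ toS L) (t [← weakenBy j u ])
        ≡⟨ plug-▹ (top ▹ S) (toS L) _ ⟩
      plug (top ▹ S) (plugS (toS L) (t [← weakenBy j u ]))
        ≡⟨ cong (plug (top ▹ S)) (plugS-toS L _) ⟩
      plug (top ▹ S) (plugL L (t [← weakenBy j u ]))
        ≡⟨ plug-▹ top S _ ⟩
      plugS S (plugL L (t [← weakenBy j u ])) ∎)
  where
  open ≡.≡-Reasoning
  U = funS (toS L) u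
  Z = top ▹ S ▹ U

ue-contraction : ∀ {t u} → t ⊸ue u → Contraction t u
ue-contraction (ue {k} {i} {j} S S′ L u (e , a) ¬es v) =
  contraction {zip = Z} (Ready-⟨⟩ top S U (ready-top e)) (Applied-⟨⟩ top S U (applied top a))
    (var (≡.subst Value value≡ v))
    (trans (plug-▹ X S′ (var (liftVar i zero))) (plug-▹ top S (plugS (esS S′ _) _)))
    (begin
      plugFloat (floatAt Z (liftVar i zero))
        ≡⟨ plugFloat-▹ X zero S′ (cong (λ (float Z ρ u) → float (esZ Z u) (lift 1 ρ) (weaken u))
                                       (peel-plugL (top ▹ S) L ¬es)) ⟩
      plug (top ▹ S ▹ toS L) (plugS S″ (weakenBy i (weaken u)) [← u ])
        ≡⟨ cong (λ r → plug (top ▹ S ▹ toS L) (plugS S″ r [← u ])) (weakenBy-suc i u) ⟩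
      plug (top ▹ S ▹ toS L) (plugS S″ (weakenBy (suc i) u) [← u ])
        ≡⟨ plug-▹ (top ▹ S) (toS L) _ ⟩
      plug (top ▹ S) (plugS (toS L) (plugS S″ (weakenBy (suc i) u) [← u ]))
        ≡⟨ cong (plug (top ▹ S)) (plugS-toS L _) ⟩
      plug (top ▹ S) (plugL L (plugS S″ (weakenBy (suc i) u) [← u ]))
        ≡⟨ plug-▹ top S _ ⟩
      plugS S (plugL L (plugS S″ (weakenBy (suc i) u) [← u ])) ∎)
  where
  open ≡.≡-Reasoning
  X = esZ (top ▹ S) (plugL L u)
  U = esS S′ (plugL L u)
  Z = X ▹ S′
  S″ = renameS (lift 1 (liftVar j)) S′

  value≡ : ≡.subst ETerm (⊕-assoc k) u ↓[ S ⟨ toS L ⟩ ] ≡ env Z (liftVar i zero)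
  value≡ = begin
    ≡.subst ETerm (⊕-assoc k) u ↓[ S ⟨ toS L ⟩ ]
      ≡⟨ subst-closed (env top) _ ⟨
    subst (env top) (≡.subst ETerm (⊕-assoc k) u ↓[ S ⟨ toS L ⟩ ])
      ≡⟨ ↓[⟨⟩]-clo top S (toS L) u ⟩
    clo (top ▹ S ▹ toS L) u
      ≡⟨ clo-plugL (top ▹ S) L u ⟨
    env X zero
      ≡⟨ env-▹ X S′ zero ⟨
    env Z (liftVar i zero) ∎

uf-contraction : ∀ {t u} → t ⊸uf u → Contraction t u
uf-contraction (inj₁ s) = um-contraction s
uf-contraction (inj₂ s) = ue-contraction s

-- Uniqueness of the useful redex

¬fireball-applied : ∀ {t u : Term 0} → ¬ Fireball t → ¬ Fireball (t · u)
¬fireball-applied ¬t (inert (i · f)) = ¬t (inert i)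

value-not-inert : ∀ {n} {t : Term n} → Value t → ¬ Inert t
value-not-inert (lam t) ()

redex-value : ∀ {m} {Z : Zip m} {h} → Redex Z h → Value (clo Z h)
redex-value (lam t) = lam _
redex-value (var v) = v

-- A redex stays a value while only explicit substitutions are crossed. At the application that
-- takes it as its function it becomes a non-fireball, and it remains one from there outwards.
redex-not-fireball : ∀ {n k} (Z : Zip n) (S : SCtx n k) {h} → Applied (Z ▹ S) → Redex (Z ▹ S) h →
                     ¬ Fireball (clo Z (plugS S h)) ⊎ Applied Z × Value (clo Z (plugS S h))
redex-not-fireball Z hole a r = inj₂ (a , redex-value r)
redex-not-fireball Z (funS S t) a r with redex-not-fireball (funZ Z t) S a r
... | inj₁ ¬f      = inj₁ (¬fireball-applied ¬f)
... | inj₂ (_ , v) = inj₁ λ { (inert (i · _)) → value-not-inert v i }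
redex-not-fireball Z (argS t S) a r with redex-not-fireball (argZ t Z) S a r
... | inj₁ ¬f = inj₁ λ { (inert (_ · f)) → ¬f f }
redex-not-fireball Z (esS S t) a r =
  ≡.subst (λ s → ¬ Fireball s ⊎ Applied Z × Value s) (≡.sym (clo-es Z (plugS S _) t))
          (redex-not-fireball (esZ Z t) S a r)

Path : ℕ → Set
Path n = Σ ℕ λ k → SCtx n k × ETerm (k ⊕ n)

hole-path : ∀ {n k} {Z : Zip n} {h : ETerm n} (S : SCtx n k) {h′} → Redex Z h → h ≡ plugS S h′ →
            _≡_ {A = Path n} (0 , hole , h) (k , S , h′)
hole-path hole       r       refl = refl
hole-path (funS S t) (lam _) ()
hole-path (funS S t) (var _) ()
hole-path (argS t S) (lam _) ()
hole-path (argS t S) (var _) ()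
hole-path (esS S t)  (lam _) ()
hole-path (esS S t)  (var _) ()

·-injective : ∀ {φ n} {t u t′ u′ : Tm φ n} → t · u ≡ t′ · u′ → t ≡ t′ × u ≡ u′
·-injective refl = refl , refl

es-injective : ∀ {n} {t t′ : ETerm (suc n)} {u u′ : ETerm n} →
               (t [← u ]) ≡ (t′ [← u′ ]) → t ≡ t′ × u ≡ u′
es-injective refl = refl , refl

-- Two paths can only part at an application. The one entering the function is ready, so the
-- argument is a fireball; the one entering the argument has a redex there, so it is not.
path-unique : ∀ {n k k′} (Z : Zip n) (S : SCtx n k) {h} (S′ : SCtx n k′) {h′} →
              Ready (Z ▹ S) → Applied (Z ▹ S) → Redex (Z ▹ S) h →
              Ready (Z ▹ S′) → Applied (Z ▹ S′) → Redex (Z ▹ S′) h′ →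
              plugS S h ≡ plugS S′ h′ → _≡_ {A = Path n} (k , S , h) (k′ , S′ , h′)
path-unique Z hole S′ _ _ r _ _ r′ eq = hole-path {Z = Z} S′ r eq
path-unique Z S@(funS _ _) hole _ _ r _ _ r′ eq = ≡.sym (hole-path {Z = Z} S r′ (≡.sym eq))
path-unique Z S@(argS _ _) hole _ _ r _ _ r′ eq = ≡.sym (hole-path {Z = Z} S r′ (≡.sym eq))
path-unique Z S@(esS _ _)  hole _ _ r _ _ r′ eq = ≡.sym (hole-path {Z = Z} S r′ (≡.sym eq))
path-unique Z (funS S t) (funS S′ t′) y a r y′ a′ r′ eq with ·-injective eq
... | eq′ , refl with path-unique (funZ Z t) S S′ y a r y′ a′ r′ eq′
... | refl = refl
path-unique Z (argS t S) (argS t′ S′) y a r y′ a′ r′ eq with ·-injective eq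
... | refl , eq′ with path-unique (argZ t Z) S S′ y a r y′ a′ r′ eq′
... | refl = refl
path-unique Z (esS S t) (esS S′ t′) y a r y′ a′ r′ eq with es-injective eq
... | eq′ , refl with path-unique (esZ Z t) S S′ y a r y′ a′ r′ eq′
... | refl = refl
path-unique Z (funS S u) (argS t S′) y a r y′ a′ r′ eq
  with ·-injective eq | redex-not-fireball (argZ t Z) S′ a′ r′
... | _ , refl | inj₁ ¬f = ⊥-elim (¬f (proj₂ (Ready-outer (funZ Z u) S y)))
path-unique Z (argS t S) (funS S′ u) y a r y′ a′ r′ eq
  with ·-injective eq | redex-not-fireball (argZ t Z) S a r
... | _ , refl | inj₁ ¬f = ⊥-elim (¬f (proj₂ (Ready-outer (funZ Z u) S′ y′)))
path-unique Z (funS _ _) (esS _ _) _ _ _ _ _ _ ()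
path-unique Z (argS _ _) (esS _ _) _ _ _ _ _ _ ()
path-unique Z (esS _ _) (funS _ _) _ _ _ _ _ _ ()
path-unique Z (esS _ _) (argS _ _) _ _ _ _ _ _ ()

data FromTop : ∀ {m} → Zip m → Set where
  fromTop : ∀ {k} (S : SCtx 0 k) → FromTop (top ▹ S)

from-top : ∀ {m} (Z : Zip m) → FromTop Z
from-top Z = go Z hole
  where
  go : ∀ {m k} (Z : Zip m) (S : SCtx m k) → FromTop (Z ▹ S)
  go top        S = fromTop S
  go (argZ t Z) S = go Z (argS t S)
  go (funZ Z u) S = go Z (funS S u)
  go (esZ Z c)  S = go Z (esS S c)

redex-irrelevant : ∀ {m} {Z : Zip m} {h} (r r′ : Redex Z h) → contract Z r ≡ contract Z r′
redex-irrelevant (lam t) (lam .t) = refl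
redex-irrelevant (var _) (var _)  = refl

-- Hence the target of a derivation is determined by its source and its length, which is all that
-- the program receives.
contraction-unique : ∀ {m t} (Z : Zip m) {h} → Ready Z → Applied Z → (r : Redex Z h) →
                     plug Z h ⊸uf t → contract Z r ≡ t
contraction-unique Z y a r s with uf-contraction s
... | contraction {zip = Z′} y′ a′ r′ src tgt with from-top Z | from-top Z′
... | fromTop S | fromTop S′
  with path-unique top S S′ y a r y′ a′ r′
         (trans (≡.sym (plug-▹ top S _)) (trans (≡.sym src) (plug-▹ top S′ _)))
... | refl = trans (redex-irrelevant r r′) tgt

-- Needed when the search reaches the root without finding a redex: the remaining derivation must
-- then be empty.
fireball-normal : ∀ {t u} → Fireball (t ↓) → ¬ (t ⊸uf u)
fireball-normal {t} f s with uf-contraction s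
... | contraction {zip = Z} y a r refl tgt with from-top Z
... | fromTop S with redex-not-fireball top S a r
... | inj₁ ¬f = ¬f (≡.subst Fireball eq f)
  where
  eq : t ↓ ≡ clo top (plugS S _)
  eq = trans (cong _↓ (plug-▹ top S _)) (≡.sym (subst-closed (env top) _))

-- The Fireball Calculus on unfoldings

redex-in-context-not-fireball : ∀ {n} (F : FCtx n) {t f} → ¬ Fireball (plugF F (lam t · f))
redex-in-context-not-fireball hole         (inert (() · _))
redex-in-context-not-fireball (argF s F)   (inert (_ · f)) = redex-in-context-not-fireball F f
redex-in-context-not-fireball (funF F u _) (inert (i · _)) =
  redex-in-context-not-fireball F (inert i)

fireball-no-→f : ∀ {n} {t u : Term n} → Fireball t → ¬ (t →f u)
fireball-no-→f f (step F t _) = redex-in-context-not-fireball F f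

lam-not-redex : ∀ {n} (F : FCtx n) {t s f} → lam s ≢ plugF F (lam t · f)
lam-not-redex hole         ()
lam-not-redex (argF s F)   ()
lam-not-redex (funF F u _) ()

plugF-redex-unique : ∀ {n} (F F′ : FCtx n) {t f t′ f′} → Fireball f → Fireball f′ →
                     plugF F (lam t · f) ≡ plugF F′ (lam t′ · f′) →
                     plugF F (t ⟦ f ⟧) ≡ plugF F′ (t′ ⟦ f′ ⟧)
plugF-redex-unique hole hole f f′ refl = refl
plugF-redex-unique hole (argF s F′) f f′ refl = ⊥-elim (redex-in-context-not-fireball F′ f)
plugF-redex-unique hole (funF F′ u _) f f′ eq =
  ⊥-elim (lam-not-redex F′ (proj₁ (·-injective eq)))
plugF-redex-unique (argF s F) hole f f′ refl = ⊥-elim (redex-in-context-not-fireball F f′)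
plugF-redex-unique (funF F u _) hole f f′ eq =
  ⊥-elim (lam-not-redex F (≡.sym (proj₁ (·-injective eq))))
plugF-redex-unique (argF s F) (argF s′ F′) f f′ eq with ·-injective eq
... | refl , eq′ = cong (s ·_) (plugF-redex-unique F F′ f f′ eq′)
plugF-redex-unique (funF F u _) (funF F′ u′ _) f f′ eq with ·-injective eq
... | eq′ , refl = cong (_· u) (plugF-redex-unique F F′ f f′ eq′)
plugF-redex-unique (argF s F) (funF F′ u fu) f f′ eq with ·-injective eq
... | _ , refl = ⊥-elim (redex-in-context-not-fireball F fu)
plugF-redex-unique (funF F u fu) (argF s F′) f f′ eq with ·-injective eq
... | _ , refl = ⊥-elim (redex-in-context-not-fireball F′ fu)

→f-source : ∀ {n} {t u : Term n} → t →f u → ∀ {F : FCtx n} {s f} → Fireball f →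
            t ≡ plugF F (lam s · f) → plugF F (s ⟦ f ⟧) ≡ u
→f-source (step F t f) {F′} f′ eq = plugF-redex-unique F′ F f′ f (≡.sym eq)

→f-deterministic : ∀ {n} {t u u′ : Term n} → t →f u → t →f u′ → u ≡ u′
→f-deterministic (step F t f) s = →f-source s f refl

-- Explicit substitutions leave no trace in the unfolded context, because `env` has already put
-- their contents into the closures.
wrap : ∀ {m} → Zip m → Term 0 → Term 0
wrap top        r = r
wrap (argZ t Z) r = wrap Z (clo Z t · r)
wrap (funZ Z u) r = wrap Z (r · clo Z u)
wrap (esZ Z c)  r = wrap Z r

plug-↓ : ∀ {m} (Z : Zip m) t → plug Z t ↓ ≡ wrap Z (clo Z t)
plug-↓ top        r = ≡.sym (subst-closed (env top) (r ↓))
plug-↓ (argZ t Z) r = plug-↓ Z (t · r)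
plug-↓ (funZ Z u) r = plug-↓ Z (r · u)
plug-↓ (esZ Z c)  r = trans (plug-↓ Z (r [← c ])) (cong (wrap Z) (clo-es Z r c))

→f-arg : ∀ {n} {t u : Term n} s → t →f u → s · t →f s · u
→f-arg s (step F t f) = step (argF s F) t f

→f-fun : ∀ {n} {t u f : Term n} → Fireball f → t →f u → t · f →f u · f
→f-fun f (step F t g) = step (funF F _ f) t g

wrap-→f : ∀ {m} (Z : Zip m) {r s} → Ready Z → r →f s → wrap Z r →f wrap Z s
wrap-→f top        y       s = s
wrap-→f (argZ t Z) y       s = wrap-→f Z y (→f-arg _ s)
wrap-→f (funZ Z u) (y , f) s = wrap-→f Z y (→f-fun f s)
wrap-→f (esZ Z c)  (y , _) s = wrap-→f Z y s

clo-rename : ∀ {m n} (Z : Zip m) (Z′ : Zip n) {ρ} → env Z′ ∘ ρ ≗ env Z →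
             ∀ t → clo Z′ (rename ρ t) ≡ clo Z t
clo-rename Z Z′ {ρ} h t = begin
  subst (env Z′) (rename ρ t ↓)   ≡⟨ cong (subst (env Z′)) (↓-rename ρ t) ⟩
  subst (env Z′) (rename ρ (t ↓)) ≡⟨ subst-rename (env Z′) ρ (t ↓) ⟩
  subst (env Z′ ∘ ρ) (t ↓)        ≡⟨ subst-cong h (t ↓) ⟩
  subst (env Z) (t ↓)             ∎
  where open ≡.≡-Reasoning

clo-weaken : ∀ {m} (Z : Zip m) c u → clo (esZ Z c) (weaken u) ≡ clo Z u
clo-weaken Z c = clo-rename Z (esZ Z c) (λ _ → refl)

env-unapp : ∀ {m} (Z : Zip m) → env (proj₁ (unapp Z)) ≗ env Z
env-unapp top        i       = refl
env-unapp (argZ t Z) i       = refl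
env-unapp (funZ Z u) i       = refl
env-unapp (esZ Z c)  zero    = subst-cong (env-unapp Z) (c ↓)
env-unapp (esZ Z c)  (suc i) = env-unapp Z i

unapp-ready : ∀ {m} (Z : Zip m) → Applied Z → Ready Z →
              let Z′ , u = unapp Z in Ready Z′ × Fireball (clo Z′ u)
unapp-ready (funZ Z u) a y = y
unapp-ready (esZ Z c) a (y , f) =
  let y′ , fu = unapp-ready Z a y in
  (y′ , ≡.subst Fireball (≡.sym (subst-cong (env-unapp Z) (c ↓))) f) ,
  ≡.subst Fireball (≡.sym (clo-weaken (proj₁ (unapp Z)) c (proj₂ (unapp Z)))) fu

wrap-unapp : ∀ {m} (Z : Zip m) → Applied Z → ∀ r →
             let Z′ , u = unapp Z in wrap Z r ≡ wrap Z′ (r · clo Z′ u)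
wrap-unapp (funZ Z u) a r = refl
wrap-unapp (esZ Z c)  a r = trans (wrap-unapp Z a r)
  (cong (λ s → wrap (proj₁ (unapp Z)) (r · s))
        (≡.sym (clo-weaken (proj₁ (unapp Z)) c (proj₂ (unapp Z)))))

-- Readiness makes the argument of the redex and all arguments to its right fireballs, so the
-- unfolded context is an evaluation context and the redex a legal one.
um-↓ : ∀ {m} (Z : Zip m) t → Applied Z → Ready Z →
       plug Z (lam t) ↓ →f contract Z (lam t) ↓
um-↓ Z t a y = ≡.subst₂ _→f_ (≡.sym lhs) (≡.sym rhs) (wrap-→f Z′ y′ (step hole _ fu))
  where
  Z′ = proj₁ (unapp Z)
  u = proj₂ (unapp Z)
  y′ = proj₁ (unapp-ready Z a y)
  fu = proj₂ (unapp-ready Z a y)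

  lhs : plug Z (lam t) ↓ ≡ wrap Z′ (lam (subst (liftSub (env Z)) (t ↓)) · clo Z′ u)
  lhs = trans (plug-↓ Z (lam t)) (wrap-unapp Z a _)

  eq : (clo Z′ u ∷ₛ env Z) ≗ env (esZ Z′ u)
  eq zero    = refl
  eq (suc i) = ≡.sym (env-unapp Z i)

  rhs : plug Z′ (t [← u ]) ↓ ≡ wrap Z′ (subst (liftSub (env Z)) (t ↓) ⟦ clo Z′ u ⟧)
  rhs = trans (plug-↓ (esZ Z′ u) t) (cong (wrap Z′)
    (≡.sym (trans (subst-single-liftSub (env Z) (clo Z′ u) (t ↓)) (subst-cong eq (t ↓)))))

-- What floating preserves: the closures of the old variables, the unfolded surroundings, and the
-- closure of the content. Substitution steps are invisible in the unfolding for this reason.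
record Faithful {m} (Z : Zip m) (s : Term 0) (F : Float m) : Set where
  constructor faithful
  open Float F
  field
    env≗     : env zip ∘ ren ≗ env Z
    wrap≗    : wrap zip ≗ wrap Z
    content≡ : clo zip content ≡ s

peel-faithful : ∀ {m} (Z : Zip m) c → Faithful Z (clo Z c) (peel Z c)
peel-faithful Z (var i)    = faithful (λ _ → refl) (λ _ → refl) refl
peel-faithful Z (sym a)    = faithful (λ _ → refl) (λ _ → refl) refl
peel-faithful Z (lam t)    = faithful (λ _ → refl) (λ _ → refl) refl
peel-faithful Z (t · u)    = faithful (λ _ → refl) (λ _ → refl) refl
peel-faithful Z (t [← c ]) =
  let faithful e w s = peel-faithful (esZ Z c) t in
  faithful (e ∘ suc) w (trans s (≡.sym (clo-es Z t c)))

float-faithful : ∀ {m} (Z : Zip m) i → Faithful Z (env Z i) (floatAt Z i)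
float-faithful (argZ t Z) i with floatAt Z i | float-faithful Z i
... | float Z′ ρ u | faithful e w s = faithful e
  (λ r → trans (cong (λ s → wrap Z′ (s · r)) (clo-rename Z Z′ e t)) (w _)) s
float-faithful (funZ Z a) i with floatAt Z i | float-faithful Z i
... | float Z′ ρ u | faithful e w s = faithful e
  (λ r → trans (cong (λ s → wrap Z′ (r · s)) (clo-rename Z Z′ e a)) (w _)) s
float-faithful (esZ Z c) zero with peel Z c | peel-faithful Z c
... | float Z′ ρ u | faithful e w s = faithful (λ { zero → s ; (suc i) → e i }) w
  (trans (clo-weaken Z′ u u) s)
float-faithful (esZ Z c) (suc i) with floatAt Z i | float-faithful Z i
... | float Z′ ρ u | faithful e w s =
  faithful (λ { zero → clo-rename Z Z′ e c ; (suc i) → e i }) w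
  (trans (clo-weaken Z′ (rename ρ c) u) s)

ue-↓ : ∀ {m} (Z : Zip m) i → plugFloat (floatAt Z i) ↓ ≡ plug Z (var i) ↓
ue-↓ Z i with floatAt Z i | float-faithful Z i
... | float Z′ ρ u | faithful e w s =
  trans (plug-↓ Z′ u) (trans (cong (wrap Z′) s) (trans (w (env Z i)) (≡.sym (plug-↓ Z (var i)))))

-- Node graphs

-- A node carries its number; a variable carries the number of its binder.  The
-- flag f of an explicit substitution is 0 if the content unfolds to an inert
-- term, and otherwise the length of the chain of variables leading from it to a
-- value.

data Node : Set where
  var sym : (p b : ℕ) → Node
  lam     : ℕ → Node → Node
  app     : ℕ → Node → Node → Node
  es      : (x f : ℕ) → Node → Node → Node

data NodeZip : Set where
  top : NodeZip
  arg : ℕ → Node → NodeZip → NodeZip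
  fun : (p f : ℕ) → NodeZip → Node → NodeZip
  es  : (x f : ℕ) → NodeZip → Node → NodeZip

root : Node → ℕ
root (var p b)    = p
root (sym p a)    = p
root (lam p t)    = p
root (app p t u)  = p
root (es x f t c) = x

-- 0 means inert and is not a length, so it is kept. Otherwise the variable lengthens the chain by
-- one, with an abstraction counting 1.
bump : ℕ → ℕ
bump zero    = zero
bump (suc f) = suc (suc f)

-- Meant for finished terms, where the head of every application is inert; hence 0 for applications.
flag : ∀ {n} → Vec ℕ n → ETerm n → ℕ
flag fs (var i)    = bump (lookup fs i)
flag fs (sym a)    = 0
flag fs (lam t)    = 1
flag fs (t · u)    = 0
flag fs (t [← c ]) = flag (flag fs c ∷ fs) t

data Code : ∀ {n} → Vec ℕ n → Node → Term n → Set where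
  var : ∀ {n p b} {bs : Vec ℕ n} {i} → lookup bs i ≡ b → Code bs (var p b) (var i)
  sym : ∀ {n p a} {bs : Vec ℕ n} → Code bs (sym p a) (sym a)
  lam : ∀ {n p t t′} {bs : Vec ℕ n} → Code (p ∷ bs) t t′ → Code bs (lam p t) (lam t′)
  app : ∀ {n p t t′ u u′} {bs : Vec ℕ n} → Code bs t t′ → Code bs u u′ →
        Code bs (app p t u) (t′ · u′)

-- m bounds the size of abstractions and R the flags.

data Done (m R : ℕ) : ∀ {n} → Vec ℕ n → Vec ℕ n → Node → ETerm n → Set where
  var : ∀ {n p b} {bs fs : Vec ℕ n} {i} → lookup bs i ≡ b → Done m R bs fs (var p b) (var i)
  sym : ∀ {n p a} {bs fs : Vec ℕ n} → Done m R bs fs (sym p a) (sym a)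
  lam : ∀ {n p t t′} {bs fs : Vec ℕ n} → Code (p ∷ bs) t t′ → ∣ lam t′ ∣ ≤ m →
        Done m R bs fs (lam p t) (lam (embed t′))
  app : ∀ {n p t t′ u u′} {bs fs : Vec ℕ n} → Done m R bs fs t t′ → flag fs t′ ≡ 0 →
        Done m R bs fs u u′ → Done m R bs fs (app p t u) (t′ · u′)
  es  : ∀ {n x f t t′ c c′} {bs fs : Vec ℕ n} → Done m R bs fs c c′ → f ≡ flag fs c′ → f ≤ R →
        Done m R (x ∷ bs) (f ∷ fs) t t′ → Done m R bs fs (es x f t c) (t′ [← c′ ])

-- A pending argument may have flag `suc R`, one more than a content: it becomes a content only in a
-- beta step, which raises R by one.
data Path-of (m R : ℕ) : ∀ {n} → Vec ℕ n → Vec ℕ n → NodeZip → Zip n → Set where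
  top : Path-of m R [] [] top top
  arg : ∀ {n p t t′ ν Z} {bs fs : Vec ℕ n} → Path-of m R bs fs ν Z → Code bs t t′ → ∣ t′ ∣ ≤ m →
        Path-of m R bs fs (arg p t ν) (argZ (embed t′) Z)
  fun : ∀ {n p f u u′ ν Z} {bs fs : Vec ℕ n} → Path-of m R bs fs ν Z → Done m R bs fs u u′ →
        f ≡ flag fs u′ → f ≤ suc R → Path-of m R bs fs (fun p f ν u) (funZ Z u′)
  es  : ∀ {n x f c c′ ν Z} {bs fs : Vec ℕ n} → Path-of m R bs fs ν Z → Done m R bs fs c c′ →
        f ≡ flag fs c′ → f ≤ R → Path-of m R (x ∷ bs) (f ∷ fs) (es x f ν c) (esZ Z c′)

-- Floating moves the indices of the old variables but neither the nodes of their binders nor their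
-- flags.
Extends : ∀ {m n} → (Fin m → Fin n) → Vec ℕ m → Vec ℕ n → Set
Extends ρ xs ys = lookup ys ∘ ρ ≗ lookup xs

extends-lift : ∀ {m n} {ρ : Fin m → Fin n} {xs ys} x → Extends ρ xs ys →
               Extends (lift 1 ρ) (x ∷ xs) (x ∷ ys)
extends-lift x h zero    = refl
extends-lift x h (suc i) = h i

flag-rename : ∀ {m n} {ρ : Fin m → Fin n} {fs gs} → Extends ρ fs gs →
              ∀ t → flag gs (rename ρ t) ≡ flag fs t
flag-rename h (var i) = cong bump (h i)
flag-rename h (sym a) = refl
flag-rename h (lam t) = refl
flag-rename h (t · u) = refl
flag-rename {ρ = ρ} {fs} {gs} h (t [← c ]) = trans
  (flag-rename (extends-lift (flag gs (rename ρ c)) h) t)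
  (cong (λ f → flag (f ∷ fs) t) (flag-rename h c))

∣rename∣ : ∀ {m n} (ρ : Fin m → Fin n) t → ∣ rename ρ t ∣ ≡ ∣ t ∣
∣rename∣ ρ (var i) = refl
∣rename∣ ρ (sym a) = refl
∣rename∣ ρ (lam t) = cong (_+ 1) (∣rename∣ (lift 1 ρ) t)
∣rename∣ ρ (t · u) = cong₂ (λ a b → a + b + 1) (∣rename∣ ρ t) (∣rename∣ ρ u)

code-rename : ∀ {m n} {ρ : Fin m → Fin n} {bs cs ν t} → Extends ρ bs cs →
              Code bs ν t → Code cs ν (rename ρ t)
code-rename h (var eq)  = var (trans (h _) eq)
code-rename h sym       = sym
code-rename h (lam t)   = lam (code-rename (extends-lift _ h) t)
code-rename h (app t u) = app (code-rename h t) (code-rename h u)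

done-rename : ∀ {m R k n} {ρ : Fin k → Fin n} {bs cs fs gs ν t} →
              Extends ρ bs cs → Extends ρ fs gs →
              Done m R bs fs ν t → Done m R cs gs ν (rename ρ t)
done-rename h g (var eq) = var (trans (h _) eq)
done-rename h g sym      = sym
done-rename {m} {R} {ρ = ρ} h g (lam {p = p} {t} {t′} c le) =
  ≡.subst (λ s → Done m R _ _ (lam p t) (lam s)) (embed-rename (lift 1 ρ) t′)
    (lam (code-rename (extends-lift p h) c) (≤-trans (≤-reflexive (∣rename∣ ρ (lam t′))) le))
done-rename h g (app {t′ = t′} t eq u) =
  app (done-rename h g t) (trans (flag-rename g t′) eq) (done-rename h g u)
done-rename h g (es {x = x} {f} {c′ = c′} c eq le t) =
  es (done-rename h g c) (trans eq (≡.sym (flag-rename g c′))) le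
     (done-rename (extends-lift x h) (extends-lift f g) t)

done-mono : ∀ {m R R′ n} {bs fs : Vec ℕ n} {ν t} → R ≤ R′ → Done m R bs fs ν t → Done m R′ bs fs ν t
done-mono le (var eq)      = var eq
done-mono le sym           = sym
done-mono le (lam c s)     = lam c s
done-mono le (app t eq u)  = app (done-mono le t) eq (done-mono le u)
done-mono le (es c eq s t) = es (done-mono le c) eq (≤-trans s le) (done-mono le t)

path-mono : ∀ {m R R′ n} {bs fs : Vec ℕ n} {ν Z} → R ≤ R′ →
            Path-of m R bs fs ν Z → Path-of m R′ bs fs ν Z
path-mono le top            = top
path-mono le (arg Z c s)    = arg (path-mono le Z) c s
path-mono le (fun Z u eq s) = fun (path-mono le Z) (done-mono le u) eq (≤-trans s (s≤s le))
path-mono le (es Z c eq s)  = es (path-mono le Z) (done-mono le c) eq (≤-trans s le)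

bump≤ : ∀ {f R} → f ≤ R → bump f ≤ suc R
bump≤ {zero}  le = z≤n
bump≤ {suc f} le = s≤s le

-- A variable adds one to some flag in scope and an abstraction has flag 1; contents inside the term
-- obey R as well. A beta step can thus raise the bound by at most one.
flag≤ : ∀ {m R n} {bs fs : Vec ℕ n} {ν t} → (∀ i → lookup fs i ≤ R) → Done m R bs fs ν t →
        flag fs t ≤ suc R
flag≤ h (var _)     = bump≤ (h _)
flag≤ h sym         = z≤n
flag≤ h (lam _ _)   = s≤s z≤n
flag≤ h (app _ _ _) = z≤n
flag≤ h (es _ refl le t) = flag≤ (λ { zero → le ; (suc i) → h i }) t

path-flags≤ : ∀ {m R n} {bs fs : Vec ℕ n} {ν Z} → Path-of m R bs fs ν Z → ∀ i → lookup fs i ≤ R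
path-flags≤ (arg Z _ _)   i       = path-flags≤ Z i
path-flags≤ (fun Z _ _ _) i       = path-flags≤ Z i
path-flags≤ (es Z _ _ le) zero    = le
path-flags≤ (es Z _ _ le) (suc i) = path-flags≤ Z i

Flagged : ℕ → Term 0 → Set
Flagged zero    s = Inert s
Flagged (suc f) s = Value s

flagged-fireball : ∀ {f s} → Flagged f s → Fireball s
flagged-fireball {zero}  i = inert i
flagged-fireball {suc f} v = value v

flagged-bump : ∀ {f s} → Flagged f s → Flagged (bump f) s
flagged-bump {zero}  i = i
flagged-bump {suc f} v = v

-- The soundness of the flags: a single comparison with 0 tells whether the unfolding is inert or a
-- value, without following the chain.
done-flagged : ∀ {m R n} {bs fs : Vec ℕ n} {ν t} (σ : Sub pure n 0) →
               (∀ i → Flagged (lookup fs i) (σ i)) →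
               Done m R bs fs ν t → Flagged (flag fs t) (subst σ (t ↓))
done-flagged σ h (var {i = i} _) = flagged-bump (h i)
done-flagged σ h sym         = sym _
done-flagged σ h (lam _ _)   = lam _
done-flagged {fs = fs} σ h (app {t′ = t′} t eq u) =
  ≡.subst (λ f → Flagged f (subst σ (t′ ↓))) eq (done-flagged σ h t) ·
  flagged-fireball (done-flagged σ h u)
done-flagged {fs = fs} σ h (es {t′ = t′} {c′ = c′} c refl _ t) =
  ≡.subst (Flagged (flag (flag fs c′ ∷ fs) t′)) (≡.sym (subst-⟦⟧ σ (t′ ↓) (c′ ↓)))
    (done-flagged (subst σ (c′ ↓) ∷ₛ σ)
      (λ { zero → done-flagged σ h c ; (suc i) → h i }) t)

path-flagged : ∀ {m R n} {bs fs : Vec ℕ n} {ν Z} → Path-of m R bs fs ν Z →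
               ∀ i → Flagged (lookup fs i) (env Z i)
path-flagged (arg Z _ _)      i       = path-flagged Z i
path-flagged (fun Z _ _ _)    i       = path-flagged Z i
path-flagged (es Z c refl _)  zero    = done-flagged _ (path-flagged Z) c
path-flagged (es Z c _ _)     (suc i) = path-flagged Z i

path-done-flagged : ∀ {m R n} {bs fs : Vec ℕ n} {ν Z μ t} → Path-of m R bs fs ν Z →
                    Done m R bs fs μ t → Flagged (flag fs t) (clo Z t)
path-done-flagged Z = done-flagged _ (path-flagged Z)

path-ready : ∀ {m R n} {bs fs : Vec ℕ n} {ν Z} → Path-of m R bs fs ν Z → Ready Z
path-ready top           = tt
path-ready (arg Z _ _)   = path-ready Z
path-ready (fun Z u _ _) = path-ready Z , flagged-fireball (path-done-flagged Z u)
path-ready (es Z c _ _)  = path-ready Z , flagged-fireball (path-done-flagged Z c)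

-- Nonzero when the hole is applied. It is a number because field 7 of the frame stores it and a
-- jump tests it.
kind : NodeZip → ℕ
kind top          = 0
kind (arg p t ν)  = 0
kind (fun p f ν u) = 1
kind (es x f ν c) = kind ν

path-applied : ∀ {m R n} {bs fs : Vec ℕ n} {ν Z} → Path-of m R bs fs ν Z → kind ν ≢ 0 → Applied Z
path-applied top           k = k refl
path-applied (arg Z _ _)   k = k refl
path-applied (fun Z _ _ _) k = tt
path-applied (es Z _ _ _)  k = path-applied Z k

-- Contractions on node graphs

record Split : Set where
  constructor split
  field
    outer : NodeZip
    node  : ℕ
    flg   : ℕ
    right : Node

open Split

es-split : (x f : ℕ) → Node → Split → Split
es-split x f c (split ν p g u) = split (es x f ν c) p g u

-- The graph versions of `unapp`, `peel` and `floatAt` rename nothing, since a variable names the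
-- node of its binder. Paths without the required frame get default values.
unappN : NodeZip → Split
unappN top           = split top 0 0 (var 0 0)
unappN (arg p t ν)   = split (arg p t ν) 0 0 (var 0 0)
unappN (fun p f ν u) = split ν p f u
unappN (es x f ν c)  = es-split x f c (unappN ν)

peelN : NodeZip → Node → NodeZip × Node
peelN ν (es x f t c) = peelN (es x f ν c) t
peelN ν t            = ν , t

floatN : ℕ → NodeZip → NodeZip × Node
floatN k       top           = top , var 0 0
floatN k       (arg p t ν)   = let ν′ , u = floatN k ν in arg p t ν′ , u
floatN k       (fun p f ν a) = let ν′ , u = floatN k ν in fun p f ν′ a , u
floatN zero    (es x f ν c)  = let ν′ , u = peelN ν c in es x f ν′ u , u
floatN (suc k) (es x f ν c)  = let ν′ , u = floatN k ν in es x f ν′ c , u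

unapp-path : ∀ {m R n} {bs fs : Vec ℕ n} {ν Z} → Path-of m R bs fs ν Z → kind ν ≢ 0 →
             Path-of m R bs fs (outer (unappN ν)) (proj₁ (unapp Z)) ×
             Done m R bs fs (right (unappN ν)) (proj₂ (unapp Z)) ×
             flg (unappN ν) ≡ flag fs (proj₂ (unapp Z)) × flg (unappN ν) ≤ suc R
unapp-path top k = ⊥-elim (k refl)
unapp-path (arg Z _ _) k = ⊥-elim (k refl)
unapp-path (fun Z u eq le) k = Z , u , eq , le
unapp-path {Z = esZ Z′ _} (es Z c eq le) k =
  let P , u , eq′ , le′ = unapp-path Z k in
  es P c eq le , done-rename (λ _ → refl) (λ _ → refl) u ,
  trans eq′ (≡.sym (flag-rename (λ _ → refl) (proj₂ (unapp Z′)))) , le′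

record Floated (m R : ℕ) {n} (bs fs : Vec ℕ n) (f : ℕ) (F : Float n) (N : NodeZip × Node) : Set where
  constructor floated
  open Float F
  field
    {binders flags} : Vec ℕ scope
    extends-b : Extends ren bs binders
    extends-f : Extends ren fs flags
    path      : Path-of m R binders flags (proj₁ N) zip
    done      : Done m R binders flags (proj₂ N) content
    flag≡     : flag flags content ≡ f
    ¬es       : ¬ IsES content

peel-path : ∀ {m R n} {bs fs : Vec ℕ n} {ν Z μ c} → Path-of m R bs fs ν Z →
            Done m R bs fs μ c → Floated m R bs fs (flag fs c) (peel Z c) (peelN ν μ)
peel-path Z (var eq)  = floated (λ _ → refl) (λ _ → refl) Z (var eq) refl (λ ())
peel-path Z sym       = floated (λ _ → refl) (λ _ → refl) Z sym refl (λ ())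
peel-path Z (lam c s) = floated (λ _ → refl) (λ _ → refl) Z (lam c s) refl (λ ())
peel-path Z (app t eq u) =
  floated (λ _ → refl) (λ _ → refl) Z (app t eq u) refl (λ ())
peel-path Z (es c refl s t) =
  let floated b f Z′ u eq ¬es = peel-path (es Z c refl s) t in
  floated (b ∘ suc) (f ∘ suc) Z′ u eq ¬es

rename-¬es : ∀ {m n} {ρ : Fin m → Fin n} {t} → ¬ IsES t → ¬ IsES (rename ρ t)
rename-¬es {t = t [← c ]} h _ = h (t , c , refl)

float-path : ∀ {m R n} {bs fs : Vec ℕ n} {ν Z} → Path-of m R bs fs ν Z → ∀ i →
             Floated m R bs fs (lookup fs i) (floatAt Z i) (floatN (toℕ i) ν)
float-path {Z = argZ _ Z} (arg {t′ = t} P c s) i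
  with floatAt Z i | float-path P i
... | float Z′ ρ u | floated b f P′ d eq ¬es =
  floated b f (≡.subst (λ t → Path-of _ _ _ _ _ (argZ t Z′)) (embed-rename ρ t)
    (arg P′ (code-rename b c) (≤-trans (≤-reflexive (∣rename∣ ρ t)) s))) d eq ¬es
float-path {Z = funZ Z _} (fun {u′ = a} P c e s) i
  with floatAt Z i | float-path P i
... | float Z′ ρ u | floated b f P′ d eq ¬es =
  floated b f (fun P′ (done-rename b f c) (trans e (≡.sym (flag-rename f a))) s) d eq ¬es
float-path {Z = esZ Z c′} (es {x = x} {g} P c refl s) zero
  with peel Z c′ | peel-path P c
... | float Z′ ρ u | floated b f P′ d eq ¬es =
  floated (extends-lift x b) (extends-lift g f) (es P′ d (≡.sym eq) s)
    (done-rename (λ _ → refl) (λ _ → refl) d) (trans (flag-rename (λ _ → refl) u) eq) (rename-¬es ¬es)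
float-path {Z = esZ Z c′} (es {x = x} {g} P c e s) (suc i)
  with floatAt Z i | float-path P i
... | float Z′ ρ u | floated b f P′ d eq ¬es =
  floated (extends-lift x b) (extends-lift g f)
    (es P′ (done-rename b f c) (trans e (≡.sym (flag-rename f c′))) s)
    (done-rename (λ _ → refl) (λ _ → refl) d) (trans (flag-rename (λ _ → refl) u) eq) (rename-¬es ¬es)

size : Node → ℕ
size (var p b)    = 1
size (sym p a)    = 1
size (lam p t)    = 1 + size t
size (app p t u)  = 1 + size t + size u
size (es x f t c) = 1 + size t + size c

code-size : ∀ {n} {bs : Vec ℕ n} {ν t} → Code bs ν t → size ν ≡ ∣ t ∣
code-size (var _)  = refl
code-size sym      = refl
code-size (lam t)  = trans (cong suc (code-size t)) (+-comm 1 _)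
code-size (app t u) = trans (cong₂ (λ a b → 1 + a + b) (code-size t) (code-size u)) (+-comm 1 _)

-- The number of transitions charged to the unexplored part of the term.

weight : NodeZip → ℕ
weight top           = 0
weight (arg p t ν)   = 3 * size t + 2 + weight ν
weight (fun p f ν u) = suc (weight ν)
weight (es x f ν c)  = weight ν

weight-unapp : ∀ ν → kind ν ≢ 0 → weight ν ≡ suc (weight (outer (unappN ν)))
weight-unapp top           k = ⊥-elim (k refl)
weight-unapp (arg p t ν)   k = ⊥-elim (k refl)
weight-unapp (fun p f ν u) k = refl
weight-unapp (es x f ν c)  k = weight-unapp ν k

weight-peel : ∀ ν t → weight (proj₁ (peelN ν t)) ≡ weight ν
weight-peel ν (var p b)    = refl
weight-peel ν (sym p a)    = refl
weight-peel ν (lam p t)    = refl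
weight-peel ν (app p t u)  = refl
weight-peel ν (es x f t c) = weight-peel (es x f ν c) t

-- Floating only rearranges finished contents, which carry no charge.
weight-float : ∀ k ν → weight (proj₁ (floatN k ν)) ≡ weight ν
weight-float k       top           = refl
weight-float k       (arg p t ν)   = cong (3 * size t + 2 +_) (weight-float k ν)
weight-float k       (fun p f ν u) = cong suc (weight-float k ν)
weight-float zero    (es x f ν c)  = weight-peel ν c
weight-float (suc k) (es x f ν c)  = weight-float k ν

kind-peel : ∀ ν t → kind (proj₁ (peelN ν t)) ≡ kind ν
kind-peel ν (var p b)    = refl
kind-peel ν (sym p a)    = refl
kind-peel ν (lam p t)    = refl
kind-peel ν (app p t u)  = refl
kind-peel ν (es x f t c) = kind-peel (es x f ν c) t

kind-float : ∀ k ν → kind (proj₁ (floatN k ν)) ≡ kind ν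
kind-float k       top           = refl
kind-float k       (arg p t ν)   = refl
kind-float k       (fun p f ν u) = refl
kind-float zero    (es x f ν c)  = kind-peel ν c
kind-float (suc k) (es x f ν c)  = kind-float k ν

-- Occurrence counts

-- Separation of nodes is expressed by occurrence counts bounded by 1, so that
-- rearranging a graph amounts to an equation between sums.

δ : ℕ → ℕ → ℕ
δ p i = if does (p ≟ i) then 1 else 0

δ-refl : ∀ p → δ p p ≡ 1
δ-refl p rewrite dec-true (p ≟ p) refl = refl

occ : Node → ℕ → ℕ
occ (var p b)    i = δ p i
occ (sym p a)    i = δ p i
occ (lam p t)    i = δ p i + occ t i
occ (app p t u)  i = δ p i + (occ t i + occ u i)
occ (es x f t c) i = δ x i + (occ t i + occ c i)

occZ : NodeZip → ℕ → ℕ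
occZ top           i = δ 0 i
occZ (arg p t ν)   i = δ p i + (occ t i + occZ ν i)
occZ (fun p f ν u) i = δ p i + (occ u i + occZ ν i)
occZ (es x f ν c)  i = δ x i + (occ c i + occZ ν i)

Separate : (ℕ → ℕ) → Set
Separate o = ∀ i → o i ≤ 1

δ-in : ∀ p {o} → 1 ≤ δ p p + o
δ-in p rewrite δ-refl p = s≤s z≤n

head-fresh : ∀ p {o} → δ p p + o ≤ 1 → o ≡ 0
head-fresh p {o} le rewrite δ-refl p with le
... | s≤s z≤n = refl

fresh₁ : ∀ {a b} → a + b ≡ 0 → a ≡ 0
fresh₁ {a} = m+n≡0⇒m≡0 a

fresh₂ : ∀ {a b} → a + b ≡ 0 → b ≡ 0
fresh₂ {a} = m+n≡0⇒n≡0 a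

sep₂ : ∀ {a b} → a + b ≤ 1 → b ≤ 1
sep₂ {a} = ≤-trans (m≤n+m _ a)

sep₁ : ∀ {a b} → a + b ≤ 1 → a ≤ 1
sep₁ = ≤-trans (m≤m+n _ _)

apart : ∀ {o : ℕ → ℕ} {i p} → 1 ≤ o i → o p ≡ 0 → i ≢ p
apart 1≤ 0≡ refl with ≤-trans 1≤ (≤-reflexive 0≡)
... | ()

clash : ∀ {a b} → a + b ≤ 1 → 1 ≤ a → b ≡ 0
clash {suc a} {zero} le 1≤ = refl
clash {suc a} {suc b} (s≤s le) 1≤ with ≤-trans (m≤n+m (suc b) a) le
... | ()

occ-root : ∀ t → 1 ≤ occ t (root t)
occ-root (var p b)    rewrite δ-refl p = ≤-refl
occ-root (sym p a)    rewrite δ-refl p = ≤-refl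
occ-root (lam p t)    = δ-in p
occ-root (app p t u)  = δ-in p
occ-root (es x f t c) = δ-in x

-- Node and field of the cell that points to the focus. Node 0 is not part of the term; its field 1
-- holds the pointer to the root.
slotB slotF : NodeZip → ℕ
slotB top           = 0
slotB (arg p t ν)   = p
slotB (fun p f ν u) = p
slotB (es x f ν c)  = x
slotF top           = 1
slotF (arg p t ν)   = 2
slotF (fun p f ν u) = 1
slotF (es x f ν c)  = 1

occ-slot : ∀ ν → 1 ≤ occZ ν (slotB ν)
occ-slot top           = ≤-refl
occ-slot (arg p t ν)   = δ-in p
occ-slot (fun p f ν u) = δ-in p
occ-slot (es x f ν c)  = δ-in x

slotF<8 : ∀ ν → slotF ν < 8
slotF<8 top           = s≤s (s≤s z≤n)
slotF<8 (arg p t ν)   = s≤s (s≤s (s≤s z≤n))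
slotF<8 (fun p f ν u) = s≤s (s≤s z≤n)
slotF<8 (es x f ν c)  = s≤s (s≤s z≤n)

-- A beta step loses the application node p and no other: the node of the abstraction is reused, so
-- separation survives and nothing is allocated.
occ-unapp : ∀ ν → kind ν ≢ 0 → ∀ i → let split μ p f u = unappN ν in
            occZ ν i ≡ δ p i + (occ u i + occZ μ i)
occ-unapp top           k i = ⊥-elim (k refl)
occ-unapp (arg p t ν)   k i = ⊥-elim (k refl)
occ-unapp (fun p f ν u) k i = refl
occ-unapp (es x f ν c)  k i = let split μ p _ u = unappN ν in trans
  (cong (λ o → δ x i + (occ c i + o)) (occ-unapp ν k i)) (perm (δ x i) (occ c i) (δ p i) (occ u i)
      (occZ μ i))
  where
  perm : ∀ a b c d e → a + (b + (c + (d + e))) ≡ c + (d + (a + (b + e)))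
  perm = solve-∀

occ-peel : ∀ ν t i → let ν′ , u = peelN ν t in occ u i + occZ ν′ i ≡ occ t i + occZ ν i
occ-peel ν (var p b)    i = refl
occ-peel ν (sym p a)    i = refl
occ-peel ν (lam p t)    i = refl
occ-peel ν (app p t u)  i = refl
occ-peel ν (es x f t c) i = trans (occ-peel (es x f ν c) t i) (perm (occ t i) (δ x i) (occ c i) _)
  where
  perm : ∀ a b c d → a + (b + (c + d)) ≡ b + (a + c) + d
  perm = solve-∀

occ-float : ∀ k ν i → occZ (proj₁ (floatN k ν)) i ≡ occZ ν i
occ-float k       top           i = refl
occ-float k       (arg p t ν)   i = cong (λ o → δ p i + (occ t i + o)) (occ-float k ν i)
occ-float k       (fun p f ν u) i = cong (λ o → δ p i + (occ u i + o)) (occ-float k ν i)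
occ-float zero    (es x f ν c)  i = cong (δ x i +_) (occ-peel ν c i)
occ-float (suc k) (es x f ν c)  i = cong (λ o → δ x i + (occ c i + o)) (occ-float k ν i)

update-same : ∀ M a v → (M [ a ≔ v ]) a ≡ v
update-same M a v rewrite dec-true (a ≟ a) refl = refl

update-other : ∀ M {a b} v → b ≢ a → (M [ a ≔ v ]) b ≡ M b
update-other M {a} {b} v ne rewrite dec-false (b ≟ a) ne = refl

-- Node layout

-- Node i occupies the eight cells from address i * 8 + β.  Beyond the tag and
-- the pointers of `Rep`, field 3 holds the address of the cell that points to
-- the node, field 4 the flag of the content or of the finished argument, field
-- 5 the address of the cell below the substitution context of that content,
-- and fields 6 and 7 the next frame and the kind of a frame.

module Layout (β : ℕ) where

  ad : ℕ → ℕ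
  ad i = i * 8 + β

  get : (ℕ → ℕ) → ℕ → ℕ → ℕ
  get M i f = M (ad i + f)

  put : (ℕ → ℕ) → ℕ → ℕ → ℕ → ℕ → ℕ
  put M i f v = M [ ad i + f ≔ v ]

  -- Once β is cancelled, the field is the remainder modulo 8 and the node the quotient.
  cell-injective : ∀ {i j f g} → f < 8 → g < 8 → ad i + f ≡ ad j + g → i ≡ j × f ≡ g
  cell-injective {i} {j} {f} {g} f< g< eq = i≡j , f≡g
    where
    shuffle : ∀ i f b → i * 8 + b + f ≡ f + i * 8 + b
    shuffle = solve-∀

    eq′ : f + i * 8 ≡ g + j * 8
    eq′ = +-cancelʳ-≡ β _ _ (trans (≡.sym (shuffle i f β)) (trans eq (shuffle j g β)))

    f≡g : f ≡ g
    f≡g = begin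
      f               ≡⟨ m<n⇒m%n≡m f< ⟨
      f % 8           ≡⟨ [m+kn]%n≡m%n f i 8 ⟨
      (f + i * 8) % 8 ≡⟨ cong (_% 8) eq′ ⟩
      (g + j * 8) % 8 ≡⟨ [m+kn]%n≡m%n g j 8 ⟩
      g % 8           ≡⟨ m<n⇒m%n≡m g< ⟩
      g               ∎
      where open ≡.≡-Reasoning

    i≡j : i ≡ j
    i≡j = *-cancelʳ-≡ i j 8 (+-cancelˡ-≡ f _ _ (trans eq′ (cong (_+ j * 8) (≡.sym f≡g))))

  put-same : ∀ M i f v → get (put M i f v) i f ≡ v
  put-same M i f v = update-same M (ad i + f) v

  put-field : ∀ M i {f g} v → g ≢ f → get (put M i f v) i g ≡ get M i g
  put-field M i v ne = update-other M v (ne ∘ +-cancelˡ-≡ (ad i) _ _)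

  put-node : ∀ M {i j f g} v → f < 8 → g < 8 → j ≢ i → get (put M i f v) j g ≡ get M j g
  put-node M v f< g< ne = update-other M v (ne ∘ proj₁ ∘ cell-injective g< f<)

  -- Forward pointers of abstractions, in field 2, are scratch space.

  record Agree (M M′ : ℕ → ℕ) (i : ℕ) : Set where
    constructor mk
    field on : ∀ g → g < 8 → (g ≡ 2 → get M i 0 ≢ 2) → get M′ i g ≡ get M i g

  record Same (M M′ : ℕ → ℕ) (i : ℕ) : Set where
    constructor mk
    field on : ∀ g → g < 8 → get M′ i g ≡ get M i g

  open Agree
  open Same

  same⇒agree : ∀ {M M′ i} → Same M M′ i → Agree M M′ i
  same⇒agree h = mk λ g g< _ → on h g g<

  same-trans : ∀ {M M′ M″ i} → Same M M′ i → Same M′ M″ i → Same M M″ i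
  same-trans h h′ = mk λ g g< → trans (on h′ g g<) (on h g g<)

  put-other : ∀ M {i f v} j → f < 8 → j ≢ i → Same M (put M i f v) j
  put-other M j f< ne = mk λ g g< → put-node M _ f< g< ne

  slot : NodeZip → ℕ
  slot ν = ad (slotB ν) + slotF ν

  -- Explicit substitutions are not frames of the search stack, so the machine leaves them behind
  -- without visiting them.
  frame : NodeZip → ℕ
  frame top           = ad 0
  frame (arg p t ν)   = ad p
  frame (fun p f ν u) = ad p
  frame (es x f ν c)  = frame ν

  bottomNode : ℕ → Node → ℕ
  bottomNode x (es y f t c) = bottomNode y t
  bottomNode x _            = x

  -- The cell in which a chain of explicit substitutions ends and to which something can be attached
  -- when the chain floats out; a is the answer for the empty chain.
  bottom : ℕ → Node → ℕ
  bottom a (es y f t c) = ad (bottomNode y t) + 1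
  bottom a _            = a

  BottomAt : (ℕ → ℕ) → ℕ → Node → Set
  BottomAt M a c@(es _ _ _ _) = M a ≡ bottom 0 c
  BottomAt M a _              = ⊤

  -- Inside a chain each explicit substitution knows the cell that points to it, because floating
  -- makes the chain a part of the path. The back pointer of the first one in a content is written
  -- at that moment.
  SlotAt : (ℕ → ℕ) → ℕ → Node → Set
  SlotAt M s (es y f t c) = get M y 3 ≡ s
  SlotAt M s _            = ⊤

  data Enc (M : ℕ → ℕ) : Node → Set where
    var : ∀ {p b} → get M p 0 ≡ 0 → get M p 1 ≡ ad b → Enc M (var p b)
    sym : ∀ {p a} → get M p 0 ≡ 1 → get M p 1 ≡ a → Enc M (sym p a)
    lam : ∀ {p t} → get M p 0 ≡ 2 → get M p 1 ≡ ad (root t) → Enc M t → Enc M (lam p t)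
    app : ∀ {p t u} → get M p 0 ≡ 3 → get M p 1 ≡ ad (root t) → get M p 2 ≡ ad (root u) →
          Enc M t → Enc M u → Enc M (app p t u)
    es  : ∀ {x f t c} → get M x 0 ≡ 4 → get M x 1 ≡ ad (root t) → get M x 2 ≡ ad (root c) →
          get M x 4 ≡ f → BottomAt M (ad x + 5) c → SlotAt M (ad x + 1) t →
          Enc M t → Enc M c → Enc M (es x f t c)

  data EncZ (M : ℕ → ℕ) : NodeZip → Set where
    top : get M 0 6 ≡ 0 → get M 0 7 ≡ 0 → EncZ M top
    arg : ∀ {p t ν} → get M p 0 ≡ 3 → get M p 1 ≡ ad (root t) → get M p 3 ≡ slot ν →
          get M p 6 ≡ frame ν → get M p 7 ≡ 0 → M (slot ν) ≡ ad p →
          Enc M t → EncZ M ν → EncZ M (arg p t ν)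
    fun : ∀ {p f u ν} → get M p 0 ≡ 3 → get M p 2 ≡ ad (root u) → get M p 3 ≡ slot ν →
          get M p 4 ≡ f → BottomAt M (ad p + 5) u →
          get M p 6 ≡ frame ν → get M p 7 ≡ 1 → M (slot ν) ≡ ad p →
          Enc M u → EncZ M ν → EncZ M (fun p f ν u)
    es  : ∀ {x f c ν} → get M x 0 ≡ 4 → get M x 2 ≡ ad (root c) → get M x 3 ≡ slot ν →
          get M x 4 ≡ f → BottomAt M (ad x + 5) c → M (slot ν) ≡ ad x →
          Enc M c → EncZ M ν → EncZ M (es x f ν c)

  bottomAt-cong : ∀ {M M′ a a′} c → M′ a′ ≡ M a → BottomAt M a c → BottomAt M′ a′ c
  bottomAt-cong (var p b)    eq h = tt
  bottomAt-cong (sym p a)    eq h = tt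
  bottomAt-cong (lam p t)    eq h = tt
  bottomAt-cong (app p t u)  eq h = tt
  bottomAt-cong (es x f t c) eq h = trans eq h

  slotAt-cong : ∀ {M M′ s} t → get M′ (root t) 3 ≡ get M (root t) 3 → SlotAt M s t → SlotAt M′ s t
  slotAt-cong (var p b)    eq h = tt
  slotAt-cong (sym p a)    eq h = tt
  slotAt-cong (lam p t)    eq h = tt
  slotAt-cong (app p t u)  eq h = tt
  slotAt-cong (es x f t c) eq h = trans eq h

  0<8 : 0 < 8
  0<8 = s≤s z≤n
  1<8 : 1 < 8
  1<8 = s≤s 0<7
    where 0<7 = s≤s z≤n
  2<8 : 2 < 8
  2<8 = s≤s (s≤s (s≤s z≤n))
  3<8 : 3 < 8
  3<8 = s≤s (s≤s (s≤s (s≤s z≤n)))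
  4<8 : 4 < 8
  4<8 = s≤s (s≤s (s≤s (s≤s (s≤s z≤n))))
  5<8 : 5 < 8
  5<8 = s≤s (s≤s (s≤s (s≤s (s≤s (s≤s z≤n)))))
  6<8 : 6 < 8
  6<8 = s≤s (s≤s (s≤s (s≤s (s≤s (s≤s (s≤s z≤n))))))
  7<8 : 7 < 8
  7<8 = ≤-refl

  module _ {M M′ : ℕ → ℕ} where
    agree : ∀ {i v} g → g < 8 → g ≢ 2 → Agree M M′ i → get M i g ≡ v → get M′ i g ≡ v
    agree g g< ne h eq = trans (on h g g< (⊥-elim ∘ ne)) eq

    agree₂ : ∀ {i v w} → Agree M M′ i → get M i 0 ≡ w → w ≢ 2 → get M i 2 ≡ v → get M′ i 2 ≡ v
    agree₂ h tag ne eq = trans (on h 2 2<8 (λ _ tag′ → ne (trans (≡.sym tag) tag′))) eq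

    enc-agree : ∀ {t} → (∀ i → 1 ≤ occ t i → Agree M M′ i) → Enc M t → Enc M′ t
    enc-agree {var p b} h (var e₀ e₁) = var (agree 0 0<8 (λ ()) a e₀) (agree 1 1<8 (λ ()) a e₁)
      where a = h p (occ-root (var p b))
    enc-agree {sym p b} h (sym e₀ e₁) = sym (agree 0 0<8 (λ ()) a e₀) (agree 1 1<8 (λ ()) a e₁)
      where a = h p (occ-root (sym p b))
    enc-agree {lam p t} h (lam e₀ e₁ r) =
      lam (agree 0 0<8 (λ ()) a e₀) (agree 1 1<8 (λ ()) a e₁)
          (enc-agree (λ i o → h i (m≤n⇒m≤o+n (δ p i) o)) r)
      where a = h p (δ-in p)
    enc-agree {app p t u} h (app e₀ e₁ e₂ r s) =
      app (agree 0 0<8 (λ ()) a e₀) (agree 1 1<8 (λ ()) a e₁) (agree₂ a e₀ (λ ()) e₂)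
          (enc-agree (λ i o → h i (m≤n⇒m≤o+n (δ p i) (m≤n⇒m≤n+o _ o))) r)
          (enc-agree (λ i o → h i (m≤n⇒m≤o+n (δ p i) (m≤n⇒m≤o+n (occ t i) o))) s)
      where a = h p (δ-in p)
    enc-agree {es x f t c} h (es e₀ e₁ e₂ e₄ b sl r s) =
      es (agree 0 0<8 (λ ()) a e₀) (agree 1 1<8 (λ ()) a e₁) (agree₂ a e₀ (λ ()) e₂)
         (agree 4 4<8 (λ ()) a e₄) (bottomAt-cong c (on a 5 5<8 (λ ())) b)
         (slotAt-cong t (on (ht (root t) (occ-root t)) 3 3<8 (λ ())) sl)
         (enc-agree ht r)
         (enc-agree (λ i o → h i (m≤n⇒m≤o+n (δ x i) (m≤n⇒m≤o+n (occ t i) o))) s)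
      where
      a = h x (δ-in x)
      ht : ∀ i → 1 ≤ occ t i → Agree M M′ i
      ht i o = h i (m≤n⇒m≤o+n (δ x i) (m≤n⇒m≤n+o _ o))

    slot-agree : ∀ {ν v} → EncZ M ν → Agree M M′ (slotB ν) → M (slot ν) ≡ v → M′ (slot ν) ≡ v
    slot-agree (top _ _)                  a eq = agree 1 1<8 (λ ()) a eq
    slot-agree (arg e₀ _ _ _ _ _ _ _)     a eq = agree₂ a e₀ (λ ()) eq
    slot-agree (fun _ _ _ _ _ _ _ _ _ _)  a eq = agree 1 1<8 (λ ()) a eq
    slot-agree (es _ _ _ _ _ _ _ _)       a eq = agree 1 1<8 (λ ()) a eq

    encZ-agree : ∀ {ν} → (∀ i → 1 ≤ occZ ν i → Agree M M′ i) → EncZ M ν → EncZ M′ ν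
    encZ-agree {top} h (top e₆ e₇) = top (agree 6 6<8 (λ ()) a e₆) (agree 7 7<8 (λ ()) a e₇)
      where a = h 0 (occ-slot top)
    encZ-agree {arg p t ν} h (arg e₀ e₁ e₃ e₆ e₇ esl r s) =
      arg (agree 0 0<8 (λ ()) a e₀) (agree 1 1<8 (λ ()) a e₁) (agree 3 3<8 (λ ()) a e₃)
          (agree 6 6<8 (λ ()) a e₆) (agree 7 7<8 (λ ()) a e₇)
          (slot-agree s (hν (slotB ν) (occ-slot ν)) esl)
          (enc-agree (λ i o → h i (m≤n⇒m≤o+n (δ p i) (m≤n⇒m≤n+o _ o))) r) (encZ-agree hν s)
      where
      a = h p (δ-in p)
      hν : ∀ i → 1 ≤ occZ ν i → Agree M M′ i
      hν i o = h i (m≤n⇒m≤o+n (δ p i) (m≤n⇒m≤o+n (occ t i) o))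
    encZ-agree {fun p f ν u} h (fun e₀ e₂ e₃ e₄ b e₆ e₇ esl r s) =
      fun (agree 0 0<8 (λ ()) a e₀) (agree₂ a e₀ (λ ()) e₂) (agree 3 3<8 (λ ()) a e₃)
          (agree 4 4<8 (λ ()) a e₄) (bottomAt-cong u (on a 5 5<8 (λ ())) b)
          (agree 6 6<8 (λ ()) a e₆) (agree 7 7<8 (λ ()) a e₇)
          (slot-agree s (hν (slotB ν) (occ-slot ν)) esl)
          (enc-agree (λ i o → h i (m≤n⇒m≤o+n (δ p i) (m≤n⇒m≤n+o _ o))) r) (encZ-agree hν s)
      where
      a = h p (δ-in p)
      hν : ∀ i → 1 ≤ occZ ν i → Agree M M′ i
      hν i o = h i (m≤n⇒m≤o+n (δ p i) (m≤n⇒m≤o+n (occ u i) o))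
    encZ-agree {es x f ν c} h (es e₀ e₂ e₃ e₄ b esl r s) =
      es (agree 0 0<8 (λ ()) a e₀) (agree₂ a e₀ (λ ()) e₂) (agree 3 3<8 (λ ()) a e₃)
         (agree 4 4<8 (λ ()) a e₄) (bottomAt-cong c (on a 5 5<8 (λ ())) b)
         (slot-agree s (hν (slotB ν) (occ-slot ν)) esl)
         (enc-agree (λ i o → h i (m≤n⇒m≤o+n (δ x i) (m≤n⇒m≤n+o _ o))) r) (encZ-agree hν s)
      where
      a = h x (δ-in x)
      hν : ∀ i → 1 ≤ occZ ν i → Agree M M′ i
      hν i o = h i (m≤n⇒m≤o+n (δ x i) (m≤n⇒m≤o+n (occ c i) o))

  module _ {M : ℕ → ℕ} where
    enc-put : ∀ {t p f v} → f < 8 → occ t p ≡ 0 → Enc M t → Enc (put M p f v) t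
    enc-put {t} f< fr = enc-agree λ i o → same⇒agree (put-other M i f< (apart {occ t} o fr))

    encZ-put : ∀ {ν p f v} → f < 8 → occZ ν p ≡ 0 → EncZ M ν → EncZ (put M p f v) ν
    encZ-put {ν} f< fr = encZ-agree λ i o → same⇒agree (put-other M i f< (apart {occZ ν} o fr))

    slot-put : ∀ ν {p f v} → f < 8 → occZ ν p ≡ 0 → put M p f v (slot ν) ≡ M (slot ν)
    slot-put ν f< fr =
      put-node M _ f< (slotF<8 ν) (apart {occZ ν} {slotB ν} (occ-slot ν) fr)

    -- No frame reads its own slot.

    encZ-slot : ∀ {ν v} → Separate (occZ ν) → EncZ M ν → EncZ (M [ slot ν ≔ v ]) ν
    encZ-slot {top} sep (top e₆ e₇) =
      top (trans (put-field M 0 _ (λ ())) e₆) (trans (put-field M 0 _ (λ ())) e₇)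
    encZ-slot {arg p t ν} sep (arg e₀ e₁ e₃ e₆ e₇ esl r s) =
      arg (trans (put-field M p _ (λ ())) e₀) (trans (put-field M p _ (λ ())) e₁)
          (trans (put-field M p _ (λ ())) e₃) (trans (put-field M p _ (λ ())) e₆)
          (trans (put-field M p _ (λ ())) e₇)
          (trans (slot-put ν 2<8 (fresh₂ {occ t p} fr)) esl) (enc-put 2<8 (fresh₁ fr) r)
          (encZ-put 2<8 (fresh₂ {occ t p} fr) s)
      where fr = head-fresh p (sep p)
    encZ-slot {fun p f ν u} sep (fun e₀ e₂ e₃ e₄ b e₆ e₇ esl r s) =
      fun (trans (put-field M p _ (λ ())) e₀) (trans (put-field M p _ (λ ())) e₂)
          (trans (put-field M p _ (λ ())) e₃) (trans (put-field M p _ (λ ())) e₄)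
          (bottomAt-cong u (put-field M p _ (λ ())) b)
          (trans (put-field M p _ (λ ())) e₆) (trans (put-field M p _ (λ ())) e₇)
          (trans (slot-put ν 1<8 (fresh₂ {occ u p} fr)) esl) (enc-put 1<8 (fresh₁ fr) r)
          (encZ-put 1<8 (fresh₂ {occ u p} fr) s)
      where fr = head-fresh p (sep p)
    encZ-slot {es x f ν c} sep (es e₀ e₂ e₃ e₄ b esl r s) =
      es (trans (put-field M x _ (λ ())) e₀) (trans (put-field M x _ (λ ())) e₂)
         (trans (put-field M x _ (λ ())) e₃) (trans (put-field M x _ (λ ())) e₄)
         (bottomAt-cong c (put-field M x _ (λ ())) b)
         (trans (slot-put ν 1<8 (fresh₂ {occ c x} fr)) esl) (enc-put 1<8 (fresh₁ fr) r)
         (encZ-put 1<8 (fresh₂ {occ c x} fr) s)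
      where fr = head-fresh x (sep x)

-- Destructive updates of node graphs

Writes : Set
Writes = List (ℕ × ℕ)

-- A Boolean test, so that for literal field numbers the premise of `puts-other` is settled by
-- evaluation.
inNode : Writes → Bool
inNode []             = true
inNode ((f , v) ∷ ws) = (f <ᵇ 8) ∧ inNode ws

written : Writes → ℕ → ℕ → ℕ
written []             g d = d
written ((f , v) ∷ ws) g d = written ws g (if does (g ≟ f) then v else d)

Sep : NodeZip → Node → Set
Sep ν t = Separate (λ i → occ t i + occZ ν i)

-- When the nearest application is removed, this node takes its place in the cell above; it is x
-- itself if no explicit substitution lies in between.
outermost : ℕ → NodeZip → ℕ
outermost x (es y f ν c) = outermost y ν
outermost x _            = x

below : NodeZip → NodeZip
below top           = top
below (arg p t ν)   = arg p t ν
below (fun p f ν u) = ν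
below (es x f ν c)  = below ν

-- Links a de Bruijn index to the node that the machine reaches at once through the binder pointer
-- of the variable.
data At : ℕ → NodeZip → (x f : ℕ) → NodeZip → Node → Set where
  here : ∀ {x f ν c} → At 0 (es x f ν c) x f ν c
  es   : ∀ {k x f ν c y g μ d} → At k ν x f μ d → At (suc k) (es y g ν c) x f μ d
  arg  : ∀ {k x f ν p t μ d} → At k ν x f μ d → At k (arg p t ν) x f μ d
  fun  : ∀ {k x f ν p g u μ d} → At k ν x f μ d → At k (fun p g ν u) x f μ d

path-at : ∀ {m R n} {bs fs : Vec ℕ n} {ν Z} → Path-of m R bs fs ν Z → ∀ i →
          ∃[ μ ] ∃[ c ] At (toℕ i) ν (lookup bs i) (lookup fs i) μ c
path-at (arg P _ _)   i       = let μ , c , a = path-at P i in μ , c , arg a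
path-at (fun P _ _ _) i       = let μ , c , a = path-at P i in μ , c , fun a
path-at (es P _ _ _)  zero    = _ , _ , here
path-at (es P _ _ _)  (suc i) = let μ , c , a = path-at P i in μ , c , es a

innermost : Node → Node
innermost (es x f t c) = innermost t
innermost t            = t

peel-innermost : ∀ ν t → proj₂ (peelN ν t) ≡ innermost t
peel-innermost ν (var p b)    = refl
peel-innermost ν (sym p a)    = refl
peel-innermost ν (lam p t)    = refl
peel-innermost ν (app p t u)  = refl
peel-innermost ν (es x f t c) = peel-innermost (es x f ν c) t

float-innermost : ∀ {k ν x f μ c} → At k ν x f μ c → proj₂ (floatN k ν) ≡ innermost c
float-innermost {c = c} (here {ν = ν}) = peel-innermost ν c
float-innermost (es a)  = float-innermost a
float-innermost (arg a) = float-innermost a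
float-innermost (fun a) = float-innermost a

occ-outermost : ∀ x f ν c → kind ν ≢ 0 →
                1 ≤ occZ (es x f (outer (unappN ν)) c) (outermost x ν)
occ-outermost x f top c k = δ-in x
occ-outermost x f (arg p t ν) c k = δ-in x
occ-outermost x f (fun p g ν u) c k = δ-in x
occ-outermost x f (es y g ν d) c k =
  m≤n⇒m≤o+n (δ x _) (m≤n⇒m≤o+n (occ c _) (occ-outermost y g ν d k))

occ-below : ∀ ν → kind ν ≢ 0 → 1 ≤ occZ (outer (unappN ν)) (slotB (below ν))
occ-below top           k = ⊥-elim (k refl)
occ-below (arg p t ν)   k = ⊥-elim (k refl)
occ-below (fun p f ν u) k = occ-slot ν
occ-below (es x f ν c)  k =
  m≤n⇒m≤o+n (δ x _) (m≤n⇒m≤o+n (occ c _) (occ-below ν k))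

module Update (β : ℕ) where
  open Layout β
  open Agree
  open Same

  puts : (ℕ → ℕ) → ℕ → Writes → ℕ → ℕ
  puts M i []             = M
  puts M i ((f , v) ∷ ws) = puts (put M i f v) i ws

  puts-at : ∀ M i ws g → get (puts M i ws) i g ≡ written ws g (get M i g)
  puts-at M i []             g = refl
  puts-at M i ((f , v) ∷ ws) g =
    trans (puts-at (put M i f v) i ws g) (cong (written ws g) at)
    where
    at : get (put M i f v) i g ≡ (if does (g ≟ f) then v else get M i g)
    at with g ≟ f
    ... | yes refl rewrite dec-true (g ≟ g) refl = put-same M i g v
    ... | no ne rewrite dec-false (g ≟ f) ne = put-field M i v ne

  puts-other : ∀ M {i} ws {_ : T (inNode ws)} j → j ≢ i → Same M (puts M i ws) j
  puts-other M []             j ne = mk λ _ _ → refl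
  puts-other M {i} ((f , v) ∷ ws) {ok} j ne with f <ᵇ 8 in eq
  ... | true = same-trans (put-other M j (<ᵇ⇒< f 8 (≡.subst T (≡.sym eq) tt)) ne)
                          (puts-other (put M i f v) ws {ok} j ne)

  cell-≢ : ∀ i j {f g} → f < 8 → g < 8 → f ≢ g → ad i + f ≢ ad j + g
  cell-≢ i j f< g< ne eq = ne (proj₂ (cell-injective {i} {j} f< g< eq))

  module _ {M : ℕ → ℕ} where

    enter-app : ∀ {ν p t u} → EncZ M ν → M (slot ν) ≡ ad p → Enc M (app p t u) → Sep ν (app p t u) →
      let M′ = puts M p ((3 , slot ν) ∷ (6 , frame ν) ∷ (7 , 0) ∷ []) in
      EncZ M′ (arg p t ν) × Enc M′ u × M′ (slot (arg p t ν)) ≡ ad (root u)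
    enter-app {ν} {p} {t} {u} z sl (app e₀ e₁ e₂ r s) sep =
      arg (trans (at 0) e₀) (trans (at 1) e₁) (at 3) (at 6) (at 7)
          (trans (on (same (slotB ν) (apart {occZ ν} (occ-slot ν) fν)) _ (slotF<8 ν)) sl)
          (enc-agree (λ i o → same⇒agree (same i (apart {occ t} o ft))) r)
          (encZ-agree (λ i o → same⇒agree (same i (apart {occZ ν} o fν))) z) ,
      enc-agree (λ i o → same⇒agree (same i (apart {occ u} o fu))) s , trans (at 2) e₂
      where
      ws = (3 , slot ν) ∷ (6 , frame ν) ∷ (7 , 0) ∷ []
      at = puts-at M p ws
      same = puts-other M {p} ws
      fr = head-fresh p (≤-trans (≤-reflexive (≡.sym (+-assoc (δ p p) _ (occZ ν p)))) (sep p))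
      ft = fresh₁ (fresh₁ fr)
      fu = fresh₂ {occ t p} (fresh₁ fr)
      fν = fresh₂ {occ t p + occ u p} fr

    -- The flag and the bottom of the finished argument are written into the application, from where
    -- the explicit substitution created by a later beta step inherits them.
    leave-arg : ∀ {ν p t u f b} → EncZ M (arg p t ν) → Enc M u → get M p 2 ≡ ad (root u) →
      Sep (arg p t ν) u → b ≡ bottom (ad p + 2) u →
      let M′ = puts M p ((4 , f) ∷ (5 , b) ∷ (7 , 1) ∷ []) in
      EncZ M′ (fun p f ν u) × Enc M′ t × M′ (slot (fun p f ν u)) ≡ ad (root t)
    leave-arg {ν} {p} {t} {u} {f} {b} (arg e₀ e₁ e₃ e₆ e₇ sl r z) s e₂ sep refl =
      fun (trans (at 0) e₀) (trans (at 2) e₂) (trans (at 3) e₃) (at 4)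
          (bot u) (trans (at 6) e₆) (at 7)
          (trans (on (same (slotB ν) (apart {occZ ν} (occ-slot ν) fν)) _ (slotF<8 ν)) sl)
          (enc-agree (λ i o → same⇒agree (same i (apart {occ u} o fu))) s)
          (encZ-agree (λ i o → same⇒agree (same i (apart {occZ ν} o fν))) z) ,
      enc-agree (λ i o → same⇒agree (same i (apart {occ t} o ft))) r , trans (at 1) e₁
      where
      ws = (4 , f) ∷ (5 , b) ∷ (7 , 1) ∷ []
      at = puts-at M p ws
      same = puts-other M {p} ws
      fu : occ u p ≡ 0
      fu = clash {δ p p + (occ t p + occZ ν p)}
             (≤-trans (≤-reflexive (+-comm _ (occ u p))) (sep p)) (δ-in p)
      fr = head-fresh p (sep₂ {occ u p} (sep p))
      ft = fresh₁ fr
      fν = fresh₂ {occ t p} fr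
      bot : ∀ u′ → BottomAt (puts M p ((4 , f) ∷ (5 , bottom (ad p + 2) u′) ∷ (7 , 1) ∷ []))
          (ad p + 5) u′
      bot (var q c)    = tt
      bot (sym q a)    = tt
      bot (lam q v)    = tt
      bot (app q v w)  = tt
      bot (es x g v c) = puts-at M p ((4 , f) ∷ (5 , bottom (ad p + 2) (es x g v c)) ∷ (7 , 1) ∷ []) 5

    record UnappRead (x : ℕ) (ν : NodeZip) : Set where
      constructor unappRead
      open Split (unappN ν) renaming (node to p; flg to f; right to u)
      field
        frame≡  : frame ν ≡ ad p
        left≡   : get M p 1 ≡ ad (outermost x ν)
        right≡  : get M p 2 ≡ ad (root u)
        slot≡   : get M p 3 ≡ slot (below ν)
        flag≡   : get M p 4 ≡ f
        bottom≡ : BottomAt M (ad p + 5) u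
        next≡   : get M p 6 ≡ frame (below ν)
        enc     : Enc M u

    unapp-read : ∀ {x ν} → kind ν ≢ 0 → EncZ M ν → M (slot ν) ≡ ad x → UnappRead x ν
    unapp-read k (top _ _) eq = ⊥-elim (k refl)
    unapp-read k (arg _ _ _ _ _ _ _ _) eq = ⊥-elim (k refl)
    unapp-read k (fun e₀ e₂ e₃ e₄ b e₆ e₇ sl r z) eq = unappRead refl eq e₂ e₃ e₄ b e₆ r
    unapp-read k (es e₀ e₂ e₃ e₄ b sl r z) eq =
      let unappRead a b c d e f g h = unapp-read k z sl in unappRead a b c d e f g h

    -- Applied when the abstraction has already become the frame of x. Two writes, one for each
    -- direction of the link, bypass the application however long the substitution context between
    -- them is.
    remove-app : ∀ {x f ν c} → kind ν ≢ 0 → EncZ M (es x f ν c) →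
      Separate (occZ (es x f (outer (unappN ν)) c)) →
      let y = outermost x ν ; s = slot (below ν) in
      EncZ (put M y 3 s [ s ≔ ad y ]) (es x f (outer (unappN ν)) c)
    remove-app {ν = top}       k _ _ = ⊥-elim (k refl)
    remove-app {ν = arg _ _ _} k _ _ = ⊥-elim (k refl)
    remove-app {x} {f} {fun p g ν u} {c} k (es e₀ e₂ e₃ e₄ b sl r (fun _ _ _ _ _ _ _ _ _ z)) sep =
      es (trans (at 0 0<8) (trans (put-field M x _ (λ ())) e₀))
         (trans (at 2 2<8) (trans (put-field M x _ (λ ())) e₂))
         (trans (at 3 3<8) (put-same M x 3 _))
         (trans (at 4 4<8) (trans (put-field M x _ (λ ())) e₄))
         (bottomAt-cong c (trans (at 5 5<8) (put-field M x _ (λ ()))) b)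
         (update-same (put M x 3 (slot ν)) (slot ν) (ad x))
         (enc-put (slotF<8 ν) fc (enc-put 3<8 (fresh₁ fr) r))
         (encZ-slot {put M x 3 (slot ν)} (λ i → sep₂ {occ c i} (sep₂ {δ x i} (sep i)))
             (encZ-put 3<8 (fresh₂ {occ c x} fr) z))
      where
      fr = head-fresh x (sep x)
      fc : occ c (slotB ν) ≡ 0
      fc = clash {occZ ν (slotB ν)} (≤-trans (≤-reflexive (+-comm _ (occ c (slotB ν))))
                                             (sep₂ {δ x (slotB ν)} (sep (slotB ν)))) (occ-slot ν)
      at : ∀ g → g < 8 → get (put M x 3 (slot ν) [ slot ν ≔ ad x ]) x g ≡ get (put M x 3 (slot ν)) x g
      at g g< = put-node (put M x 3 (slot ν)) _ (slotF<8 ν) g<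
          (λ eq → apart {occZ ν} (occ-slot ν) (fresh₂ {occ c x} fr) (≡.sym eq))
    remove-app {x} {f} {es z g ν d} {c} k (es e₀ e₂ e₃ e₄ b sl r w) sep =
      es (trans (at 0 0<8) e₀) (trans (at 2 2<8) e₂) (trans (at 3 3<8) e₃) (trans (at 4 4<8) e₄)
         (bottomAt-cong c (at 5 5<8) b) (trans slot≡ sl)
         (enc-agree (λ i o → same⇒agree (same i (apart {occ c} o fy) (apart {occ c} o fs))) r)
         (remove-app k w (λ i → sep₂ {occ c i} (sep₂ {δ x i} (sep i))))
      where
      y = outermost z ν
      s = slot (below ν)
      M′ = put M y 3 s [ s ≔ ad y ]
      inner = es z g (outer (unappN ν)) d
      y∈ : 1 ≤ occZ inner y
      y∈ = occ-outermost z g ν d k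
      s∈ : 1 ≤ occZ inner (slotB (below ν))
      s∈ = m≤n⇒m≤o+n (δ z _) (m≤n⇒m≤o+n (occ d _) (occ-below ν k))
      fr = fresh₂ {occ c x} (head-fresh x (sep x))
      fy : occ c y ≡ 0
      fy = clash (≤-trans (≤-reflexive (+-comm (occZ inner y) _)) (sep₂ {δ x y} (sep y))) y∈
      fs : occ c (slotB (below ν)) ≡ 0
      fs = clash (≤-trans (≤-reflexive (+-comm (occZ inner (slotB (below ν))) _))
                          (sep₂ {δ x (slotB (below ν))} (sep _))) s∈
      same : ∀ i → i ≢ y → i ≢ slotB (below ν) → Same M M′ i
      same i ≢y ≢s = same-trans (put-other M i 3<8 ≢y) (put-other _ i (slotF<8 (below ν)) ≢s)
      at : ∀ g → g < 8 → get M′ x g ≡ get M x g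
      at = on (same x (λ eq → apart {occZ inner} y∈ fr (≡.sym eq))
                      (λ eq → apart {occZ inner} s∈ fr (≡.sym eq)))
      z≢s : z ≢ slotB (below ν)
      z≢s eq = apart {occZ (outer (unappN ν))} (occ-below ν k)
        (fresh₂ {occ d z} (head-fresh z (sep₂ {occ c z} (sep₂ {δ x z} (sep z))))) (≡.sym eq)
      slot≡ : get M′ z 1 ≡ get M z 1
      slot≡ = trans (put-node (put M y 3 s) _ (slotF<8 (below ν)) 1<8 z≢s)
                    (update-other M s (cell-≢ z y 1<8 3<8 (λ ())))

-- Beta steps in memory and relinking of floating contexts

module Relinking (β : ℕ) where
  open Layout β
  open Agree
  open Same
  open Update β

  -- The chain starting at y is inserted between the cell s and the node x. Five writes suffice for
  -- any length, because its last cell has been recorded.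
  relink : (ℕ → ℕ) → ℕ → Node → ℕ → ℕ → ℕ
  relink M x c@(es y g t d) s =
    puts (put (M [ s ≔ ad y ]) y 3 s [ bottom 0 c ≔ ad x ]) x
         ((3 , bottom 0 c) ∷ (2 , ad (root (innermost c))) ∷ [])
  relink M x c s = M

  bottomAt-innermost : ∀ {M a} c → BottomAt M a (innermost c)
  bottomAt-innermost (var p b)    = tt
  bottomAt-innermost (sym p a)    = tt
  bottomAt-innermost (lam p t)    = tt
  bottomAt-innermost (app p t u)  = tt
  bottomAt-innermost (es x f t c) = bottomAt-innermost t

  bottom-node : ∀ y t → bottom (ad y + 1) t ≡ ad (bottomNode y t) + 1
  bottom-node y (var p b)    = refl
  bottom-node y (sym p a)    = refl
  bottom-node y (lam p t)    = refl
  bottom-node y (app p t u)  = refl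
  bottom-node y (es x f t c) = refl

  module _ {M : ℕ → ℕ} where

    -- Field 1 already points to the body and the variables already point to x. Only the tag and the
    -- fields that describe the content and its place are written, followed by the removal of the
    -- application.
    contract-lam : ∀ {x t ν} → kind ν ≢ 0 → EncZ M ν → M (slot ν) ≡ ad x → Enc M (lam x t) →
      Sep ν (lam x t) →
      let split μ p f u = unappN ν ; y = outermost x ν ; s = slot (below ν)
          M₁ = puts M x ((0 , 4) ∷ (2 , get M p 2) ∷ (3 , slot ν) ∷ (4 , get M p 4) ∷
              (5 , get M p 5) ∷ [])
          M′ = put M₁ y 3 s [ s ≔ ad y ]
      in EncZ M′ (es x f μ u) × Enc M′ t × get M′ x 1 ≡ ad (root t) × Sep (es x f μ u) t
    contract-lam {x} {t} {ν} k z sl (lam e₀ e₁ r) sep =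
      remove-app k (es (at 0) (trans (at 2) right≡) (at 3) (trans (at 4) flag≡)
                       (bottomAt-cong u (at 5) bottom≡)
                       (trans (on (same (slotB ν) (apart {occZ ν} (occ-slot ν) fν)) _ (slotF<8 ν)) sl)
                       (enc-agree (λ i o → same⇒agree (same i (apart {occ u} o fu))) enc)
                       (encZ-agree (λ i o → same⇒agree (same i (apart {occZ ν} o fν))) z))
        (λ i → sep₂ {occ t i} (sep′ i)) ,
      enc-agree (λ i o → same⇒agree (same-trans (same i (apart {occ t} o ft))
        (same-trans (put-other M₁ i 3<8 (apart {occ t} o (t∌ (occ-outermost x f ν u k))))
                    (put-other _ i (slotF<8 (below ν))
                       (apart {occ t} o (t∌ (m≤n⇒m≤o+n (δ x _)
                           (m≤n⇒m≤o+n (occ u _) (occ-below ν k)))))))))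
        r ,
      trans (put-node (put M₁ y 3 s) _ (slotF<8 (below ν)) 1<8
               (λ eq → apart {occZ μ} (occ-below ν k) fμ (≡.sym eq)))
            (trans (update-other M₁ s (cell-≢ x y 1<8 3<8 (λ ()))) (trans (at 1) e₁)) ,
      sep′
      where
      open Split (unappN ν) renaming (outer to μ; node to p; flg to f; right to u)
      open UnappRead (unapp-read {x = x} k z sl)
      y = outermost x ν
      s = slot (below ν)
      ws = (0 , 4) ∷ (2 , get M p 2) ∷ (3 , slot ν) ∷ (4 , get M p 4) ∷ (5 , get M p 5) ∷ []
      M₁ = puts M x ws
      at = puts-at M x ws
      same = puts-other M {x} ws
      fr = head-fresh x (≤-trans (≤-reflexive (≡.sym (+-assoc (δ x x) _ (occZ ν x)))) (sep x))
      ft = fresh₁ fr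
      fν = fresh₂ {occ t x} fr
      fuμ : occ u x + occZ μ x ≡ 0
      fuμ = fresh₂ {δ p x} (trans (≡.sym (occ-unapp ν k x)) fν)
      fu = fresh₁ fuμ
      fμ = fresh₂ {occ u x} fuμ
      perm : ∀ a b c d e → a + (b + (c + d)) + e ≡ b + a + (e + (c + d))
      perm = solve-∀
      sep′ : Sep (es x f μ u) t
      sep′ i = ≤-trans (m≤m+n _ (δ p i)) (≤-trans (≤-reflexive
        (trans (perm (occ t i) (δ x i) (occ u i) (occZ μ i) (δ p i))
               (cong (δ x i + occ t i +_) (≡.sym (occ-unapp ν k i))))) (sep i))
      t∌ : ∀ {i} → 1 ≤ occZ (es x f μ u) i → occ t i ≡ 0
      t∌ {i} o = clash (≤-trans (≤-reflexive (+-comm _ (occ t i))) (sep′ i)) o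

    -- A finished chain is stored as a path would be, back pointers included, so turning it into
    -- frames needs no write.
    peel-enc : ∀ ν t → EncZ M ν → Enc M t → M (slot ν) ≡ ad (root t) → SlotAt M (slot ν) t →
      let ν′ , u = peelN ν t in
      EncZ M ν′ × Enc M u × M (slot ν′) ≡ ad (root u) × slot ν′ ≡ bottom (slot ν) t × frame ν′ ≡ frame ν
    peel-enc ν (var p b)    z r sl _ = z , r , sl , refl , refl
    peel-enc ν (sym p a)    z r sl _ = z , r , sl , refl , refl
    peel-enc ν (lam p t)    z r sl _ = z , r , sl , refl , refl
    peel-enc ν (app p t u)  z r sl _ = z , r , sl , refl , refl
    peel-enc ν (es y f t c) z (es e₀ e₁ e₂ e₄ b s r q) sl s′ =
      let z′ , r′ , sl′ , bot , fr = peel-enc (es y f ν c) t (es e₀ e₂ s′ e₄ b sl q z) r e₁ s in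
      z′ , r′ , sl′ , trans bot (bottom-node y t) , fr

  -- `slot≡` and `frame≡` keep the registers of the machine valid; together with `focus≡` they
  -- re-establish the links of the frames that lie further in.
  record Relinked (M M′ : ℕ → ℕ) (ν ν′ : NodeZip) (u : Node) : Set where
    constructor relinked
    field
      encZ    : EncZ M′ ν′
      enc     : Enc M′ u
      slot≡   : slot ν′ ≡ slot ν
      frame≡  : frame ν′ ≡ frame ν
      focus≡  : M′ (slot ν) ≡ M (slot ν)
      outside : ∀ i → occZ ν i ≡ 0 → Same M M′ i

  relink-here : ∀ {M x f μ} c → EncZ M (es x f μ c) → Separate (occZ (es x f μ c)) →
    let μ′ , u = peelN μ c in
    Relinked M (relink M x c (slot μ)) (es x f μ c) (es x f μ′ u) (innermost c)
  relink-here (var p b)   z@(es _ _ _ _ _ _ r _) sep =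
    relinked z r refl refl refl (λ _ _ → mk λ _ _ → refl)
  relink-here (sym p a)   z@(es _ _ _ _ _ _ r _) sep =
    relinked z r refl refl refl (λ _ _ → mk λ _ _ → refl)
  relink-here (lam p t)   z@(es _ _ _ _ _ _ r _) sep =
    relinked z r refl refl refl (λ _ _ → mk λ _ _ → refl)
  relink-here (app p t u) z@(es _ _ _ _ _ _ r _) sep =
    relinked z r refl refl refl (λ _ _ → mk λ _ _ → refl)
  relink-here {M} {x} {f} {μ} c@(es y g t d) (es e₀ e₂ e₃ e₄ b sl (es a₀ a₁ a₂ a₄ ab as r q) z) sep =
    relinked
      (es (trans (at 0) (trans (at₃ 0 0<8) e₀)) (trans (at 2) (cong (ad ∘ root) (≡.sym u≡)))
          (trans (at 3) (≡.sym B≡))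
          (trans (at 4) (trans (at₃ 4 4<8) e₄)) (≡.subst (BottomAt M₄ (ad x + 5)) (≡.sym u≡)
              (bottomAt-innermost c))
          (trans (on (same₄ (slotB μ′) (apart {occZ μ′} (occ-slot μ′) (fresh₂ {occ u x} xfr′)))
                     (slotF μ′) (slotF<8 μ′)) slot₃)
          u₄ (encZ-agree (λ i o → same⇒agree (same₄ i (apart {occZ μ′} o (fresh₂ {occ u x} xfr′)))) z₃))
      (≡.subst (Enc M₄) u≡ u₄)
      refl fr≡ (trans (at 1) (at₃ 1 1<8)) outside
    where
    s = slot μ
    B = bottom 0 c
    μ′ = proj₁ (peelN μ c)
    u = proj₂ (peelN μ c)
    u≡ = peel-innermost μ c
    -- `M₂` hangs y on s, after which the chain is part of the path; `M₃` directs its last cell to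
    -- x, and `M₄` updates x itself.
    M₁ = M [ s ≔ ad y ]
    M₂ = put M₁ y 3 s
    M₃ = M₂ [ B ≔ ad x ]
    ws = (3 , B) ∷ (2 , ad (root (innermost c))) ∷ []
    M₄ = puts M₃ x ws
    at = puts-at M₃ x ws
    same₄ : ∀ i → i ≢ x → Same M₃ M₄ i
    same₄ = puts-other M₃ ws

    sep′ : ∀ i → δ x i + (occ u i + occZ μ′ i) ≤ 1
    sep′ i = ≡.subst (λ o → δ x i + o ≤ 1) (≡.sym (occ-peel μ c i)) (sep i)

    sepcμ : ∀ i → occ c i + occZ μ i ≤ 1
    sepcμ i = sep₂ {δ x i} (sep i)

    ∉c : ∀ {i} → 1 ≤ occZ μ i → occ c i ≡ 0
    ∉c {i} o = clash (≤-trans (≤-reflexive (+-comm _ (occ c i))) (sepcμ i)) o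

    fs : occ c (slotB μ) ≡ 0
    fs = ∉c (occ-slot μ)
    ftd = fresh₂ {δ y (slotB μ)} fs
    yfr : occ t y + occ d y + occZ μ y ≡ 0
    yfr = head-fresh y (≤-trans (≤-reflexive (≡.sym (+-assoc (δ y y) _ (occZ μ y)))) (sepcμ y))
    yμ = fresh₂ {occ t y + occ d y} yfr
    xfr = head-fresh x (sep x)
    xfr′ = head-fresh x (sep′ x)

    same₂ : ∀ i → i ≢ slotB μ → i ≢ y → Same M M₂ i
    same₂ i ≢s ≢y = same-trans (put-other M i (slotF<8 μ) ≢s) (put-other M₁ i 3<8 ≢y)

    aty : ∀ g → g < 8 → g ≢ 3 → get M₂ y g ≡ get M y g
    aty g g< ne = trans (put-field M₁ y s ne)
                        (put-node M _ (slotF<8 μ) g< (apart {occ c} (occ-root c) fs))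

    sameₜ : ∀ i → 1 ≤ occ t i → Same M M₂ i
    sameₜ i o = same₂ i (apart {occ t} o (fresh₁ ftd)) (apart {occ t} o (fresh₁ (fresh₁ yfr)))

    peeled : EncZ M₂ μ′ × Enc M₂ u × M₂ (slot μ′) ≡ ad (root u) ×
             slot μ′ ≡ bottom (ad y + 1) t × frame μ′ ≡ frame μ
    peeled = peel-enc (es y g μ d) t
      (es (trans (aty 0 0<8 (λ ())) a₀) (trans (aty 2 2<8 (λ ())) a₂) (put-same M₁ y 3 s)
          (trans (aty 4 4<8 (λ ())) a₄) (bottomAt-cong d (aty 5 5<8 (λ ())) ab)
          (trans (slot-put {M₁} μ 3<8 yμ) (update-same M s (ad y)))
          (enc-agree (λ i o → same⇒agree (same₂ i (apart {occ d} o (fresh₂ {occ t (slotB μ)} ftd))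
                                              (apart {occ d} o (fresh₂ {occ t y} (fresh₁ yfr))))) q)
          (encZ-put 3<8 yμ (encZ-slot (λ i → sep₂ {occ c i} (sepcμ i)) z)))
      (enc-agree (λ i o → same⇒agree (sameₜ i o)) r)
      (trans (aty 1 1<8 (λ ())) a₁)
      (slotAt-cong t (on (sameₜ (root t) (occ-root t)) 3 3<8) as)

    B≡ : slot μ′ ≡ B
    B≡ = trans (proj₁ (proj₂ (proj₂ (proj₂ peeled)))) (bottom-node y t)
    fr≡ = proj₂ (proj₂ (proj₂ (proj₂ peeled)))

    z₃ : EncZ M₃ μ′
    z₃ = ≡.subst (λ b → EncZ (M₂ [ b ≔ ad x ]) μ′) B≡
           (encZ-slot (λ i → sep₂ {occ u i} (sep₂ {δ x i} (sep′ i))) (proj₁ peeled))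

    slot₃ : M₃ (slot μ′) ≡ ad x
    slot₃ = ≡.subst (λ b → (M₂ [ b ≔ ad x ]) (slot μ′) ≡ ad x) B≡ (update-same M₂ (slot μ′) (ad x))

    same₃ : ∀ i → i ≢ slotB μ′ → Same M₂ M₃ i
    same₃ i ne = ≡.subst (λ b → Same M₂ (M₂ [ b ≔ ad x ]) i) B≡ (put-other M₂ i (slotF<8 μ′) ne)

    u₄ : Enc M₄ u
    u₄ = enc-agree (λ i o → same⇒agree (same-trans (same₃ i (apart {occ u} o fus))
                                                   (same₄ i (apart {occ u} o (fresh₁ xfr′)))))
                   (proj₁ (proj₂ peeled))
      where
      fus : occ u (slotB μ′) ≡ 0
      fus = clash (≤-trans (≤-reflexive (+-comm _ (occ u (slotB μ′)))) (sep₂ {δ x (slotB μ′)} (sep′ _)))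
                  (occ-slot μ′)

    at₃ : ∀ g → g < 8 → get M₃ x g ≡ get M x g
    at₃ g g< = trans
      (on (same₃ x (λ eq → apart {occZ μ′} (occ-slot μ′) (fresh₂ {occ u x} xfr′) (≡.sym eq))) g g<)
      (on (same₂ x (λ eq → apart {occZ μ} (occ-slot μ) (fresh₂ {occ c x} xfr) (≡.sym eq))
                   (λ eq → apart {occ c} (occ-root c) (fresh₁ xfr) (≡.sym eq))) g g<)

    outside : ∀ i → occZ (es x f μ c) i ≡ 0 → Same M M₄ i
    outside i o = same-trans (same-trans
      (same₂ i (λ eq → apart {occZ μ} (occ-slot μ) (fresh₂ {occ c i} oᵢ) (≡.sym eq))
               (λ eq → apart {occ c} (occ-root c) (fresh₁ oᵢ) (≡.sym eq)))
      (same₃ i (λ eq → apart {occZ μ′} (occ-slot μ′)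
        (fresh₂ {occ u i} (trans (occ-peel μ c i) oᵢ)) (≡.sym eq))))
      (same₄ i (λ eq → apart {occZ (es x f μ c)} {x} (δ-in x) o (≡.sym eq)))
      where oᵢ = fresh₂ {δ x i} o

  relink-at : ∀ {M k ν x f μ c} → At k ν x f μ c → EncZ M ν → Separate (occZ ν) →
              Relinked M (relink M x c (slot μ)) ν (proj₁ (floatN k ν)) (innermost c)
  relink-at {c = c} here z sep = relink-here c z sep
  relink-at {M} {k} {arg p t ν} {x} {μ = μ} {c} (arg a) (arg e₀ e₁ e₃ e₆ e₇ sl r z) sep =
    relinked
      (arg (trans (at 0 0<8) e₀) (trans (at 1 1<8) e₁) (trans (at 3 3<8) (trans e₃ (≡.sym slot≡)))
           (trans (at 6 6<8) (trans e₆ (≡.sym frame≡))) (trans (at 7 7<8) e₇)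
           (trans (cong M′ slot≡) (trans focus≡ sl))
           (enc-agree (λ i o → same⇒agree (outside i (clash {occ t i} (sep₂ {δ p i} (sep i)) o))) r)
               encZ)
      enc refl refl (at 2 2<8) (λ i o → outside i (fresh₂ {occ t i} (fresh₂ {δ p i} o)))
    where
    M′ = relink M x c (slot μ)
    open Relinked (relink-at a z (λ i → sep₂ {occ t i} (sep₂ {δ p i} (sep i))))
    at = on (outside p (fresh₂ {occ t p} (head-fresh p (sep p))))
  relink-at {M} {k} {fun p g ν u} {x} {μ = μ} {c} (fun a) (fun e₀ e₂ e₃ e₄ b e₆ e₇ sl r z) sep =
    relinked
      (fun (trans (at 0 0<8) e₀) (trans (at 2 2<8) e₂) (trans (at 3 3<8) (trans e₃ (≡.sym slot≡)))
           (trans (at 4 4<8) e₄) (bottomAt-cong u (at 5 5<8) b)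
           (trans (at 6 6<8) (trans e₆ (≡.sym frame≡))) (trans (at 7 7<8) e₇)
           (trans (cong M′ slot≡) (trans focus≡ sl))
           (enc-agree (λ i o → same⇒agree (outside i (clash {occ u i} (sep₂ {δ p i} (sep i)) o))) r)
               encZ)
      enc refl refl (at 1 1<8) (λ i o → outside i (fresh₂ {occ u i} (fresh₂ {δ p i} o)))
    where
    M′ = relink M x c (slot μ)
    open Relinked (relink-at a z (λ i → sep₂ {occ u i} (sep₂ {δ p i} (sep i))))
    at = on (outside p (fresh₂ {occ u p} (head-fresh p (sep p))))
  relink-at {M} {ν = es y g ν d} {x} {μ = μ} {c} (es a) (es e₀ e₂ e₃ e₄ b sl r z) sep =
    relinked
      (es (trans (at 0 0<8) e₀) (trans (at 2 2<8) e₂) (trans (at 3 3<8) (trans e₃ (≡.sym slot≡)))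
          (trans (at 4 4<8) e₄) (bottomAt-cong d (at 5 5<8) b)
          (trans (cong M′ slot≡) (trans focus≡ sl))
          (enc-agree (λ i o → same⇒agree (outside i (clash {occ d i} (sep₂ {δ y i} (sep i)) o))) r)
              encZ)
      enc refl frame≡ (at 1 1<8) (λ i o → outside i (fresh₂ {occ d i} (fresh₂ {δ y i} o)))
    where
    M′ = relink M x c (slot μ)
    open Relinked (relink-at a z (λ i → sep₂ {occ d i} (sep₂ {δ y i} (sep i))))
    at = on (outside y (fresh₂ {occ d y} (head-fresh y (sep y))))

-- The program

loadf storef : (r p f : ℕ) → Program
loadf r p f  = set 15 f ∷ add 15 p 15 ∷ load r 15 ∷ []
storef p f r = set 15 f ∷ add 15 p 15 ∷ store 15 r ∷ []

move allocate increase decrease : (r s : ℕ) → Program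
move r s     = set 15 0 ∷ add r 15 s ∷ []
allocate r s = set 15 8 ∷ add r 15 s ∷ []
increase r c = set 15 c ∷ add r 15 r ∷ []
decrease r c = set 15 c ∷ sub r r 15 ∷ []

offset : (r s c : ℕ) → Program
offset r s c = set 15 c ∷ add r s 15 ∷ []

goto : ℕ → Program
goto ℓ = set 15 0 ∷ jumpZero 15 ℓ ∷ []

-- Register 1 holds the number of steps left, 2 the next free address, 3 the
-- address of the cell that points to the focus, 4 the innermost frame, 5 the
-- address of node 0 and 9 the flag of the finished focus.  While copying, 6 is
-- the source, 7 the cell that receives the copy, and 8 the innermost application
-- of the copy whose argument is pending.

-- Labels are the offsets of the blocks in `program`.

copyℓ copyLamℓ copyIntoℓ copyVarℓ copyLocalℓ copyLeafℓ copyPopℓ downℓ downSymℓ downLamℓ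
  downVarℓ relinkℓ fetchℓ bumpℓ upℓ upArgℓ haltℓ : ℕ
copyℓ      = 20
copyLamℓ   = 52
copyIntoℓ  = 59
copyVarℓ   = 67
copyLocalℓ = 75
copyLeafℓ  = 78
copyPopℓ   = 87
downℓ      = 98
downSymℓ   = 131
downLamℓ   = 134
downVarℓ   = 183
relinkℓ    = 204
fetchℓ     = 222
bumpℓ      = 227
upℓ        = 229
upArgℓ     = 246
haltℓ      = 260

initCode : Program
initCode =
  offset 5 2 1 ++ set 14 0 ∷ storef 5 6 14 ++ storef 5 7 14 ++ move 6 0 ++ offset 7 5
  1 ++ offset 3 5 1 ++ move 4 5 ++ set 8 0 ∷ allocate 2 5 ++ []

-- The stack of the copier lives in the copy: field 3 of a new application holds the source of its
-- argument and field 6 the next pending application. Exploration overwrites both only later.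
copyCode : Program
copyCode =
  loadf 10 6 0 ++ loadf 11 6 1 ++ loadf 12 6 2 ++ move 13 10 ++ jumpZero 10 copyVarℓ ∷
  decrease 10 1 ++ jumpZero 10 copyLeafℓ ∷ decrease 10 1 ++ jumpZero 10 copyLamℓ ∷
  store 7 2 ∷ storef 2 0 13 ++ storef 2 3 12 ++ storef 2 6 8 ++ move 8 2 ++ goto
  copyIntoℓ ++ []

copyLamCode : Program
copyLamCode =
  store 7 2 ∷ storef 2 0 13 ++ storef 6 2 2 ++ []

copyIntoCode : Program
copyIntoCode =
  move 6 11 ++ offset 7 2 1 ++ allocate 2 2 ++ goto copyℓ ++ []

-- Evaluation being weak, the binder of a variable is either an abstraction within the source, whose
-- field 2 leads to its copy, or an explicit substitution outside, which is kept.
copyVarCode : Program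
copyVarCode =
  loadf 14 11 0 ++ decrease 14 2 ++ jumpZero 14 copyLocalℓ ∷ goto copyLeafℓ ++ []

copyLocalCode : Program
copyLocalCode =
  loadf 11 11 2 ++ []

copyLeafCode : Program
copyLeafCode =
  store 7 2 ∷ storef 2 0 13 ++ storef 2 1 11 ++ allocate 2 2 ++ []

copyPopCode : Program
copyPopCode =
  jumpZero 8 downℓ ∷ loadf 6 8 3 ++ offset 7 8 2 ++ loadf 8 8 6 ++ goto copyℓ ++ []

downCode : Program
downCode =
  load 10 3 ∷ loadf 11 10 0 ++ loadf 12 10 1 ++ loadf 16 4 7 ++ jumpZero 11 downVarℓ ∷
  decrease 11 1 ++ jumpZero 11 downSymℓ ∷ decrease 11 1 ++ jumpZero 11 downLamℓ ∷
  storef 10 3 3 ++ storef 10 6 4 ++ set 14 0 ∷ storef 10 7 14 ++ move 4 10 ++ offset 3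
  10 2 ++ goto downℓ ++ []

downSymCode : Program
downSymCode =
  set 9 0 ∷ goto upℓ ++ []

downLamCode : Program
downLamCode =
  set 9 1 ∷ jumpZero 16 upℓ ∷ jumpZero 1 haltℓ ∷ decrease 1 1 ++ loadf 11 4 1 ++ loadf
  12 4 2 ++ loadf 13 4 3 ++ loadf 14 4 4 ++ loadf 16 4 5 ++ loadf 17 4 6 ++ set 18 4 ∷
  storef 10 0 18 ++ storef 10 2 12 ++ storef 10 3 3 ++ storef 10 4 14 ++ storef 10 5
  16 ++ storef 11 3 13 ++ store 13 11 ∷ move 4 17 ++ offset 3 10 1 ++ goto downℓ ++ []

-- δ is what a substitution takes from the counter: 1 when it is a step of the derivation, 0 when
-- the derivation only counts beta steps.
downVarCode : ℕ → Program
downVarCode δ =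
  loadf 9 12 4 ++ jumpZero 9 upℓ ∷ jumpZero 16 bumpℓ ∷ jumpZero 1 haltℓ ∷ decrease 1 δ
  ++ loadf 11 12 2 ++ loadf 13 11 0 ++ set 15 4 ∷ sub 13 15 13 ∷ jumpZero 13 relinkℓ ∷
  move 6 11 ++ goto fetchℓ ++ []

relinkCode : Program
relinkCode =
  loadf 14 12 5 ++ load 6 14 ∷ loadf 16 12 3 ++ store 16 11 ∷ storef 11 3 16 ++ store
  14 12 ∷ storef 12 3 14 ++ storef 12 2 6 ++ []

fetchCode : Program
fetchCode =
  move 7 3 ++ set 8 0 ∷ goto copyℓ ++ []

bumpCode : Program
bumpCode =
  increase 9 1 ++ []

upCode : Program
upCode =
  loadf 10 4 6 ++ jumpZero 10 haltℓ ∷ loadf 11 4 7 ++ loadf 12 4 3 ++ jumpZero 11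
  upArgℓ ∷ move 3 12 ++ move 4 10 ++ goto upℓ ++ []

upArgCode : Program
upArgCode =
  storef 4 4 9 ++ storef 4 5 3 ++ set 14 1 ∷ storef 4 7 14 ++ offset 3 4 1 ++ goto
  downℓ ++ []

haltCode : Program
haltCode =
  offset 15 5 1 ++ load 0 15 ∷ []

program : ℕ → Program
program δ =
  initCode ++
  copyCode ++
  copyLamCode ++
  copyIntoCode ++
  copyVarCode ++
  copyLocalCode ++
  copyLeafCode ++
  copyPopCode ++
  downCode ++
  downSymCode ++
  downLamCode ++
  downVarCode δ ++
  relinkCode ++
  fetchCode ++
  bumpCode ++
  upCode ++
  upArgCode ++
  haltCode

-- Symbolic execution of the blocks

infix 4 _⊢_⟶[_]_

data _⊢_⟶[_]_ (P : Program) : Config → ℕ → Config → Set where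
  stay : ∀ {c} → P ⊢ c ⟶[ 0 ] c
  next : ∀ {c c′ k ι} → fetch P (pc c) ≡ just ι →
         P ⊢ exec ι c ⟶[ k ] c′ → P ⊢ c ⟶[ suc k ] c′

⟶-trans : ∀ {P c c′ c″ j k} → P ⊢ c ⟶[ j ] c′ → P ⊢ c′ ⟶[ k ] c″ → P ⊢ c ⟶[ j + k ] c″
⟶-trans stay       s′ = s′
⟶-trans (next f s) s′ = next f (⟶-trans s s′)

⟶-⇓ : ∀ {P c c′ c″ j k} → P ⊢ c ⟶[ j ] c′ → P ⊢ c′ ⇓[ k ] c″ → P ⊢ c ⇓[ j + k ] c″
⟶-⇓ stay       s′ = s′
⟶-⇓ (next f s) s′ = next f (⟶-⇓ s s′)

jump : ∀ {P l R M r ℓ k c} → fetch P l ≡ just (jumpZero r ℓ) → R r ≡ 0 →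
       P ⊢ ⟪ ℓ , R , M ⟫ ⟶[ k ] c → P ⊢ ⟪ l , R , M ⟫ ⟶[ suc k ] c
jump {P} {l} {R} {M} {r} {ℓ} {k} {c} f eq s =
  next f (≡.subst (λ b → P ⊢ ⟪ (if b then ℓ else suc l) , R , M ⟫ ⟶[ k ] c)
                  (≡.sym (dec-true (R r ≟ 0) eq)) s)

pass : ∀ {P l R M r ℓ k c} → fetch P l ≡ just (jumpZero r ℓ) → R r ≢ 0 →
       P ⊢ ⟪ suc l , R , M ⟫ ⟶[ k ] c → P ⊢ ⟪ l , R , M ⟫ ⟶[ suc k ] c
pass {P} {l} {R} {M} {r} {ℓ} {k} {c} f ne s =
  next f (≡.subst (λ b → P ⊢ ⟪ (if b then ℓ else suc l) , R , M ⟫ ⟶[ k ] c)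
                  (≡.sym (dec-false (R r ≟ 0) ne)) s)

-- No block executes more than 128 instructions.

record Run (P : Program) (l : ℕ) (R M : ℕ → ℕ) (l′ : ℕ) (M′ : ℕ → ℕ)
           (Q : (ℕ → ℕ) → Set) : Set where
  constructor run
  field
    {time} : ℕ
    {regs} : ℕ → ℕ
    steps  : P ⊢ ⟪ l , R , M ⟫ ⟶[ time ] ⟪ l′ , regs , M′ ⟫
    quick  : time ≤ 128
    post   : Q regs

suc-≢0 : ∀ {m n} → m ≡ suc n → m ≢ 0
suc-≢0 refl ()

Preserved Unmoved : (R R′ : ℕ → ℕ) → Set
Preserved R R′ = R′ 1 ≡ R 1 × R′ 3 ≡ R 3 × R′ 4 ≡ R 4 × R′ 5 ≡ R 5
Unmoved R R′ = R′ 1 ≡ R 1 × R′ 2 ≡ R 2 × R′ 3 ≡ R 3 × R′ 4 ≡ R 4 × R′ 5 ≡ R 5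

-- Register numbers and labels are literals, so execution is a computation. In every block the loads
-- precede the stores; all values read thus come from M, and premises are only needed for these
-- values and for the conditional jumps.
run-init : ∀ δ R M → let a = R 2 + 1 in
  Run (program δ) 0 R M copyℓ (M [ a + 6 ≔ 0 ] [ a + 7 ≔ 0 ]) λ R′ →
  R′ 1 ≡ R 1 × R′ 2 ≡ 8 + a × R′ 3 ≡ a + 1 × R′ 4 ≡ a × R′ 5 ≡ a ×
  R′ 6 ≡ R 0 × R′ 7 ≡ a + 1 × R′ 8 ≡ 0
run-init δ R M = run
  (next refl (next refl (next refl (next refl (next refl (next refl (next refl (next refl
   (next refl (next refl (next refl (next refl (next refl (next refl (next refl (next refl
   (next refl (next refl (next refl (next refl (stay)))))))))))))))))))))
  (≤ᵇ⇒≤ _ 128 tt) (refl , refl , refl , refl , refl , refl , refl , refl)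

run-copy-app : ∀ δ R M {q s d w τ u} → R 2 ≡ q → R 6 ≡ s → R 7 ≡ d → R 8 ≡ w →
  M (s + 0) ≡ τ → M (s + 2) ≡ u → τ ≡ 3 →
  Run (program δ) copyℓ R M copyℓ (M [ d ≔ q ] [ q + 0 ≔ τ ] [ q + 3 ≔ u ] [ q + 6 ≔ w ]) λ R′ →
  Preserved R R′ × R′ 2 ≡ 8 + q × R′ 6 ≡ M (s + 1) × R′ 7 ≡ q + 1 × R′ 8 ≡ q
run-copy-app δ R M refl refl refl refl refl refl tag = run
  (next refl (next refl (next refl (next refl (next refl (next refl (next refl (next refl
   (next refl (next refl (next refl (pass refl (suc-≢0 tag) (next refl (next refl (pass
   refl (suc-≢0 (cong (_∸ 1) tag)) (next refl (next refl (pass refl (suc-≢0 (cong (λ n → n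
   ∸ 1 ∸ 1) tag)) (next refl (next refl (next refl (next refl (next refl (next refl (next
   refl (next refl (next refl (next refl (next refl (next refl (next refl (next refl (next
   refl (next refl (next refl (next refl (next refl (next refl (next refl (next refl
   (stay)))))))))))))))))))))))))))))))))))))))))
  (≤ᵇ⇒≤ _ 128 tt) ((refl , refl , refl , refl) , refl , refl , refl , refl)

run-copy-lam : ∀ δ R M {q s d w τ} → R 2 ≡ q → R 6 ≡ s → R 7 ≡ d → R 8 ≡ w →
  M (s + 0) ≡ τ → τ ≡ 2 →
  Run (program δ) copyℓ R M copyℓ (M [ d ≔ q ] [ q + 0 ≔ τ ] [ s + 2 ≔ q ]) λ R′ →
  Preserved R R′ × R′ 2 ≡ 8 + q × R′ 6 ≡ M (s + 1) × R′ 7 ≡ q + 1 × R′ 8 ≡ w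
run-copy-lam δ R M refl refl refl refl refl tag = run
  (next refl (next refl (next refl (next refl (next refl (next refl (next refl (next refl
   (next refl (next refl (next refl (pass refl (suc-≢0 tag) (next refl (next refl (pass
   refl (suc-≢0 (cong (_∸ 1) tag)) (next refl (next refl (jump refl (cong (λ n → n ∸ 1 ∸
   1) tag) (next refl (next refl (next refl (next refl (next refl (next refl (next refl
   (next refl (next refl (next refl (next refl (next refl (next refl (next refl (next refl
   (stay))))))))))))))))))))))))))))))))))
  (≤ᵇ⇒≤ _ 128 tt) ((refl , refl , refl , refl) , refl , refl , refl , refl)

run-copy-sym : ∀ δ R M {q s d w τ v} → R 2 ≡ q → R 6 ≡ s → R 7 ≡ d → R 8 ≡ w →
  M (s + 0) ≡ τ → M (s + 1) ≡ v → τ ≡ 1 →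
  Run (program δ) copyℓ R M copyPopℓ (M [ d ≔ q ] [ q + 0 ≔ τ ] [ q + 1 ≔ v ]) λ R′ →
  Preserved R R′ × R′ 2 ≡ 8 + q × R′ 8 ≡ w
run-copy-sym δ R M refl refl refl refl refl refl tag = run
  (next refl (next refl (next refl (next refl (next refl (next refl (next refl (next refl
   (next refl (next refl (next refl (pass refl (suc-≢0 tag) (next refl (next refl (jump
   refl (cong (_∸ 1) tag) (next refl (next refl (next refl (next refl (next refl (next
   refl (next refl (next refl (next refl (stay)))))))))))))))))))))))))
  (≤ᵇ⇒≤ _ 128 tt) ((refl , refl , refl , refl) , refl , refl)

run-copy-free : ∀ δ R M {q s d w τ b} → R 2 ≡ q → R 6 ≡ s → R 7 ≡ d → R 8 ≡ w →
  M (s + 0) ≡ τ → M (s + 1) ≡ b → τ ≡ 0 → M (b + 0) ≡ 4 →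
  Run (program δ) copyℓ R M copyPopℓ (M [ d ≔ q ] [ q + 0 ≔ τ ] [ q + 1 ≔ b ]) λ R′ →
  Preserved R R′ × R′ 2 ≡ 8 + q × R′ 8 ≡ w
run-copy-free δ R M refl refl refl refl refl refl tag tag′ = run
  (next refl (next refl (next refl (next refl (next refl (next refl (next refl (next refl
   (next refl (next refl (next refl (jump refl (tag) (next refl (next refl (next refl
   (next refl (next refl (pass refl (suc-≢0 (cong (_∸ 2) tag′)) (next refl (next refl
   (next refl (next refl (next refl (next refl (next refl (next refl (next refl (next refl
   (next refl (stay))))))))))))))))))))))))))))))
  (≤ᵇ⇒≤ _ 128 tt) ((refl , refl , refl , refl) , refl , refl)

run-copy-bound : ∀ δ R M {q s d w τ b c} → R 2 ≡ q → R 6 ≡ s → R 7 ≡ d → R 8 ≡ w →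
  M (s + 0) ≡ τ → M (s + 1) ≡ b → M (b + 2) ≡ c → τ ≡ 0 → M (b + 0) ≡ 2 →
  Run (program δ) copyℓ R M copyPopℓ (M [ d ≔ q ] [ q + 0 ≔ τ ] [ q + 1 ≔ c ]) λ R′ →
  Preserved R R′ × R′ 2 ≡ 8 + q × R′ 8 ≡ w
run-copy-bound δ R M refl refl refl refl refl refl refl tag tag′ = run
  (next refl (next refl (next refl (next refl (next refl (next refl (next refl (next refl
   (next refl (next refl (next refl (jump refl (tag) (next refl (next refl (next refl
   (next refl (next refl (jump refl (cong (_∸ 2) tag′) (next refl (next refl (next refl
   (next refl (next refl (next refl (next refl (next refl (next refl (next refl (next refl
   (next refl (stay)))))))))))))))))))))))))))))))
  (≤ᵇ⇒≤ _ 128 tt) ((refl , refl , refl , refl) , refl , refl)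

run-pop : ∀ δ R M {w} → R 8 ≡ w → w ≢ 0 → Run (program δ) copyPopℓ R M copyℓ M λ R′ →
  Preserved R R′ × R′ 2 ≡ R 2 × R′ 6 ≡ M (w + 3) × R′ 7 ≡ w + 2 × R′ 8 ≡ M (w + 6)
run-pop δ R M refl ne = run
  (pass refl (ne) (next refl (next refl (next refl (next refl (next refl (next refl (next
   refl (next refl (next refl (next refl (stay))))))))))))
  (≤ᵇ⇒≤ _ 128 tt) ((refl , refl , refl , refl) , refl , refl , refl , refl)

run-pop-end : ∀ δ R M → R 8 ≡ 0 → Run (program δ) copyPopℓ R M downℓ M (_≡ R)
run-pop-end δ R M eq = run
  (jump refl (eq) (stay))
  (≤ᵇ⇒≤ _ 128 tt) (refl)

run-down-app : ∀ δ R M {q s p} → R 3 ≡ s → R 4 ≡ p → M s ≡ q → M (q + 0) ≡ 3 →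
  Run (program δ) downℓ R M downℓ (M [ q + 3 ≔ s ] [ q + 6 ≔ p ] [ q + 7 ≔ 0 ]) λ R′ →
  R′ 1 ≡ R 1 × R′ 2 ≡ R 2 × R′ 3 ≡ q + 2 × R′ 4 ≡ q × R′ 5 ≡ R 5
run-down-app δ R M refl refl refl tag = run
  (next refl (next refl (next refl (next refl (next refl (next refl (next refl (next refl
   (next refl (next refl (pass refl (suc-≢0 tag) (next refl (next refl (pass refl (suc-≢0
   (cong (_∸ 1) tag)) (next refl (next refl (pass refl (suc-≢0 (cong (λ n → n ∸ 1 ∸ 1)
   tag)) (next refl (next refl (next refl (next refl (next refl (next refl (next refl
   (next refl (next refl (next refl (next refl (next refl (next refl (next refl (next refl
   (next refl (stay))))))))))))))))))))))))))))))))))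
  (≤ᵇ⇒≤ _ 128 tt) (refl , refl , refl , refl , refl)

run-down-sym : ∀ δ R M {q a} → R 3 ≡ a → M a ≡ q → M (q + 0) ≡ 1 →
    Run (program δ) downℓ R M upℓ M λ R′ →
  Unmoved R R′ × R′ 9 ≡ 0
run-down-sym δ R M refl refl tag = run
  (next refl (next refl (next refl (next refl (next refl (next refl (next refl (next refl
   (next refl (next refl (pass refl (suc-≢0 tag) (next refl (next refl (jump refl (cong
   (_∸ 1) tag) (next refl (next refl (next refl (stay))))))))))))))))))
  (≤ᵇ⇒≤ _ 128 tt) ((refl , refl , refl , refl , refl) , refl)

run-down-lam : ∀ δ R M {q a p} → R 3 ≡ a → R 4 ≡ p → M a ≡ q → M (q + 0) ≡ 2 → M (p + 7) ≡ 0 →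
  Run (program δ) downℓ R M upℓ M λ R′ → Unmoved R R′ × R′ 9 ≡ 1
run-down-lam δ R M refl refl refl tag kind = run
  (next refl (next refl (next refl (next refl (next refl (next refl (next refl (next refl
   (next refl (next refl (pass refl (suc-≢0 tag) (next refl (next refl (pass refl (suc-≢0
   (cong (_∸ 1) tag)) (next refl (next refl (jump refl (cong (λ n → n ∸ 1 ∸ 1) tag) (next
   refl (jump refl (kind) (stay))))))))))))))))))))
  (≤ᵇ⇒≤ _ 128 tt) ((refl , refl , refl , refl , refl) , refl)

run-stop-lam : ∀ δ R M {q a p} → R 3 ≡ a → R 4 ≡ p → M a ≡ q → M (q + 0) ≡ 2 → M (p + 7) ≢ 0 → R 1 ≡ 0 →
  Run (program δ) downℓ R M haltℓ M λ R′ → R′ 5 ≡ R 5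
run-stop-lam δ R M refl refl refl tag kind stop = run
  (next refl (next refl (next refl (next refl (next refl (next refl (next refl (next refl
   (next refl (next refl (pass refl (suc-≢0 tag) (next refl (next refl (pass refl (suc-≢0
   (cong (_∸ 1) tag)) (next refl (next refl (jump refl (cong (λ n → n ∸ 1 ∸ 1) tag) (next
   refl (pass refl (kind) (jump refl (stop) (stay)))))))))))))))))))))
  (≤ᵇ⇒≤ _ 128 tt) (refl)

run-um : ∀ δ R M {q a p y s} → R 3 ≡ a → R 4 ≡ p → M a ≡ q → M (q + 0) ≡ 2 → M (p + 7) ≢ 0 →
  R 1 ≢ 0 → M (p + 1) ≡ y → M (p + 3) ≡ s →
  Run (program δ) downℓ R M downℓ
    (M [ q + 0 ≔ 4 ] [ q + 2 ≔ M (p + 2) ] [ q + 3 ≔ a ] [ q + 4 ≔ M (p + 4) ] [ q + 5 ≔ M (p + 5) ]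
       [ y + 3 ≔ s ] [ s ≔ y ]) λ R′ →
  R′ 1 ≡ R 1 ∸ 1 × R′ 2 ≡ R 2 × R′ 3 ≡ q + 1 × R′ 4 ≡ M (p + 6) × R′ 5 ≡ R 5
run-um δ R M refl refl refl tag kind more refl refl = run
  (next refl (next refl (next refl (next refl (next refl (next refl (next refl (next refl
   (next refl (next refl (pass refl (suc-≢0 tag) (next refl (next refl (pass refl (suc-≢0
   (cong (_∸ 1) tag)) (next refl (next refl (jump refl (cong (λ n → n ∸ 1 ∸ 1) tag) (next
   refl (pass refl (kind) (pass refl (more) (next refl (next refl (next refl (next refl
   (next refl (next refl (next refl (next refl (next refl (next refl (next refl (next refl
   (next refl (next refl (next refl (next refl (next refl (next refl (next refl (next refl
   (next refl (next refl (next refl (next refl (next refl (next refl (next refl (next refl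
   (next refl (next refl (next refl (next refl (next refl (next refl (next refl (next refl
   (next refl (next refl (next refl (next refl (next refl (next refl (next refl (next refl
   (next refl (next refl
   (stay)))))))))))))))))))))))))))))))))))))))))))))))))))))))))))))))))))
  (≤ᵇ⇒≤ _ 128 tt) (refl , refl , refl , refl , refl)

run-down-inert : ∀ δ R M {q b a} → R 3 ≡ a → M a ≡ q → M (q + 0) ≡ 0 → M (q + 1) ≡ b → M (b + 4) ≡ 0 →
  Run (program δ) downℓ R M upℓ M λ R′ → Unmoved R R′ × R′ 9 ≡ 0
run-down-inert δ R M refl refl tag refl flag = run
  (next refl (next refl (next refl (next refl (next refl (next refl (next refl (next refl
   (next refl (next refl (jump refl (tag) (next refl (next refl (next refl (jump refl
   (flag) (stay))))))))))))))))
  (≤ᵇ⇒≤ _ 128 tt) ((refl , refl , refl , refl , refl) , flag)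

run-down-value : ∀ δ R M {q b f a p} → R 3 ≡ a → R 4 ≡ p → M a ≡ q → M (q + 0) ≡ 0 → M (q + 1) ≡ b →
    M (b + 4) ≡ suc f →
  M (p + 7) ≡ 0 → Run (program δ) downℓ R M upℓ M λ R′ → Unmoved R R′ × R′ 9 ≡ suc (suc f)
run-down-value δ R M refl refl refl tag refl flag kind = run
  (next refl (next refl (next refl (next refl (next refl (next refl (next refl (next refl
   (next refl (next refl (jump refl (tag) (next refl (next refl (next refl (pass refl
   (suc-≢0 flag) (jump refl (kind) (next refl (next refl (stay)))))))))))))))))))
  (≤ᵇ⇒≤ _ 128 tt) ((refl , refl , refl , refl , refl) , cong suc flag)

run-stop-var : ∀ δ R M {q b f a p} → R 3 ≡ a → R 4 ≡ p → M a ≡ q → M (q + 0) ≡ 0 → M (q + 1) ≡ b →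
    M (b + 4) ≡ suc f →
  M (p + 7) ≢ 0 → R 1 ≡ 0 → Run (program δ) downℓ R M haltℓ M λ R′ → R′ 5 ≡ R 5
run-stop-var δ R M refl refl refl tag refl flag kind stop = run
  (next refl (next refl (next refl (next refl (next refl (next refl (next refl (next refl
   (next refl (next refl (jump refl (tag) (next refl (next refl (next refl (pass refl
   (suc-≢0 flag) (pass refl (kind) (jump refl (stop) (stay))))))))))))))))))
  (≤ᵇ⇒≤ _ 128 tt) (refl)

run-ue : ∀ δ R M {q b f c a p} → R 3 ≡ a → R 4 ≡ p → M a ≡ q → M (q + 0) ≡ 0 → M (q + 1) ≡ b →
    M (b + 4) ≡ suc f →
  M (p + 7) ≢ 0 → R 1 ≢ 0 → M (b + 2) ≡ c → 4 ∸ M (c + 0) ≢ 0 →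
  Run (program δ) downℓ R M copyℓ M λ R′ →
  R′ 1 ≡ R 1 ∸ δ × R′ 2 ≡ R 2 × R′ 3 ≡ R 3 × R′ 4 ≡ R 4 × R′ 5 ≡ R 5 × R′ 6 ≡ c × R′ 7 ≡ R 3 × R′ 8 ≡ 0
run-ue δ R M refl refl refl tag refl flag kind more refl tag′ = run
  (next refl (next refl (next refl (next refl (next refl (next refl (next refl (next refl
   (next refl (next refl (jump refl (tag) (next refl (next refl (next refl (pass refl
   (suc-≢0 flag) (pass refl (kind) (pass refl (more) (next refl (next refl (next refl
   (next refl (next refl (next refl (next refl (next refl (next refl (next refl (pass refl
   (tag′) (next refl (next refl (next refl (next refl (next refl (next refl (next refl
   (next refl (next refl (stay))))))))))))))))))))))))))))))))))))))
  (≤ᵇ⇒≤ _ 128 tt) (refl , refl , refl , refl , refl , refl , refl , refl)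

run-ue-relink : ∀ δ R M {q b f c B u s a p} → R 3 ≡ a → R 4 ≡ p → M a ≡ q → M (q + 0) ≡ 0 →
    M (q + 1) ≡ b → M (b + 4) ≡ suc f →
  M (p + 7) ≢ 0 → R 1 ≢ 0 → M (b + 2) ≡ c → 4 ∸ M (c + 0) ≡ 0 →
  M (b + 5) ≡ B → M B ≡ u → M (b + 3) ≡ s →
  Run (program δ) downℓ R M copyℓ
    (M [ s ≔ c ] [ c + 3 ≔ s ] [ B ≔ b ] [ b + 3 ≔ B ] [ b + 2 ≔ u ]) λ R′ →
  R′ 1 ≡ R 1 ∸ δ × R′ 2 ≡ R 2 × R′ 3 ≡ R 3 × R′ 4 ≡ R 4 × R′ 5 ≡ R 5 × R′ 6 ≡ u × R′ 7 ≡ R 3 × R′ 8 ≡ 0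
run-ue-relink δ R M refl refl refl tag refl flag kind more refl tag′ refl refl refl = run
  (next refl (next refl (next refl (next refl (next refl (next refl (next refl (next refl
   (next refl (next refl (jump refl (tag) (next refl (next refl (next refl (pass refl
   (suc-≢0 flag) (pass refl (kind) (pass refl (more) (next refl (next refl (next refl
   (next refl (next refl (next refl (next refl (next refl (next refl (next refl (jump refl
   (tag′) (next refl (next refl (next refl (next refl (next refl (next refl (next refl
   (next refl (next refl (next refl (next refl (next refl (next refl (next refl (next refl
   (next refl (next refl (next refl (next refl (next refl (next refl (next refl (next refl
   (stay))))))))))))))))))))))))))))))))))))))))))))))))))))
  (≤ᵇ⇒≤ _ 128 tt) (refl , refl , refl , refl , refl , refl , refl , refl)

run-up-fun : ∀ δ R M {p} → R 4 ≡ p → M (p + 6) ≢ 0 → M (p + 7) ≢ 0 →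
  Run (program δ) upℓ R M upℓ M λ R′ →
  R′ 1 ≡ R 1 × R′ 2 ≡ R 2 × R′ 3 ≡ M (p + 3) × R′ 4 ≡ M (p + 6) × R′ 5 ≡ R 5 × R′ 9 ≡ R 9
run-up-fun δ R M refl next≢ kind = run
  (next refl (next refl (next refl (pass refl (next≢) (next refl (next refl (next refl
   (next refl (next refl (next refl (pass refl (kind) (next refl (next refl (next refl
   (next refl (next refl (next refl (stay))))))))))))))))))
  (≤ᵇ⇒≤ _ 128 tt) (refl , refl , refl , refl , refl , refl)

run-up-arg : ∀ δ R M {p b f} → R 4 ≡ p → R 3 ≡ b → R 9 ≡ f → M (p + 6) ≢ 0 → M (p + 7) ≡ 0 →
  Run (program δ) upℓ R M downℓ (M [ p + 4 ≔ f ] [ p + 5 ≔ b ] [ p + 7 ≔ 1 ]) λ R′ →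
  R′ 1 ≡ R 1 × R′ 2 ≡ R 2 × R′ 3 ≡ p + 1 × R′ 4 ≡ p × R′ 5 ≡ R 5
run-up-arg δ R M refl refl refl next≢ kind = run
  (next refl (next refl (next refl (pass refl (next≢) (next refl (next refl (next refl
   (next refl (next refl (next refl (jump refl (kind) (next refl (next refl (next refl
   (next refl (next refl (next refl (next refl (next refl (next refl (next refl (next refl
   (next refl (next refl (next refl (stay))))))))))))))))))))))))))
  (≤ᵇ⇒≤ _ 128 tt) (refl , refl , refl , refl , refl)

run-up-top : ∀ δ R M {p} → R 4 ≡ p → M (p + 6) ≡ 0 → Run (program δ) upℓ R M haltℓ M λ R′ → R′ 5 ≡ R 5
run-up-top δ R M refl next≡ = run
  (next refl (next refl (next refl (jump refl (next≡) (stay)))))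
  (≤ᵇ⇒≤ _ 128 tt) (refl)

run-halt : ∀ δ R M → ∃[ R′ ] program δ ⊢ ⟪ haltℓ , R , M ⟫ ⇓[ 3 ] ⟪ 263 , R′ , M ⟫ × R′ 0 ≡ M (R 5 + 1)
run-halt δ R M = _ , next refl (next refl (next refl (halt refl))) , refl

-- Copying code

data Raw : Set where
  leaf : ℕ → Raw
  lam  : ℕ → Raw → Raw
  app  : ℕ → Raw → Raw → Raw

start : Raw → ℕ
start (leaf p)    = p
start (lam p s)   = p
start (app p s u) = p

data Cell (p : ℕ) : ℕ → Set where
  cell₀ : Cell p (p + 0)
  cell₁ : Cell p (p + 1)
  cell₂ : Cell p (p + 2)

data In : Raw → ℕ → Set where
  leaf : ∀ {p a} → Cell p a → In (leaf p) a
  lam  : ∀ {p s a} → Cell p a → In (lam p s) a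
  app  : ∀ {p s u a} → Cell p a → In (app p s u) a
  body : ∀ {p s a} → In s a → In (lam p s) a
  fun  : ∀ {p s u a} → In s a → In (app p s u) a
  arg  : ∀ {p s u a} → In u a → In (app p s u) a

-- The cells for forward pointers, the only part of the source that copying overwrites.
data Mark : Raw → ℕ → Set where
  here : ∀ {p s} → Mark (lam p s) (p + 2)
  body : ∀ {p s a} → Mark s a → Mark (lam p s) a
  fun  : ∀ {p s u a} → Mark s a → Mark (app p s u) a
  arg  : ∀ {p s u a} → Mark u a → Mark (app p s u) a

mark-in : ∀ {s a} → Mark s a → In s a
mark-in here     = lam cell₂
mark-in (body m) = body (mark-in m)
mark-in (fun m)  = fun (mark-in m)
mark-in (arg m)  = arg (mark-in m)

-- An abstraction is marked before its body is read, and the function of an application is marked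
-- before its argument is read; in both cases the marks must spare what is still to come.
data Disjoint : Raw → Set where
  leaf : ∀ {p} → Disjoint (leaf p)
  lam  : ∀ {p s} → (∀ {a} → Cell p a → ¬ In s a) → Disjoint s → Disjoint (lam p s)
  app  : ∀ {p s u} → (∀ {a} → In s a → ¬ In u a) → Disjoint s → Disjoint u → Disjoint (app p s u)

-- The source is described by bare addresses, so that one proof serves both the input with its
-- three-cell nodes and code in the layout of the machine.
data Src (M : ℕ → ℕ) : ∀ {n} → Vec ℕ n → Raw → Term n → Set where
  var : ∀ {n p i} {bs : Vec ℕ n} → M (p + 0) ≡ 0 → M (p + 1) ≡ lookup bs i → Src M bs (leaf p) (var i)
  sym : ∀ {n p a} {bs : Vec ℕ n} → M (p + 0) ≡ 1 → M (p + 1) ≡ a → Src M bs (leaf p) (sym a)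
  lam : ∀ {n p s t} {bs : Vec ℕ n} → M (p + 0) ≡ 2 → M (p + 1) ≡ start s →
        Src M (p ∷ bs) s t → Src M bs (lam p s) (lam t)
  app : ∀ {n p s u t t′} {bs : Vec ℕ n} → M (p + 0) ≡ 3 → M (p + 1) ≡ start s →
        M (p + 2) ≡ start u → Src M bs s t → Src M bs u t′ → Src M bs (app p s u) (t · t′)

src-cong : ∀ {M M′ n s t} {bs : Vec ℕ n} → (∀ a → In s a → M′ a ≡ M a) → Src M bs s t → Src M′ bs s t
src-cong h (var e₀ e₁) = var (trans (h _ (leaf cell₀)) e₀) (trans (h _ (leaf cell₁)) e₁)
src-cong h (sym e₀ e₁) = sym (trans (h _ (leaf cell₀)) e₀) (trans (h _ (leaf cell₁)) e₁)
src-cong h (lam e₀ e₁ s) =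
  lam (trans (h _ (lam cell₀)) e₀) (trans (h _ (lam cell₁)) e₁) (src-cong (λ a i → h a (body i)) s)
src-cong h (app e₀ e₁ e₂ s u) =
  app (trans (h _ (app cell₀)) e₀) (trans (h _ (app cell₁)) e₁) (trans (h _ (app cell₂)) e₂)
      (src-cong (λ a i → h a (fun i)) s) (src-cong (λ a i → h a (arg i)) u)

δ-other : ∀ {p i} → p ≢ i → δ p i ≡ 0
δ-other {p} {i} ne rewrite dec-false (p ≟ i) ne = refl

δ-eq : ∀ p i → 1 ≤ δ p i → p ≡ i
δ-eq p i 1≤ with p ≟ i
... | yes eq = eq
... | no ne with ≡.subst (1 ≤_) (δ-other ne) 1≤
... | ()

δ≤1 : ∀ p i → δ p i ≤ 1
δ≤1 p i with does (p ≟ i)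
... | true  = ≤-refl
... | false = z≤n

1≤+ : ∀ a {b} → 1 ≤ a + b → 1 ≤ a ⊎ 1 ≤ b
1≤+ zero    le = inj₂ le
1≤+ (suc a) le = inj₁ (s≤s z≤n)

separate-δ : ∀ F {o : ℕ → ℕ} → (∀ i → 1 ≤ o i → F < i) → Separate o → Separate (λ i → δ F i + o i)
separate-δ F {o} h sep i with F ≟ i
... | no ne = ≡.subst (λ d → d + o i ≤ 1) (≡.sym (δ-other ne)) (sep i)
... | yes refl with o F in eq
... | zero  = ≤-trans (≤-reflexive (cong (_+ 0) (δ-refl F))) ≤-refl
... | suc _ = ⊥-elim (<-irrefl refl (h F (≡.subst (1 ≤_) (≡.sym eq) (s≤s z≤n))))

range-δ : ∀ F {G} {o : ℕ → ℕ} → F < G → (∀ i → 1 ≤ o i → F < i × i < G) →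
          ∀ i → 1 ≤ δ F i + o i → F ≤ i × i < G
range-δ F lt h i 1≤ with 1≤+ (δ F i) 1≤
... | inj₂ o = let lo , hi = h i o in <⇒≤ lo , hi
... | inj₁ o with δ-eq F i o
... | refl = ≤-refl , lt

range-+ : ∀ {F G H} (o : ℕ → ℕ) {o′ : ℕ → ℕ} → F ≤ G → (∀ i → 1 ≤ o i → F ≤ i × i < G) →
          G ≤ H → (∀ i → 1 ≤ o′ i → G ≤ i × i < H) → ∀ i → 1 ≤ o i + o′ i → F ≤ i × i < H
range-+ o F≤G h G≤H h′ i 1≤ with 1≤+ (o i) 1≤
... | inj₁ x = let lo , hi = h i x in lo , <-≤-trans hi G≤H
... | inj₂ x = let lo , hi = h′ i x in ≤-trans F≤G lo , hi

separate-+ : ∀ {o o′ : ℕ → ℕ} → (∀ i → 1 ≤ o i → ¬ 1 ≤ o′ i) → Separate o → Separate o′ →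
             Separate (λ i → o i + o′ i)
separate-+ {o} {o′} h s s′ i with o i in eq | o′ i in eq′
... | zero  | b     = ≡.subst (_≤ 1) eq′ (s′ i)
... | suc a | zero  = ≡.subst (_≤ 1) (trans eq (+-comm 0 (suc a))) (s i)
... | suc a | suc b = ⊥-elim (h i (≡.subst (1 ≤_) (≡.sym eq) (s≤s z≤n))
                                  (≡.subst (1 ≤_) (≡.sym eq′) (s≤s z≤n)))

module Copying (β : ℕ) (β≢0 : β ≢ 0) (δ′ : ℕ) where
  open Layout β
  open Update β

  ad-mono : ∀ {i j} → i ≤ j → ad i ≤ ad j
  ad-mono le = +-monoˡ-≤ β (*-monoˡ-≤ 8 le)

  cell<ad : ∀ i {j g} → g < 8 → i < j → ad i + g < ad j
  cell<ad i g< lt = <-≤-trans (≤-trans (≤-reflexive (≡.sym (+-suc (ad i) _)))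
    (≤-trans (+-monoʳ-≤ (ad i) g<) (≤-reflexive (+-comm (ad i) 8)))) (ad-mono lt)

  ad≢0 : ∀ i → ad i ≢ 0
  ad≢0 i = β≢0 ∘ fresh₂ {i * 8}

  puts-below : ∀ M i {a} ws → a < ad i → puts M i ws a ≡ M a
  puts-below M i []             lt = refl
  puts-below M i ((f , v) ∷ ws) lt = trans (puts-below (put M i f v) i ws lt)
    (update-other M v (<⇒≢ (<-≤-trans lt (m≤m+n (ad i) f))))

  data Forward (M : ℕ → ℕ) (b b′ : ℕ) : Set where
    bound : M (b + 0) ≡ 2 → M (b + 2) ≡ ad b′ → Forward M b b′
    free  : M (b + 0) ≡ 4 → b ≡ ad b′ → Forward M b b′

  -- The cells of a binder that the copy reads are out of reach of its writes.

  record Safe (s : Raw) (F d a : ℕ) : Set where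
    constructor safe
    field
      ∉s : ¬ In s a
      ≢d : a ≢ d
      <F : a < ad F

  open Safe

  record Forwarded (M : ℕ → ℕ) (s : Raw) (F d b b′ : ℕ) : Set where
    constructor forwarded
    field
      forward : Forward M b b′
      safe₀   : Safe s F d (b + 0)
      safe₂   : Safe s F d (b + 2)

  forwarded-mono : ∀ {M M′ s s′ F F′ d d′ b b′} → (∀ {a} → In s′ a → In s a) →
    (∀ a → Safe s F d a → M′ a ≡ M a) → F ≤ F′ → (∀ {a} → a < ad F → a ≢ d′) →
    Forwarded M s F d b b′ → Forwarded M′ s′ F′ d′ b b′
  forwarded-mono {M} {M′} {s} {s′} {F} {F′} {d} {d′} {b} {b′} incl same le ne (forwarded f s₀ s₂) =
    forwarded (go f) (mono s₀) (mono s₂)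
    where
    mono : ∀ {a} → Safe s F d a → Safe s′ F′ d′ a
    mono (safe ∉s ≢d <F) = safe (∉s ∘ incl) (ne <F) (<-≤-trans <F (ad-mono le))
    go : Forward M b b′ → Forward M′ b b′
    go (bound tag b≡) = bound (trans (same _ s₀) tag) (trans (same _ s₂) b≡)
    go (free tag b≡)  = free (trans (same _ s₀) tag) b≡

  -- Ending at the pop label with w pending again makes copies of subterms compose like subroutine
  -- calls. The 256 instructions per node pay for its own block and, at an application, for one pop.
  record Copied {n} (R M : ℕ → ℕ) (F d w : ℕ) (s : Raw) (bs′ : Vec ℕ n) (t : Term n) : Set where
    field
      {time F′}  : ℕ
      {regs mem} : ℕ → ℕ
      {copy}     : Node
      steps      : program δ′ ⊢ ⟪ copyℓ , R , M ⟫ ⟶[ time ] ⟪ copyPopℓ , regs , mem ⟫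
      time≤      : time ≤ 256 * ∣ t ∣
      preserved  : Preserved R regs
      free≡      : regs 2 ≡ ad F′
      pending≡   : regs 8 ≡ w
      code       : Code bs′ copy t
      enc        : Enc mem copy
      dst≡       : mem d ≡ ad (root copy)
      range      : ∀ i → 1 ≤ occ copy i → F ≤ i × i < F′
      separate   : Separate (occ copy)
      grows      : F < F′
      outside    : ∀ a → a < ad F → a ≢ d → ¬ Mark s a → mem a ≡ M a

  preserved-trans : ∀ {R R′ R″} → Preserved R R′ → Preserved R′ R″ → Preserved R R″
  preserved-trans (a , b , c , d) (a′ , b′ , c′ , d′) =
    trans a′ a , trans b′ b , trans c′ c , trans d′ d

  copied-leaf : ∀ {n R M F d w p} {bs′ : Vec ℕ n} {t τ v ν} →
    d < ad F → Code bs′ ν t → root ν ≡ F → (∀ i → occ ν i ≡ δ F i) → 1 ≤ ∣ t ∣ →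
    (∀ {M′} → get M′ F 0 ≡ τ → get M′ F 1 ≡ v → Enc M′ ν) →
    Run (program δ′) copyℓ R M copyPopℓ (M [ d ≔ ad F ] [ ad F + 0 ≔ τ ] [ ad F + 1 ≔ v ])
      (λ R′ → Preserved R R′ × R′ 2 ≡ 8 + ad F × R′ 8 ≡ w) →
    Copied R M F d w (leaf p) bs′ t
  copied-leaf {R = R} {M} {F} {d} {τ = τ} {v} {ν} d< c refl o 1≤ e (run steps quick (pr , fr , pe))
      = record
    { steps = steps
    ; time≤ = ≤-trans quick (≤-trans (m≤m+n 128 128) (≤-trans (≤-reflexive refl) (*-monoʳ-≤ 256 1≤)))
    ; preserved = pr ; free≡ = fr ; pending≡ = pe ; code = c
    ; enc = e (puts-at M₁ F ws 0) (puts-at M₁ F ws 1)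
    ; dst≡ = trans (puts-below M₁ F ws d<) (update-same M d (ad F))
    ; range = λ i 1≤ → in-range i (≡.subst (1 ≤_) (o i) 1≤)
    ; separate = λ i → ≤-trans (≤-reflexive (o i)) (δ≤1 F i)
    ; grows = ≤-refl
    ; outside = λ a a< ne _ → trans (puts-below M₁ F ws a<) (update-other M (ad F) ne)
    }
    where
    M₁ = M [ d ≔ ad F ]
    ws = (0 , τ) ∷ (1 , v) ∷ []
    in-range : ∀ i → 1 ≤ δ F i → F ≤ i × i < suc F
    in-range i 1≤ with δ-eq F i 1≤
    ... | refl = ≤-refl , ≤-refl

  record Ready-to-copy {n} (R M : ℕ → ℕ) (F d w : ℕ) (s : Raw) (bs bs′ : Vec ℕ n) (t : Term n) : Set
      where
    constructor copyable
    field
      src : Src M bs s t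
      dis : Disjoint s
      old : ∀ {a} → In s a → a < ad F
      d∉  : ¬ In s d
      d<  : d < ad F
      fw  : ∀ i → Forwarded M s F d (lookup bs i) (lookup bs′ i)
      r₂  : R 2 ≡ ad F
      r₆  : R 6 ≡ start s
      r₇  : R 7 ≡ d
      r₈  : R 8 ≡ w

    in-≢d : ∀ {a} → In s a → a ≢ d
    in-≢d i refl = d∉ i

  old-≢ : ∀ F {a} → a < ad F → ∀ g → a ≢ ad F + g
  old-≢ F a< g = <⇒≢ (<-≤-trans a< (m≤m+n (ad F) g))

  old-< : ∀ F {a} → a < ad F → a < ad (suc F)
  old-< F a< = <-≤-trans a< (ad-mono (n≤1+n F))

  lam-memory : (ℕ → ℕ) → (F d p : ℕ) → ℕ → ℕ
  lam-memory M F d p = M [ d ≔ ad F ] [ ad F + 0 ≔ 2 ] [ p + 2 ≔ ad F ]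

  module _ {n : ℕ} {R M : ℕ → ℕ} {F d w p : ℕ} {s : Raw} {bs bs′ : Vec ℕ n} {t : Term (suc n)} where

    Lam-block : Set
    Lam-block = Run (program δ′) copyℓ R M copyℓ (lam-memory M F d p) λ R′ →
      Preserved R R′ × R′ 2 ≡ 8 + ad F × R′ 6 ≡ M (p + 1) × R′ 7 ≡ ad F + 1 × R′ 8 ≡ w

    lam-block : Ready-to-copy R M F d w (lam p s) bs bs′ (lam t) → Lam-block
    lam-block (copyable (lam e₀ _ _) _ _ _ _ _ r₂ r₆ r₇ r₈) = run-copy-lam δ′ R M r₂ r₆ r₇ r₈ e₀ refl

    lam-kept : p + 2 < ad F → ∀ a → a < ad F → a ≢ d → a ≢ p + 2 → lam-memory M F d p a ≡ M a
    lam-kept p₂< a a< ≢d ≢p = trans (update-other (M [ d ≔ ad F ] [ ad F + 0 ≔ 2 ]) (ad F) ≢p)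
      (trans (update-other (M [ d ≔ ad F ]) 2 (old-≢ F a< 0)) (update-other M (ad F) ≢d))

    ready-body : Ready-to-copy R M F d w (lam p s) bs bs′ (lam t) → (b : Lam-block) →
      Ready-to-copy (Run.regs b) (lam-memory M F d p) (suc F) (ad F + 1) w s (p ∷ bs) (F ∷ bs′) t
    ready-body r@(copyable (lam e₀ e₁ src) (lam ∉ dis) old d∉ d< fw r₂ r₆ r₇ r₈)
        (run _ _ (_ , q₂ , q₆ , q₇ , q₈)) =
      copyable (src-cong (λ a i → kept a (old (body i)) (in-≢d (body i)) (λ { refl → ∉ cell₂ i }))
          src) dis
        (λ i → old-< F (old (body i))) (λ i → old-≢ F (old (body i)) 1 refl) (cell<ad F 1<8 ≤-refl)
        fw′ q₂ (trans q₆ e₁) q₇ q₈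
      where
      open Ready-to-copy r using (in-≢d)
      kept = lam-kept (old (lam cell₂))
      0≢2 : 0 ≢ 2
      0≢2 ()
      own : ∀ {a} → Cell p a → Safe s (suc F) (ad F + 1) a
      own c = safe (∉ c) (old-≢ F (old (lam c)) 1) (old-< F (old (lam c)))
      fw′ : ∀ i → Forwarded (lam-memory M F d p) s (suc F) (ad F + 1) (lookup (p ∷ bs) i)
          (lookup (F ∷ bs′) i)
      fw′ zero = forwarded
        (bound (trans (kept (p + 0) (old (lam cell₀)) (in-≢d (lam cell₀)) (0≢2 ∘ +-cancelˡ-≡ p 0 2)) e₀)
               (update-same (M [ d ≔ ad F ] [ ad F + 0 ≔ 2 ]) (p + 2) (ad F)))
        (own cell₀) (own cell₂)
      fw′ (suc i) = forwarded-mono body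
        (λ a sf → kept a (<F sf) (≢d sf) (λ { refl → ∉s sf (lam cell₂) })) (n≤1+n F)
        (λ lt → old-≢ F lt 1) (fw i)

    copied-lam : Ready-to-copy R M F d w (lam p s) bs bs′ (lam t) → (b : Lam-block) →
      Copied (Run.regs b) (lam-memory M F d p) (suc F) (ad F + 1) w s (F ∷ bs′) t →
      Copied R M F d w (lam p s) bs′ (lam t)
    copied-lam r@(copyable _ _ old d∉ d< _ _ _ _ _) (run {regs = regs₁} steps₁ quick (pr , _)) c =
        record
      { steps = ⟶-trans steps₁ steps
      ; time≤ = ≤-trans (+-mono-≤ quick time≤)
                        (≤-trans (+-monoˡ-≤ _ (m≤m+n 128 128)) (≤-reflexive (lam-size ∣ t ∣)))
      ; preserved = preserved-trans {R} {regs₁} {regs} pr preserved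
      ; free≡ = free≡
      ; pending≡ = pending≡
      ; code = lam code
      ; enc = lam (trans (outside (ad F + 0) (cell<ad F 0<8 ≤-refl) (0≢1 ∘ +-cancelˡ-≡ (ad F) 0 1)
                           (λ m → old-≢ F (old (body (mark-in m))) 0 refl))
                    (trans (update-other (M [ d ≔ ad F ] [ ad F + 0 ≔ 2 ]) (ad F)
                        (old-≢ F (old (lam cell₂)) 0 ∘ ≡.sym))
                           (put-same (M [ d ≔ ad F ]) F 0 2)))
                  dst≡ enc
      ; dst≡ = trans (outside d (old-< F d<) (old-≢ F d< 1) (d∉ ∘ body ∘ mark-in))
          (trans (update-other (M [ d ≔ ad F ] [ ad F + 0 ≔ 2 ]) {p + 2} {d} (ad F)
              (λ { refl → d∉ (lam cell₂) }))
          (trans (update-other (M [ d ≔ ad F ]) 2 (old-≢ F d< 0)) (update-same M d (ad F))))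
      ; range = range-δ F (<⇒≤ grows) range
      ; separate = separate-δ F (λ i 1≤ → proj₁ (range i 1≤)) separate
      ; grows = <⇒≤ grows
      ; outside = λ a a< ne nm → trans (outside a (old-< F a<) (old-≢ F a< 1) (nm ∘ body))
          (lam-kept (old (lam cell₂)) a a< ne (λ { refl → nm here }))
      }
      where
      open Copied c
      0≢1 : 0 ≢ 1
      0≢1 ()
      lam-size : ∀ m → 256 + 256 * m ≡ 256 * (m + 1)
      lam-size = solve-∀

  app-writes : (u : Raw) (w : ℕ) → Writes
  app-writes u w = (0 , 3) ∷ (3 , start u) ∷ (6 , w) ∷ []

  app-memory : (ℕ → ℕ) → (F d w : ℕ) → Raw → ℕ → ℕ
  app-memory M F d w u = puts (M [ d ≔ ad F ]) F (app-writes u w)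

  module _ {n : ℕ} {R M : ℕ → ℕ} {F d w p : ℕ} {s u : Raw} {bs bs′ : Vec ℕ n} {t t′ : Term n}
           (r : Ready-to-copy R M F d w (app p s u) bs bs′ (t · t′)) where

    open Ready-to-copy r

    App-block : Set
    App-block = Run (program δ′) copyℓ R M copyℓ (app-memory M F d w u) λ R′ →
      Preserved R R′ × R′ 2 ≡ 8 + ad F × R′ 6 ≡ M (p + 1) × R′ 7 ≡ ad F + 1 × R′ 8 ≡ ad F

    app-block : App-block
    app-block with src
    ... | app e₀ _ e₂ _ _ = run-copy-app δ′ R M r₂ r₆ r₇ r₈ e₀ e₂ refl

    app-kept : ∀ a → a < ad F → a ≢ d → app-memory M F d w u a ≡ M a
    app-kept a a< ne = trans (puts-below (M [ d ≔ ad F ]) F (app-writes u w) a<)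
        (update-other M (ad F) ne)

    app-field : ∀ g → app-memory M F d w u (ad F + g) ≡
                      written (app-writes u w) g (get (M [ d ≔ ad F ]) F g)
    app-field = puts-at (M [ d ≔ ad F ]) F (app-writes u w)

    app-safe : ∀ a → Safe (app p s u) F d a → app-memory M F d w u a ≡ M a
    app-safe a (safe _ ≢d <F) = app-kept a <F ≢d

    old-∉mark : ∀ a → ad F ≤ a → ¬ Mark (app p s u) a
    old-∉mark a le m = <-irrefl refl (<-≤-trans (old (mark-in m)) le)

    ready-fun : (b : App-block) →
      Ready-to-copy (Run.regs b) (app-memory M F d w u) (suc F) (ad F + 1) (ad F) s bs bs′ t
    ready-fun (run _ _ (_ , q₂ , q₆ , q₇ , q₈)) with src | dis
    ... | app e₀ e₁ e₂ src₁ src₂ | app ∉ dis₁ dis₂ = copyable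
      (src-cong (λ a i → app-kept a (old (fun i)) (in-≢d (fun i))) src₁) dis₁
      (λ i → old-< F (old (fun i))) (λ i → old-≢ F (old (fun i)) 1 refl) (cell<ad F 1<8 ≤-refl)
      (λ i → forwarded-mono fun app-safe (n≤1+n F) (λ lt → old-≢ F lt 1) (fw i))
      q₂ (trans q₆ e₁) q₇ q₈

    module _ (b : App-block)
             (c : Copied (Run.regs b) (app-memory M F d w u) (suc F) (ad F + 1) (ad F) s bs′ t) where

      open Copied c using (F′; mem) renaming (grows to grows₁; outside to outside₁; range to range₁)

      Pop-block : Set
      Pop-block = Run (program δ′) copyPopℓ (Copied.regs c) mem copyℓ mem λ R′ →
        Preserved (Copied.regs c) R′ × R′ 2 ≡ Copied.regs c 2 × R′ 6 ≡ mem (ad F + 3) ×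
        R′ 7 ≡ ad F + 2 × R′ 8 ≡ mem (ad F + 6)

      pop-block : Pop-block
      pop-block = run-pop δ′ (Copied.regs c) mem (Copied.pending≡ c) (ad≢0 F)

      F<F′ : F < F′
      F<F′ = <⇒≤ grows₁

      F≤F′ : F ≤ F′
      F≤F′ = <⇒≤ F<F′

      new₁ : ∀ g → g < 8 → g ≢ 1 → mem (ad F + g) ≡ app-memory M F d w u (ad F + g)
      new₁ g g< ne = outside₁ (ad F + g) (cell<ad F g< ≤-refl) (ne ∘ +-cancelˡ-≡ (ad F) g 1)
        (old-∉mark (ad F + g) (m≤m+n (ad F) g) ∘ fun)

      kept₁ : ∀ a → a < ad F → ¬ Mark s a → mem a ≡ app-memory M F d w u a
      kept₁ a a< nm = outside₁ a (old-< F a<) (old-≢ F a< 1) nm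

      -- The source of the argument and the next pending application survive the first copy, which
      -- changes no older cell except its destination, field 1, and the marks of the function.
      ready-arg : (b′ : Pop-block) → Ready-to-copy (Run.regs b′) mem F′ (ad F + 2) w u bs bs′ t′
      ready-arg (run _ _ (_ , q₂ , q₆ , q₇ , q₈)) with src | dis
      ... | app e₀ e₁ e₂ src₁ src₂ | app ∉ dis₁ dis₂ = copyable
        (src-cong (λ a i → trans (kept₁ a (old (arg i)) (λ m → ∉ (mark-in m) i))
                                 (app-kept a (old (arg i)) (in-≢d (arg i)))) src₂) dis₂
        (λ i → <-≤-trans (old (arg i)) (ad-mono F≤F′))
        (λ i → old-≢ F (old (arg i)) 2 refl) (cell<ad F 2<8 F<F′)
        (λ i → forwarded-mono arg
          (λ a sf → trans (kept₁ a (<F sf) (∉s sf ∘ fun ∘ mark-in)) (app-safe a sf))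
          F≤F′ (λ lt → old-≢ F lt 2) (fw i))
        (trans q₂ (Copied.free≡ c))
        (trans q₆ (trans (new₁ 3 3<8 (λ ())) (app-field 3))) q₇
        (trans q₈ (trans (new₁ 6 6<8 (λ ())) (app-field 6)))

      copied-app : (b′ : Pop-block) → Copied (Run.regs b′) mem F′ (ad F + 2) w u bs′ t′ →
                   Copied R M F d w (app p s u) bs′ (t · t′)
      copied-app (run {regs = regs₃} steps₃ quick₃ (pr₃ , _)) c′ = record
        { steps = ⟶-trans (Run.steps b) (⟶-trans (Copied.steps c) (⟶-trans steps₃ C′.steps))
        ; time≤ = ≤-trans (+-mono-≤ (Run.quick b) (+-mono-≤ (Copied.time≤ c)
            (+-mono-≤ quick₃ C′.time≤)))
                          (≤-reflexive (app-size ∣ t ∣ ∣ t′ ∣))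
        ; preserved = preserved-trans {R} {Run.regs b} {C′.regs} (proj₁ (Run.post b))
            (preserved-trans {Run.regs b} {Copied.regs c} {C′.regs} (Copied.preserved c)
              (preserved-trans {Copied.regs c} {regs₃} {C′.regs} pr₃ C′.preserved))
        ; free≡ = C′.free≡
        ; pending≡ = C′.pending≡
        ; code = app {p = F} (Copied.code c) C′.code
        ; enc = app (trans (new₂ 0 0<8 (λ ())) (trans (new₁ 0 0<8 (λ ())) (app-field 0)))
                    (trans (new₂ 1 1<8 (λ ())) (Copied.dst≡ c)) C′.dst≡
                    (enc-agree (λ i 1≤ → same⇒agree (copy-kept i (proj₁ (range₁ i 1≤))
                        (proj₂ (range₁ i 1≤))))
                               (Copied.enc c))
                    C′.enc
        ; dst≡ = trans (C′.outside d (<-≤-trans d< (ad-mono F≤F′)) (old-≢ F d< 2) (d∉ ∘ arg ∘ mark-in))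
            (trans (outside₁ d (old-< F d<) (old-≢ F d< 1) (d∉ ∘ fun ∘ mark-in))
              (trans (puts-below (M [ d ≔ ad F ]) F (app-writes u w) d<) (update-same M d (ad F))))
        ; range = range-δ F (<-≤-trans F<F′ (<⇒≤ C′.grows)) both
        ; separate = separate-δ F (λ i 1≤ → proj₁ (both i 1≤)) (separate-+
            (λ i 1≤ 1≤′ → <-irrefl refl (<-≤-trans (proj₂ (range₁ i 1≤)) (proj₁ (C′.range i 1≤′))))
            (Copied.separate c) C′.separate)
        ; grows = <-≤-trans F<F′ (<⇒≤ C′.grows)
        ; outside = λ a a< ne nm → trans
            (C′.outside a (<-≤-trans a< (ad-mono F≤F′)) (old-≢ F a< 2) (nm ∘ arg))
            (trans (kept₁ a a< (nm ∘ fun)) (app-kept a a< ne))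
        }
        where
        module C′ = Copied c′
        new₂ : ∀ g → g < 8 → g ≢ 2 → C′.mem (ad F + g) ≡ mem (ad F + g)
        new₂ g g< ne = C′.outside (ad F + g) (cell<ad F g< F<F′) (ne ∘ +-cancelˡ-≡ (ad F) g 2)
          (old-∉mark (ad F + g) (m≤m+n (ad F) g) ∘ arg)
        copy-kept : ∀ i → F < i → i < F′ → Same mem C′.mem i
        copy-kept i lo hi = mk λ g g< → C′.outside (ad i + g) (cell<ad i g< hi)
          (λ eq → <⇒≢ lo (≡.sym (proj₁ (cell-injective {i} {F} g< 2<8 eq))))
          (old-∉mark (ad i + g) (≤-trans (ad-mono (<⇒≤ lo)) (m≤m+n (ad i) g)) ∘ arg)
        both : ∀ i → 1 ≤ occ (Copied.copy c) i + occ C′.copy i → suc F ≤ i × i < C′.F′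
        both = range-+ (occ (Copied.copy c)) F<F′ range₁ (<⇒≤ C′.grows) C′.range
        app-size : ∀ m n → 128 + (256 * m + (128 + 256 * n)) ≡ 256 * (m + n + 1)
        app-size = solve-∀

  copy-code : ∀ {n R M F d w s} {bs bs′ : Vec ℕ n} t →
              Ready-to-copy R M F d w s bs bs′ t → Copied R M F d w s bs′ t
  copy-code {R = R} {M} {F} {bs′ = bs′} (var i) (copyable (var e₀ e₁) _ _ _ d< fw r₂ r₆ r₇ r₈) with fw i
  ... | forwarded (free tag b≡) _ _ =
    copied-leaf {ν = var F (lookup bs′ i)} d< (var refl) refl (λ _ → refl) ≤-refl var
      (run-copy-free δ′ R M r₂ r₆ r₇ r₈ e₀ (trans e₁ b≡) refl
          (trans (cong (λ b → M (b + 0)) (≡.sym b≡)) tag))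
  ... | forwarded (bound tag b≡) _ _ =
    copied-leaf {ν = var F (lookup bs′ i)} d< (var refl) refl (λ _ → refl) ≤-refl var
      (run-copy-bound δ′ R M r₂ r₆ r₇ r₈ e₀ e₁ b≡ refl tag)
  copy-code {R = R} {M} {F} (sym a) (copyable (sym e₀ e₁) _ _ _ d< _ r₂ r₆ r₇ r₈) =
    copied-leaf {ν = sym F a} d< sym refl (λ _ → refl) ≤-refl sym
      (run-copy-sym δ′ R M r₂ r₆ r₇ r₈ e₀ e₁ refl)
  copy-code (lam t) r@(copyable (lam _ _ _) _ _ _ _ _ _ _ _ _) =
    copied-lam r b (copy-code t (ready-body r b))
    where b = lam-block r
  copy-code (t · t′) r@(copyable (app _ _ _ _ _) _ _ _ _ _ _ _ _ _) =
    copied-app r b c b′ (copy-code t′ (ready-arg r b c b′))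
    where
    b = app-block r
    c = copy-code t (ready-fun r b)
    b′ = pop-block r b c

-- Represented terms

unique-++ : ∀ (xs : List ℕ) {ys} → Unique (xs ++ ys) →
            Unique xs × Unique ys × (∀ {a} → a ∈ xs → ¬ (a ∈ ys))
unique-++ []       u       = [] , u , λ ()
unique-++ (x ∷ xs) (h ∷ u) =
  let ux , uy , dis = unique-++ xs u in
  ++⁻ˡ xs h ∷ ux , uy , λ { (here refl) m → All.lookup (++⁻ʳ xs h) m refl ; (there i) m → dis i m }

record Source {n M p} {bs : Vec ℕ n} (t : Term n) (r : Rep M bs p (embed t)) : Set where
  constructor source
  field
    {raw}    : Raw
    start≡   : p ≡ start raw
    src      : Src M bs raw t
    disjoint : Disjoint raw
    in-cells : ∀ {a} → In raw a → a ∈ cells r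

cell-of : ∀ {p a xs} → Cell p a → a ∈ p ∷ p + 1 ∷ p + 2 ∷ xs
cell-of {p} cell₀ = here (+-identityʳ p)
cell-of cell₁     = there (here refl)
cell-of cell₂     = there (there (here refl))

rep-source : ∀ {n M p} {bs : Vec ℕ n} (t : Term n) (r : Rep M bs p (embed t)) → Unique (cells r) →
             Source t r
rep-source {M = M} {p} (var i) (var e₀ e₁) u =
  source {raw = leaf p} refl (var (trans (cong M (+-identityʳ p)) e₀) e₁) leaf
      (λ { (leaf c) → cell-of c })
rep-source {M = M} {p} (sym a) (sym e₀ e₁) u =
  source {raw = leaf p} refl (sym (trans (cong M (+-identityʳ p)) e₀) e₁) leaf
      (λ { (leaf c) → cell-of c })
rep-source {M = M} {p} (lam t) (lam e₀ r) (h₀ ∷ h₁ ∷ h₂ ∷ u) with rep-source t r u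
... | source {raw} st src dis inc =
  source {raw = lam p raw} refl (lam (trans (cong M (+-identityʳ p)) e₀) st src)
    (lam (λ { cell₀ i → All.lookup h₀ (there (there (inc i))) (≡.sym (+-identityʳ p))
            ; cell₁ i → All.lookup h₁ (there (inc i)) refl
            ; cell₂ i → All.lookup h₂ (inc i) refl }) dis)
    (λ { (lam c) → cell-of c ; (body i) → there (there (there (inc i))) })
rep-source {M = M} {p} (t · t′) (app e₀ r r′) (h₀ ∷ h₁ ∷ h₂ ∷ u)
  with unique-++ (cells r) u
... | u₁ , u₂ , dis with rep-source t r u₁ | rep-source t′ r′ u₂
... | source {raw₁} st₁ src₁ dis₁ inc₁ | source {raw₂} st₂ src₂ dis₂ inc₂ =
  source {raw = app p raw₁ raw₂} refl (app (trans (cong M (+-identityʳ p)) e₀) st₁ st₂ src₁ src₂)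
    (app (λ i j → dis (inc₁ i) (inc₂ j)) dis₁ dis₂)
    (λ { (app c) → cell-of c
       ; (fun i) → there (there (there (∈-++⁺ˡ (inc₁ i))))
       ; (arg i) → there (there (there (∈-++⁺ʳ (cells r) (inc₂ i)))) })

count : List ℕ → ℕ → ℕ
count []       i = 0
count (p ∷ ps) i = δ p i + count ps i

count-++ : ∀ ps qs i → count (ps ++ qs) i ≡ count ps i + count qs i
count-++ []       qs i = refl
count-++ (p ∷ ps) qs i = trans (cong (δ p i +_) (count-++ ps qs i)) (≡.sym (+-assoc (δ p i) _ _))

module Representation (β : ℕ) where
  open Layout β

  blocks : List ℕ → List ℕ
  blocks []       = []
  blocks (p ∷ ps) = ad p ∷ ad p + 1 ∷ ad p + 2 ∷ blocks ps

  blocks-++ : ∀ ps qs → blocks (ps ++ qs) ≡ blocks ps ++ blocks qs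
  blocks-++ []       qs = refl
  blocks-++ (p ∷ ps) qs = cong (λ l → ad p ∷ ad p + 1 ∷ ad p + 2 ∷ l) (blocks-++ ps qs)

  outside-blocks : ∀ {p g} ps → g < 8 → count ps p ≡ 0 → All (λ a → ad p + g ≢ a) (blocks ps)
  outside-blocks []       g< z = []
  outside-blocks {p} {g} (q ∷ ps) g< z =
    (λ eq → p≢q (proj₁ (cell-injective g< 0<8 (trans eq (≡.sym (+-identityʳ (ad q))))))) ∷
    (p≢q ∘ proj₁ ∘ cell-injective g< 1<8) ∷ (p≢q ∘ proj₁ ∘ cell-injective g< 2<8) ∷
    outside-blocks ps g< (fresh₂ {δ q p} z)
    where
    p≢q : p ≢ q
    p≢q refl with trans (≡.sym (δ-refl p)) (fresh₁ z)
    ... | ()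

  unique-blocks : ∀ ps → Separate (count ps) → Unique (blocks ps)
  unique-blocks []       sep = []
  unique-blocks (p ∷ ps) sep =
    ((λ eq → 0≢1 (field-inj 0<8 1<8 (trans (+-identityʳ (ad p)) eq))) ∷
     (λ eq → 0≢2 (field-inj 0<8 2<8 (trans (+-identityʳ (ad p)) eq))) ∷
     All.map (λ ne eq → ne (trans (+-identityʳ (ad p)) eq)) (outside-blocks {p} ps 0<8 fr)) ∷
    ((λ eq → 1≢2 (field-inj 1<8 2<8 eq)) ∷ outside-blocks {p} ps 1<8 fr) ∷
    outside-blocks {p} ps 2<8 fr ∷
    unique-blocks ps (λ i → sep₂ {δ p i} (sep i))
    where
    fr = head-fresh p (sep p)
    field-inj : ∀ {f g} → f < 8 → g < 8 → ad p + f ≡ ad p + g → f ≡ g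
    field-inj f< g< eq = proj₂ (cell-injective {p} {p} f< g< eq)
    0≢1 : 0 ≢ 1
    0≢1 ()
    0≢2 : 0 ≢ 2
    0≢2 ()
    1≢2 : 1 ≢ 2
    1≢2 ()

  -- `Stored` asks for pairwise distinct cells. Keeping the list of nodes behind them reduces this
  -- to a bound on occurrence counts.
  record Represented (M : ℕ → ℕ) {n} (bs : Vec ℕ n) (a : ℕ) (t : ETerm n) (o : ℕ → ℕ) : Set where
    constructor represented
    field
      rep    : Rep M (map ad bs) a t
      nodes  : List ℕ
      cells≡ : cells rep ≡ blocks nodes
      count≡ : ∀ i → count nodes i ≡ o i

  tag : ∀ {M p v} → get M p 0 ≡ v → M (ad p) ≡ v
  tag {M} {p} eq = trans (cong M (≡.sym (+-identityʳ (ad p)))) eq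

  module _ {M : ℕ → ℕ} where

    represent-var : ∀ {n p b} {bs : Vec ℕ n} {i} → get M p 0 ≡ 0 → get M p 1 ≡ ad b →
                    lookup bs i ≡ b → Represented M bs (ad p) (var i) (λ j → δ p j)
    represent-var {p = p} {bs = bs} {i} e₀ e₁ refl = represented
      (var (tag {M} {p} e₀) (trans e₁ (≡.sym (lookup-map i ad bs)))) (p ∷ []) refl
          (λ i → +-comm (δ p i) 0)

    represent-sym : ∀ {n p a} {bs : Vec ℕ n} → get M p 0 ≡ 1 → get M p 1 ≡ a →
                    Represented M bs (ad p) (sym a) (λ j → δ p j)
    represent-sym {p = p} e₀ e₁ =
      represented (sym (tag {M} {p} e₀) e₁) (p ∷ []) refl (λ i → +-comm (δ p i) 0)

    represent-lam : ∀ {n p t o} {bs : Vec ℕ n} → get M p 0 ≡ 2 →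
        Represented M (p ∷ bs) (get M p 1) t o →
                    Represented M bs (ad p) (lam t) (λ j → δ p j + o j)
    represent-lam {p = p} e₀ (represented r ps eq c) =
      represented (lam (tag {M} {p} e₀) r) (p ∷ ps) (cong (λ l → ad p ∷ ad p + 1 ∷ ad p + 2 ∷ l) eq)
                  (λ i → cong (δ p i +_) (c i))

    represent-pair : ∀ {p ps qs} {o o′ : ℕ → ℕ} {xs ys : List ℕ} → xs ≡ blocks ps → ys ≡ blocks qs →
      (∀ i → count ps i ≡ o i) → (∀ i → count qs i ≡ o′ i) →
      ad p ∷ ad p + 1 ∷ ad p + 2 ∷ xs ++ ys ≡ blocks (p ∷ ps ++ qs) ×
      (∀ i → count (p ∷ ps ++ qs) i ≡ δ p i + (o i + o′ i))
    represent-pair {p} {ps} {qs} refl refl c c′ =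
      cong (λ l → ad p ∷ ad p + 1 ∷ ad p + 2 ∷ l) (≡.sym (blocks-++ ps qs)) ,
      λ i → cong (δ p i +_) (trans (count-++ ps qs i) (cong₂ _+_ (c i) (c′ i)))

    represent-app : ∀ {n p t u o o′} {bs : Vec ℕ n} → get M p 0 ≡ 3 →
      Represented M bs (get M p 1) t o → Represented M bs (get M p 2) u o′ →
      Represented M bs (ad p) (t · u) (λ j → δ p j + (o j + o′ j))
    represent-app {p = p} {o = o} {o′} e₀ (represented r ps eq c) (represented s qs eq′ c′) =
      let ceq , cc = represent-pair {p} {o = o} {o′} eq eq′ c c′ in
      represented (app (tag {M} {p} e₀) r s) (p ∷ ps ++ qs) ceq cc

    represent-es : ∀ {n p t u o o′} {bs : Vec ℕ n} → get M p 0 ≡ 4 →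
      Represented M (p ∷ bs) (get M p 1) t o → Represented M bs (get M p 2) u o′ →
      Represented M bs (ad p) (t [← u ]) (λ j → δ p j + (o j + o′ j))
    represent-es {p = p} {o = o} {o′} e₀ (represented r ps eq c) (represented s qs eq′ c′) =
      let ceq , cc = represent-pair {p} {o = o} {o′} eq eq′ c c′ in
      represented (es (tag {M} {p} e₀) r s) (p ∷ ps ++ qs) ceq cc

    at-address : ∀ {n a b t o} {bs : Vec ℕ n} → a ≡ b → Represented M bs b t o → Represented M bs a t o
    at-address refl r = r

    represent-code : ∀ {n ν t} {bs : Vec ℕ n} → Enc M ν → Code bs ν t →
                     Represented M bs (ad (root ν)) (embed t) (occ ν)
    represent-code (var {p} e₀ e₁) (var eq) = represent-var {p = p} e₀ e₁ eq
    represent-code (sym {p} e₀ e₁) sym = represent-sym {p = p} e₀ e₁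
    represent-code (lam {p} e₀ e₁ r) (lam t) = represent-lam {p = p} e₀
        (at-address e₁ (represent-code r t))
    represent-code (app {p} e₀ e₁ e₂ r s) (app t u) =
      represent-app {p = p} e₀ (at-address e₁ (represent-code r t)) (at-address e₂ (represent-code s u))

    represent-done : ∀ {m R n ν t} {bs fs : Vec ℕ n} → Enc M ν → Done m R bs fs ν t →
                     Represented M bs (ad (root ν)) t (occ ν)
    represent-done (var {p} e₀ e₁) (var eq) = represent-var {p = p} e₀ e₁ eq
    represent-done (sym {p} e₀ e₁) sym = represent-sym {p = p} e₀ e₁
    represent-done (lam {p} e₀ e₁ r) (lam t _) = represent-lam {p = p} e₀
        (at-address e₁ (represent-code r t))
    represent-done (app {p} e₀ e₁ e₂ r s) (app t _ u) =
      represent-app {p = p} e₀ (at-address e₁ (represent-done r t)) (at-address e₂ (represent-done s u))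
    represent-done (es {x} e₀ e₁ e₂ _ _ _ r s) (es c _ _ t) =
      represent-es {p = x} e₀ (at-address e₁ (represent-done r t)) (at-address e₂ (represent-done s c))

    -- An inequality, because `occZ` also counts node 0, which lies outside the represented term.
    represent-path : ∀ {m R n ν Z t o} {bs fs : Vec ℕ n} → EncZ M ν → Path-of m R bs fs ν Z →
      Represented M bs (M (slot ν)) t o →
      Σ (ℕ → ℕ) λ o′ → Represented M [] (get M 0 1) (plug Z t) o′ × (∀ i → o′ i ≤ o i + occZ ν i)
    represent-path {o = o} (top _ _) top r = o , r , λ i → m≤m+n (o i) _
    represent-path {o = o} (arg {p} {t} {ν} e₀ e₁ e₃ e₆ e₇ sl s z) (arg P c _) r =
      let o′ , r′ , le = represent-path z P
            (at-address sl (represent-app {p = p} e₀ (at-address e₁ (represent-code s c)) r))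
      in o′ , r′ , λ i → ≤-trans (le i) (≤-reflexive (perm (δ p i) (occ t i) (o i) (occZ ν i)))
      where
      perm : ∀ a b c d → a + (b + c) + d ≡ c + (a + (b + d))
      perm = solve-∀
    represent-path {o = o} (fun {p} {f} {u} {ν} e₀ e₂ e₃ e₄ b e₆ e₇ sl s z) (fun P d _ _) r =
      let o′ , r′ , le = represent-path z P
            (at-address sl (represent-app {p = p} e₀ r (at-address e₂ (represent-done s d))))
      in o′ , r′ , λ i → ≤-trans (le i) (≤-reflexive (perm (δ p i) (o i) (occ u i) (occZ ν i)))
      where
      perm : ∀ a b c d → a + (b + c) + d ≡ b + (a + (c + d))
      perm = solve-∀
    represent-path {o = o} (es {x} {f} {c} {ν} e₀ e₂ e₃ e₄ b sl s z) (es P d _ _) r =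
      let o′ , r′ , le = represent-path z P
            (at-address sl (represent-es {p = x} e₀ r (at-address e₂ (represent-done s d))))
      in o′ , r′ , λ i → ≤-trans (le i) (≤-reflexive (perm (δ x i) (o i) (occ c i) (occZ ν i)))
      where
      perm : ∀ a b c d → a + (b + c) + d ≡ b + (a + (c + d))
      perm = solve-∀

    stored : ∀ {t o a} → Represented M [] a t o → Separate o → Stored M a t
    stored (represented r ps eq c) sep =
      r , ≡.subst Unique (≡.sym eq) (unique-blocks ps (λ i → ≤-trans (≤-reflexive (c i)) (sep i)))

  rawOf : Node → Raw
  rawOf (lam p t)    = lam (ad p) (rawOf t)
  rawOf (app p t u)  = app (ad p) (rawOf t) (rawOf u)
  rawOf ν            = leaf (ad (root ν))

  start-rawOf : ∀ ν → start (rawOf ν) ≡ ad (root ν)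
  start-rawOf (var p b)    = refl
  start-rawOf (sym p a)    = refl
  start-rawOf (lam p t)    = refl
  start-rawOf (app p t u)  = refl
  start-rawOf (es x f t c) = refl

  code-src : ∀ {M n ν t} {bs : Vec ℕ n} → Enc M ν → Code bs ν t → Src M (map ad bs) (rawOf ν) t
  code-src {bs = bs} (var e₀ e₁) (var {i = i} refl) = var e₀ (trans e₁ (≡.sym (lookup-map i ad bs)))
  code-src (sym e₀ e₁) sym = sym e₀ e₁
  code-src (lam {t = t} e₀ e₁ r) (lam c) = lam e₀ (trans e₁ (≡.sym (start-rawOf t))) (code-src r c)
  code-src (app {t = t} {u} e₀ e₁ e₂ r s) (app c d) =
    app e₀ (trans e₁ (≡.sym (start-rawOf t))) (trans e₂ (≡.sym (start-rawOf u))) (code-src r c)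
        (code-src s d)

  cell-node : ∀ {p a} → Cell (ad p) a → ∃[ g ] g < 8 × a ≡ ad p + g
  cell-node cell₀ = 0 , 0<8 , refl
  cell-node cell₁ = 1 , 1<8 , refl
  cell-node cell₂ = 2 , 2<8 , refl

  in-node : ∀ ν {a} → In (rawOf ν) a → ∃[ i ] ∃[ g ] g < 8 × 1 ≤ occ ν i × a ≡ ad i + g
  in-node ν@(var p b)    (leaf c) = let g , g< , eq = cell-node {p} c in p , g , g< , occ-root ν , eq
  in-node ν@(sym p b)    (leaf c) = let g , g< , eq = cell-node {p} c in p , g , g< , occ-root ν , eq
  in-node ν@(es x f t d) (leaf c) = let g , g< , eq = cell-node {x} c in x , g , g< , occ-root ν , eq
  in-node ν@(lam p t)    (lam c)  = let g , g< , eq = cell-node {p} c in p , g , g< , occ-root ν , eq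
  in-node ν@(app p t u)  (app c)  = let g , g< , eq = cell-node {p} c in p , g , g< , occ-root ν , eq
  in-node (lam p t)   (body i) =
    let j , g , g< , o , eq = in-node t i in j , g , g< , m≤n⇒m≤o+n (δ p j) o , eq
  in-node (app p t u) (fun i) =
    let j , g , g< , o , eq = in-node t i in j , g , g< , m≤n⇒m≤o+n (δ p j) (m≤n⇒m≤n+o _ o) , eq
  in-node (app p t u) (arg i) =
    let j , g , g< , o , eq = in-node u i in j , g , g< , m≤n⇒m≤o+n (δ p j) (m≤n⇒m≤o+n (occ t j) o) , eq

  mark-node : ∀ {M n ν t a} {bs : Vec ℕ n} → Enc M ν → Code bs ν t → Mark (rawOf ν) a →
              ∃[ i ] a ≡ ad i + 2 × get M i 0 ≡ 2
  mark-node (lam {p} e₀ _ r) (lam c) here = p , refl , e₀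
  mark-node (lam e₀ _ r) (lam c) (body m) = mark-node r c m
  mark-node (app _ _ _ r s) (app c d) (fun m) = mark-node r c m
  mark-node (app _ _ _ r s) (app c d) (arg m) = mark-node s d m

  disjoint-node : ∀ ν → Separate (occ ν) → Disjoint (rawOf ν)
  disjoint-node (var p b)    sep = leaf
  disjoint-node (sym p a)    sep = leaf
  disjoint-node (es x f t c) sep = leaf
  disjoint-node (lam p t)    sep = lam ∉ (disjoint-node t (λ i → sep₂ {δ p i} (sep i)))
    where
    ∉ : ∀ {a} → Cell (ad p) a → ¬ In (rawOf t) a
    ∉ c i with cell-node {p} c | in-node t i
    ... | g , g< , eq | j , h , h< , o , eq′ =
      apart {occ t} o (head-fresh p (sep p))
        (≡.sym (proj₁ (cell-injective {p} {j} g< h< (trans (≡.sym eq) eq′))))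
  disjoint-node (app p t u) sep = app ∉ (disjoint-node t (λ i → sep₁ (sep₂ {δ p i} (sep i))))
                                        (disjoint-node u (λ i → sep₂ {occ t i} (sep₂ {δ p i} (sep i))))
    where
    ∉ : ∀ {a} → In (rawOf t) a → ¬ In (rawOf u) a
    ∉ i i′ with in-node t i | in-node u i′
    ... | j , g , g< , o , eq | k , h , h< , o′ , eq′ =
      apart {occ u} o′ (clash (sep₂ {δ p j} (sep j)) o)
        (≡.sym (proj₁ (cell-injective {j} {k} g< h< (trans (≡.sym eq) eq′))))

-- Evaluation

-- What a derivation has to provide for the machine to follow it: n is the number
-- of steps left, R bounds the flags, b the number of substitution steps before
-- the end, and q those before the next beta step.

record Strategy (δ′ : ℕ) (Output : ETerm 0 → Set) : Set₁ where
  field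
    Inv    : ETerm 0 → (n R b q : ℕ) → Set
    stop   : ∀ {t R b q} → Inv t 0 R b q → Output t
    normal : ∀ {t n R b q} → Fireball (t ↓) → Inv t n R b q → Output t
    beta   : ∀ {k n R b q} (Z : Zip k) t → Ready Z → Applied Z → Inv (plug Z (lam t)) (suc n) R b q →
             ∃[ q′ ] suc R ≤ q′ × Inv (contract Z (lam t)) n (suc R) b q′
    expand : ∀ {k n R b q} (Z : Zip k) i → Ready Z → Applied Z → Value (env Z i) →
             Inv (plug Z (var i)) (suc n) R b (suc q) →
             ∃[ b′ ] b ≡ suc b′ × Inv (plugFloat (floatAt Z i)) (suc n ∸ δ′) R b′ q

-- Either a new chain of substitutions may start, or the focus continues one.

data Quota (R q : ℕ) (ν : NodeZip) {k} (fs : Vec ℕ k) : Term k → Set where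
  fresh : ∀ {s} → R ≤ q → Quota R q ν fs s
  lam   : ∀ {t} → kind ν ≢ 0 → Quota R q ν fs (lam t)
  var   : ∀ {i} → kind ν ≢ 0 → lookup fs i ≢ 0 → lookup fs i ≤ q → Quota R q ν fs (var i)

record Chained (m R q : ℕ) (ν : NodeZip) {k} (bs fs : Vec ℕ k) (μ : Node) (u : ETerm k) : Set where
  constructor chained
  field
    {term} : Term k
    embed≡ : embed term ≡ u
    code   : Code bs μ term
    size≤  : ∣ term ∣ ≤ m
    quota  : Quota R q ν fs term

-- A positive flag leaves two cases: an abstraction ends the chain, while a variable refers to a
-- flag that is exactly f, still within the quota.
chained-content : ∀ {m R q ν k f μ u} {bs fs : Vec ℕ k} → 1 ≤ m → kind ν ≢ 0 → f ≤ q →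
                  Done m R bs fs μ u → ¬ IsES u → flag fs u ≡ suc f → Chained m R q ν bs fs μ u
chained-content {fs = fs} 1≤m k f≤ (var {i = i} eq) ¬es fl with lookup fs i in eq′
... | suc g with fl
... | refl = chained refl (var eq) 1≤m
  (var k (suc-≢0 eq′) (≤-trans (≤-reflexive eq′) f≤))
chained-content 1≤m k f≤ (lam {t′ = t} c s) ¬es fl = chained {term = lam t} refl (lam c) s (lam k)
chained-content 1≤m k f≤ (es {t′ = t} {c′ = c} _ _ _ _) ¬es fl = ⊥-elim (¬es (t , c , refl))

occ-innermost : ∀ c i → occ (innermost c) i ≤ occ c i
occ-innermost (var p b)    i = ≤-refl
occ-innermost (sym p a)    i = ≤-refl
occ-innermost (lam p t)    i = ≤-refl
occ-innermost (app p t u)  i = ≤-refl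
occ-innermost (es x f t c) i = m≤n⇒m≤o+n (δ x i) (m≤n⇒m≤n+o _ (occ-innermost t i))

occ-at : ∀ {k ν x f μ c} → At k ν x f μ c → ∀ i → δ x i + (occ c i + occZ μ i) ≤ occZ ν i
occ-at here i = ≤-refl
occ-at (es {c = c} {y} a) i =
  ≤-trans (occ-at a i) (m≤n⇒m≤o+n (δ y i) (m≤n+m _ (occ c i)))
occ-at (arg {p = p} {t} a) i = ≤-trans (occ-at a i) (m≤n⇒m≤o+n (δ p i) (m≤n+m _ (occ t i)))
occ-at (fun {p = p} {u = u} a) i = ≤-trans (occ-at a i) (m≤n⇒m≤o+n (δ p i) (m≤n+m _ (occ u i)))

occ-at-content : ∀ {k ν x f μ c} → At k ν x f μ c → ∀ i → occ c i ≤ occZ ν i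
occ-at-content {x = x} {c = c} a i =
  ≤-trans (m≤n⇒m≤o+n (δ x i) (m≤m+n (occ c i) _)) (occ-at a i)

occ-at-node : ∀ {k ν x f μ c} → At k ν x f μ c → 1 ≤ occZ ν x
occ-at-node {x = x} a = ≤-trans (δ-in x) (occ-at a x)

zero-≤ : ∀ {a b} → a ≤ b → b ≡ 0 → a ≡ 0
zero-≤ z≤n refl = refl

-- The destination of a copy must not lie in its source.
content-∌-slot : ∀ {k ν x f μ c} → At k ν x f μ c → Separate (occZ ν) → occ c (slotB ν) ≡ 0
content-∌-slot {x = x} {c = c} here sep = fresh₁ (head-fresh x (sep x))
content-∌-slot {c = c} (es {c = c′} {y} a) sep =
  zero-≤ (occ-at-content a y) (fresh₂ {occ c′ y} (head-fresh y (sep y)))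
content-∌-slot (arg {p = p} {t} a) sep =
  zero-≤ (occ-at-content a p) (fresh₂ {occ t p} (head-fresh p (sep p)))
content-∌-slot (fun {p = p} {u = u} a) sep =
  zero-≤ (occ-at-content a p) (fresh₂ {occ u p} (head-fresh p (sep p)))

module Machine (β : ℕ) (β≢0 : β ≢ 0) (δ′ : ℕ) where
  open Layout β
  open Update β
  open Relinking β
  open Copying β β≢0 δ′
  open Representation β
  open Agree
  open Same

  frame≢0 : ∀ ν → frame ν ≢ 0
  frame≢0 top           = ad≢0 0
  frame≢0 (arg p t ν)   = ad≢0 p
  frame≢0 (fun p f ν u) = ad≢0 p
  frame≢0 (es x f ν c)  = frame≢0 ν

  frame-outer : ∀ ν → kind ν ≢ 0 → frame (outer (unappN ν)) ≡ frame (below ν)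
  frame-outer top           k = refl
  frame-outer (arg p t ν)   k = refl
  frame-outer (fun p f ν u) k = refl
  frame-outer (es x f ν c)  k = frame-outer ν k

  module _ {M : ℕ → ℕ} where

    kind-read : ∀ {ν} → EncZ M ν → M (frame ν + 7) ≡ kind ν
    kind-read (top _ e₇)                   = e₇
    kind-read (arg _ _ _ _ e₇ _ _ _)       = e₇
    kind-read (fun _ _ _ _ _ _ e₇ _ _ _)   = e₇
    kind-read (es _ _ _ _ _ _ _ z)         = kind-read z

    at-enc : ∀ {k ν x f μ c} → At k ν x f μ c → EncZ M ν → EncZ M (es x f μ c)
    at-enc here    z                          = z
    at-enc (es a)  (es _ _ _ _ _ _ _ z)       = at-enc a z
    at-enc (arg a) (arg _ _ _ _ _ _ _ z)      = at-enc a z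
    at-enc (fun a) (fun _ _ _ _ _ _ _ _ _ z)  = at-enc a z

    bottom-read : ∀ {y g t d} → Enc M (es y g t d) → M (ad (bottomNode y t) + 1) ≡ ad
        (root (innermost t))
    bottom-read {t = var p b}    (es _ e₁ _ _ _ _ r _) = e₁
    bottom-read {t = sym p a}    (es _ e₁ _ _ _ _ r _) = e₁
    bottom-read {t = lam p t}    (es _ e₁ _ _ _ _ r _) = e₁
    bottom-read {t = app p t u}  (es _ e₁ _ _ _ _ r _) = e₁
    bottom-read {t = es x f t c} (es _ e₁ _ _ _ _ r _) = bottom-read r

    -- Code has no explicit substitutions, which keeps its nodes apart from the binders of its free
    -- variables.
    code-tag : ∀ {n ν t i} {bs : Vec ℕ n} → Enc M ν → Code bs ν t → 1 ≤ occ ν i → get M i 0 ≢ 4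
    code-tag {i = i} (var {p} e₀ _) (var _) o eq with δ-eq p i o
    ... | refl with trans (≡.sym e₀) eq
    ... | ()
    code-tag {i = i} (sym {p} e₀ _) sym o eq with δ-eq p i o
    ... | refl with trans (≡.sym e₀) eq
    ... | ()
    code-tag {i = i} (lam {p} e₀ _ r) (lam c) o eq with 1≤+ (δ p i) o
    ... | inj₂ o′ = code-tag r c o′ eq
    ... | inj₁ o′ with δ-eq p i o′
    ... | refl with trans (≡.sym e₀) eq
    ... | ()
    code-tag {ν = app p t u} {i = i} (app e₀ _ _ r s) (app c d) o eq with 1≤+ (δ p i) o
    ... | inj₁ o′ with δ-eq p i o′
    ... | refl with trans (≡.sym e₀) eq
    ... | ()
    code-tag {ν = app p t u} {i = i} (app e₀ _ _ r s) (app c d) o eq | inj₂ o′ with 1≤+ (occ t i) o′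
    ... | inj₁ o″ = code-tag r c o″ eq
    ... | inj₂ o″ = code-tag s d o″ eq

    slot-field : ∀ {ν} → EncZ M ν → slotF ν ≡ 2 → get M (slotB ν) 0 ≢ 4
    slot-field (arg e₀ _ _ _ _ _ _ _) _ eq with trans (≡.sym e₀) eq
    ... | ()

    slotF≢0 : ∀ ν → slotF ν ≢ 0
    slotF≢0 top           ()
    slotF≢0 (arg p t ν)   ()
    slotF≢0 (fun p f ν u) ()
    slotF≢0 (es x f ν c)  ()

  Halts : (ETerm 0 → Set) → (l : ℕ) (R M : ℕ → ℕ) → ℕ → Set
  Halts Output l R M h =
    ∃[ k ] ∃[ c ] ∃[ w ]
      program δ′ ⊢ ⟪ l , R , M ⟫ ⇓[ k ] c × k ≤ h × Stored (memory c) (registers c 0) w × Output w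

  after : ∀ {Output l R M l′ M′ Q h h′} (r : Run (program δ′) l R M l′ M′ Q) →
          128 + h′ ≤ h → Halts Output l′ (Run.regs r) M′ h′ → Halts Output l R M h
  after r le (k , c , w , s , k≤ , st , o) =
    _ , c , w , ⟶-⇓ (Run.steps r) s , ≤-trans (+-mono-≤ (Run.quick r) k≤) le , st , o

  halted : ∀ {Output R M t} → R 5 ≡ ad 0 → Stored M (get M 0 1) t → Output t → Halts Output haltℓ R M 3
  halted {R = R} {M} {t} r₅ st o =
    let R′ , s , eq = run-halt δ′ R M
    in 3 , _ , t , s , ≤-refl , ≡.subst (λ a → Stored M a t)
         (≡.sym (trans eq (cong (λ a → M (a + 1)) r₅))) st , o

  record Registers (R : ℕ → ℕ) (n F s p : ℕ) : Set where
    constructor regfile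
    field
      r₁ : R 1 ≡ n
      r₂ : R 2 ≡ ad F
      r₃ : R 3 ≡ s
      r₄ : R 4 ≡ p
      r₅ : R 5 ≡ ad 0

  record Placed (M : ℕ → ℕ) (F : ℕ) (ν : NodeZip) (μ : Node) : Set where
    constructor placed
    field
      encZ : EncZ M ν
      enc  : Enc M μ
      at   : M (slot ν) ≡ ad (root μ)
      sep  : Sep ν μ
      <F   : ∀ i → 1 ≤ occ μ i + occZ ν i → i < F

  stored-state : ∀ {m R k ν Z M F μ t} {bs fs : Vec ℕ k} → Path-of m R bs fs ν Z → Placed M F ν μ →
                 Represented M bs (ad (root μ)) t (occ μ) → Stored M (get M 0 1) (plug Z t)
  stored-state P (placed z r at sep _) rep =
    let o , rep′ , le = represent-path z P (at-address at rep)
    in stored rep′ (λ i → ≤-trans (le i) (sep i))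

  -- The truncated difference of 4 and the tag vanishes only for an explicit substitution, so the
  -- shape of the content decides whether there is anything to relink.
  run-expand : ∀ R M {a q p x μ f g} c → R 3 ≡ a → R 4 ≡ p → M a ≡ q → M (q + 0) ≡ 0 →
      M (q + 1) ≡ ad x →
    get M x 4 ≡ suc f → M (p + 7) ≢ 0 → R 1 ≢ 0 → EncZ M (es x g μ c) →
    Run (program δ′) downℓ R M copyℓ (relink M x c (slot μ)) λ R′ →
      R′ 1 ≡ R 1 ∸ δ′ × R′ 2 ≡ R 2 × R′ 3 ≡ R 3 × R′ 4 ≡ R 4 × R′ 5 ≡ R 5 ×
      R′ 6 ≡ ad (root (innermost c)) × R′ 7 ≡ R 3 × R′ 8 ≡ 0
  run-expand R M (var _ _) r₃ r₄ at e₀ e₁ fl k n (es _ e₂ _ _ _ _ (var t₀ _) _) =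
    run-ue δ′ R M r₃ r₄ at e₀ e₁ fl k n e₂ (suc-≢0 (cong (4 ∸_) t₀))
  run-expand R M (sym _ _) r₃ r₄ at e₀ e₁ fl k n (es _ e₂ _ _ _ _ (sym t₀ _) _) =
    run-ue δ′ R M r₃ r₄ at e₀ e₁ fl k n e₂ (suc-≢0 (cong (4 ∸_) t₀))
  run-expand R M (lam _ _) r₃ r₄ at e₀ e₁ fl k n (es _ e₂ _ _ _ _ (lam t₀ _ _) _) =
    run-ue δ′ R M r₃ r₄ at e₀ e₁ fl k n e₂ (suc-≢0 (cong (4 ∸_) t₀))
  run-expand R M (app _ _ _) r₃ r₄ at e₀ e₁ fl k n (es _ e₂ _ _ _ _ (app t₀ _ _ _ _) _) =
    run-ue δ′ R M r₃ r₄ at e₀ e₁ fl k n e₂ (suc-≢0 (cong (4 ∸_) t₀))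
  run-expand R M (es _ _ _ _) r₃ r₄ at e₀ e₁ fl k n (es _ e₂ e₃ _ b _ e@(es t₀ _ _ _ _ _ _ _) _) =
    run-ue-relink δ′ R M r₃ r₄ at e₀ e₁ fl k n e₂ (cong (4 ∸_) t₀) b (bottom-read e) e₃

  -- The free variables are bound by explicit substitutions of the path. Their tags put them outside
  -- the code, and only an application has its slot in field 2, so the copy leaves the cells it
  -- reads from them intact.
  ready-content : ∀ {m ρ k Z t ν u F R M} {bs fs : Vec ℕ k} → Path-of m ρ bs fs ν Z → EncZ M ν →
      Enc M u →
    Code bs u t → Separate (occ u) → (∀ i → 1 ≤ occ u i → i < F) → (∀ i → 1 ≤ occZ ν i → i < F) →
    occ u (slotB ν) ≡ 0 → R 2 ≡ ad F → R 6 ≡ ad (root u) → R 7 ≡ slot ν → R 8 ≡ 0 →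
    Ready-to-copy R M F (slot ν) 0 (rawOf u) (map ad bs) bs t
  ready-content {ν = ν} {u} {F} {R} {M} {bs} P z e c sep u<F ν<F ∌slot r₂ r₆ r₇ r₈ = copyable
    (code-src e c) (disjoint-node u sep)
    (λ i → let j , g , g< , o , eq = in-node u i in ≤-trans (≤-reflexive (cong suc eq))
        (cell<ad j g< (u<F j o)))
    (λ i → let j , g , g< , o , eq = in-node u i in
           apart {occ u} o ∌slot (≡.sym (proj₁ (cell-injective {slotB ν} {j} (slotF<8 ν) g< eq))))
    (cell<ad (slotB ν) (slotF<8 ν) (ν<F (slotB ν) (occ-slot ν)))
    fw r₂ (trans r₆ (≡.sym (start-rawOf u))) r₇ r₈
    where
    fw : ∀ i → Forwarded M (rawOf u) F (slot ν) (lookup (map ad bs) i) (lookup bs i)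
    fw i rewrite lookup-map i ad bs with path-at P i
    ... | _ , _ , a with at-enc a z
    ... | es e₀ _ _ _ _ _ _ _ = forwarded (free e₀ refl)
      (safe (∉u 0<8) (λ eq → slotF≢0 {M} ν (≡.sym (proj₂ (cell-injective {x} {slotB ν} 0<8
          (slotF<8 ν) eq))))
            (cell<ad x 0<8 x<F))
      (safe (∉u 2<8)
            (λ eq → let x≡ , 2≡ = cell-injective {x} {slotB ν} 2<8 (slotF<8 ν) eq in
                    slot-field z (≡.sym 2≡) (trans (cong (λ j → get M j 0) (≡.sym x≡)) e₀))
            (cell<ad x 2<8 x<F))
      where
      x = lookup bs i
      x<F : x < F
      x<F = ν<F x (occ-at-node a)
      ∉u : ∀ {g} → g < 8 → ¬ In (rawOf u) (ad x + g)
      ∉u g< inu =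
        let j , h , h< , o , eq = in-node u inu
            j≡x = ≡.sym (proj₁ (cell-injective {x} {j} g< h< eq))
        in code-tag e c (≡.subst (λ j → 1 ≤ occ u j) j≡x o) e₀

  mark-field : ∀ {M n ν t} {bs : Vec ℕ n} {i g} → Enc M ν → Code bs ν t → g < 8 →
               Mark (rawOf ν) (ad i + g) → g ≡ 2 × get M i 0 ≡ 2
  mark-field {M} {i = i} e c g< mk′ =
    let j , eq , tag≡ = mark-node e c mk′
        i≡j , g≡2 = cell-injective {i} {j} g< 2<8 eq
    in g≡2 , trans (cong (λ j → get M j 0) i≡j) tag≡

  -- The path survives because each write goes to new nodes, to the slot, or to a mark; marks occupy
  -- field 2 of abstractions, where `Agree` permits changes.
  placed-copy : ∀ {k t ν u F R M w} {bs : Vec ℕ k} → EncZ M ν → Separate (occZ ν) →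
      (∀ i → 1 ≤ occZ ν i → i < F) →
    (∀ {i g} → g < 8 → Mark u (ad i + g) → g ≡ 2 × get M i 0 ≡ 2) →
    (C : Copied R M F (slot ν) w u bs t) → Placed (Copied.mem C) (Copied.F′ C) ν (Copied.copy C)
  placed-copy {ν = ν} {u} {F} {R} {M} {w} z sep ν<F marks C =
    placed (encZ-agree agrees (encZ-slot {v = ad (root copy)} sep z)) enc dst≡
      (separate-+ (λ i o o′ → <-irrefl refl (<-≤-trans (ν<F i o′) (proj₁ (range i o)))) separate sep)
      below-F′
    where
    open Copied C
    M₁ = M [ slot ν ≔ ad (root copy) ]
    agrees : ∀ i → 1 ≤ occZ ν i → Agree M₁ mem i
    agrees i o = mk go
      where
      go : ∀ g → g < 8 → (g ≡ 2 → get M₁ i 0 ≢ 2) → get mem i g ≡ get M₁ i g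
      go g g< h with ad i + g ≟ slot ν
      ... | yes eq = trans (cong mem eq) (trans dst≡ (trans (≡.sym (update-same M (slot ν) _))
          (cong M₁ (≡.sym eq))))
      ... | no ne = trans (outside (ad i + g) (cell<ad i g< (ν<F i o)) ne unmarked)
          (≡.sym (update-other M _ ne))
        where
        unmarked : ¬ Mark u (ad i + g)
        unmarked mk′ =
          let g≡2 , tag≡ = marks {i} g< mk′
              0≢slot = λ eq′ → slotF≢0 {M} ν (≡.sym (proj₂ (cell-injective {i} {slotB ν} 0<8
                  (slotF<8 ν) eq′)))
          in h g≡2 (trans (update-other M {slot ν} {ad i + 0} _ 0≢slot) tag≡)
    below-F′ : ∀ i → 1 ≤ occ copy i + occZ ν i → i < F′
    below-F′ i o with 1≤+ (occ copy i) o
    ... | inj₁ o′ = proj₂ (range i o′)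
    ... | inj₂ o′ = <-≤-trans (ν<F i o′) (<⇒≤ grows)

-- Transitions of the machine and their cost

module Evaluation (β : ℕ) (β≢0 : β ≢ 0) (δ′ : ℕ) {Output : ETerm 0 → Set} (S : Strategy δ′ Output)
                  (m : ℕ) (1≤m : 1 ≤ m) where
  open Layout β
  open Update β
  open Relinking β
  open Copying β β≢0 δ′
  open Representation β
  open Machine β β≢0 δ′
  open Agree
  open Same
  open Strategy S

  record Down (R M : ℕ → ℕ) (n ρ b q : ℕ) {k} (Z : Zip k) (s : Term k) (ν : NodeZip) (μ : Node) :
      Set where
    constructor down
    field
      {F}     : ℕ
      {bs fs} : Vec ℕ k
      path    : Path-of m ρ bs fs ν Z
      code    : Code bs μ s
      size≤   : ∣ s ∣ ≤ m
      plc     : Placed M F ν μ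
      regs    : Registers R n F (slot ν) (frame ν)
      inv     : Inv (plug Z (embed s)) n ρ b q
      quota   : Quota ρ q ν fs s

  -- In function position a value would have been a redex, hence `flag0`. Register 3 holds the
  -- bottom of the finished term rather than its slot, ready to be stored if that term is an
  -- argument.
  record Up (R M : ℕ → ℕ) (n ρ b q : ℕ) {k} (Z : Zip k) (t : ETerm k) (ν : NodeZip) (μ : Node) : Set
      where
    constructor up
    field
      {F}     : ℕ
      {bs fs} : Vec ℕ k
      path    : Path-of m ρ bs fs ν Z
      done    : Done m ρ bs fs μ t
      flag0   : kind ν ≢ 0 → flag fs t ≡ 0
      plc     : Placed M F ν μ
      slotAt  : SlotAt M (slot ν) μ
      regs    : Registers R n F (bottom (slot ν) μ) (frame ν)
      r₉      : R 9 ≡ flag fs t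
      inv     : Inv (plug Z t) n ρ b q
      ρ≤q     : ρ ≤ q

  map-run : ∀ {P l R M l′ M′ Q Q′} → (∀ {R′} → Q R′ → Q′ R′) → Run P l R M l′ M′ Q →
      Run P l R M l′ M′ Q′
  map-run f (run s q p) = run s q (f p)

  module _ {R M : ℕ → ℕ} {n ρ b q : ℕ} where

    step-app : ∀ {k} {Z : Zip k} {s s′ ν p t u} → Down R M n ρ b q Z (s · s′) ν (app p t u) →
      ∃[ M′ ] Run (program δ′) downℓ R M downℓ M′ λ R′ → Down R′ M′ n ρ b q (argZ (embed s) Z) s′
          (arg p t ν) u
    step-app {s = s} {s′} {ν} {p} {t} {u} (down {F} P (app c c′) sz
        (placed z e@(app e₀ _ _ _ _) at sep <F)
      (regfile r₁ r₂ r₃ r₄ r₅) i (fresh ρ≤q)) =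
      let z′ , e′ , at′ = enter-app z at e sep in
      _ , map-run (λ (q₁ , q₂ , q₃ , q₄ , q₅) → down
            (arg P c (≤-trans (m≤m+n ∣ s ∣ ∣ s′ ∣) (≤-trans (m≤m+n _ 1) sz))) c′
            (≤-trans (m≤n+m ∣ s′ ∣ ∣ s ∣) (≤-trans (m≤m+n _ 1) sz))
            (placed z′ e′ at′ (λ i → ≤-trans (≤-reflexive (≡.sym
                (perm (δ p i) _ (occ u i) (occZ ν i)))) (sep i))
               (λ i o → <F i (≤-trans o (≤-reflexive (≡.sym (perm (δ p i) _ (occ u i) (occZ ν i)))))))
            (regfile (trans q₁ r₁) (trans q₂ r₂) q₃ q₄ (trans q₅ r₅)) i (fresh ρ≤q))
          (run-down-app δ′ R M r₃ r₄ at e₀)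
      where
      perm : ∀ a b c d → a + (b + c) + d ≡ c + (a + (b + d))
      perm = solve-∀

    -- A change of description without any instruction: the frame is the same, and so is the bottom
    -- of the chain that the explicit substitution joins.
    up-es : ∀ {k} {Z : Zip k} {c t x f ν d μ} → Up R M n ρ b q (esZ Z c) t (es x f ν d) μ →
            Up R M n ρ b q Z (t [← c ]) ν (es x f μ d)
    up-es {x = x} {ν = ν} {d} {μ} (up (es P dc refl f≤) dt fl0
      (placed (es e₀ e₂ e₃ e₄ b at e z) r at′ sep <F) sl (regfile r₁ r₂ r₃ r₄ r₅) r₉ i ρ≤q) =
      up P (es dc refl f≤ dt) fl0
        (placed z (es e₀ at′ e₂ e₄ b sl r e) at
          (λ i → ≤-trans (≤-reflexive (perm (δ x i) (occ μ i) (occ d i) (occZ ν i))) (sep i))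
          (λ i o → <F i (≤-trans o (≤-reflexive (perm (δ x i) (occ μ i) (occ d i) (occZ ν i))))))
        e₃ (regfile r₁ r₂ (trans r₃ (bottom-node x μ)) r₄ r₅) r₉ i ρ≤q
      where
      perm : ∀ a b c d → a + (b + c) + d ≡ b + (a + (c + d))
      perm = solve-∀

    step-fun : ∀ {k} {Z : Zip k} {u t p f ν w μ} → Up R M n ρ b q (funZ Z u) t (fun p f ν w) μ →
      Run (program δ′) upℓ R M upℓ M λ R′ → Up R′ M n ρ b q Z (t · u) ν (app p μ w)
    step-fun {p = p} {ν = ν} {w} {μ} (up (fun P du refl f≤) dt fl0
      (placed (fun e₀ e₂ e₃ e₄ b e₆ e₇ at e z) r at′ sep <F) sl (regfile r₁ r₂ r₃ r₄ r₅) r₉ i ρ≤q) =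
      map-run (λ (q₁ , q₂ , q₃ , q₄ , q₅ , q₉) → up P (app dt flag0 du) (λ _ → refl)
          (placed z (app e₀ at′ e₂ r e) at
            (λ i → ≤-trans (≤-reflexive (perm (δ p i) (occ μ i) (occ w i) (occZ ν i))) (sep i))
            (λ i o → <F i (≤-trans o (≤-reflexive (perm (δ p i) (occ μ i) (occ w i) (occZ ν i))))))
          tt (regfile (trans q₁ r₁) (trans q₂ r₂) (trans q₃ e₃) (trans q₄ e₆) (trans q₅ r₅))
          (trans q₉ (trans r₉ flag0)) i ρ≤q)
        (run-up-fun δ′ R M r₄ (frame≢0 ν ∘ trans (≡.sym e₆)) (suc-≢0 e₇))
      where
      flag0 = fl0 (λ ())
      perm : ∀ a b c d → a + (b + c) + d ≡ b + (a + (c + d))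
      perm = solve-∀

    step-arg : ∀ {k} {Z : Zip k} {s t p ν w μ} → Up R M n ρ b q (argZ s Z) t (arg p w ν) μ →
      ∃[ M′ ] ∃[ s′ ] ∃[ f ] embed s′ ≡ s × size w ≡ ∣ s′ ∣ ×
      Run (program δ′) upℓ R M downℓ M′ λ R′ → Down R′ M′ n ρ b q (funZ Z t) s′ (fun p f ν μ) w
    step-arg {p = p} {ν} {w} {μ} (up {fs = fs} (arg P c sz) dt fl0
      (placed z@(arg e₀ e₁ e₃ e₆ e₇ at e zν) r at′ sep <F) sl (regfile r₁ r₂ r₃ r₄ r₅) r₉ i ρ≤q) =
      let z′ , e′ , at″ = leave-arg z r at′ sep refl in
      _ , _ , _ , refl , code-size c ,
      map-run (λ (q₁ , q₂ , q₃ , q₄ , q₅) → down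
          (fun P dt refl (flag≤ (path-flags≤ P) dt)) c sz
          (placed z′ e′ at″ (λ i → ≤-trans (≤-reflexive (perm (occ μ i) (δ p i) (occ w i)
              (occZ ν i))) (sep i))
            (λ i o → <F i (≤-trans o (≤-reflexive (perm (occ μ i) (δ p i) (occ w i) (occZ ν i))))))
          (regfile (trans q₁ r₁) (trans q₂ r₂) q₃ q₄ (trans q₅ r₅)) i (fresh ρ≤q))
        (run-up-arg δ′ R M r₄ r₃ r₉ (frame≢0 ν ∘ trans (≡.sym e₆)) e₇)
      where
      perm : ∀ a b c d → c + (b + (a + d)) ≡ a + (b + (c + d))
      perm = solve-∀

    finish : ∀ {k} {Z : Zip k} {t μ} → Up R M n ρ b q Z t top μ → Halts Output upℓ R M 131
    finish {t = t} (up {F} P dt _ plc@(placed (top e₆ _) r _ _ _) _ (regfile r₁ r₂ r₃ r₄ r₅) _ i _)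
        with P
    ... | top = after turn ≤-refl (halted (trans (Run.post turn) r₅)
        (stored-state {m = m} {R = ρ} {F = F} top plc (represent-done r dt))
          (normal (≡.subst Fireball (subst-closed (env top) (t ↓))
              (flagged-fireball {flag [] t} (path-done-flagged top dt))) i))
      where turn = run-up-top δ′ R M r₄ e₆

    leaf-up : ∀ {k} {Z : Zip k} {t ν μ f} {bs fs : Vec ℕ k} {F R′} → Path-of m ρ bs fs ν Z →
      Done m ρ bs fs μ t → (kind ν ≢ 0 → flag fs t ≡ 0) → Placed M F ν μ → SlotAt M (slot ν) μ →
      bottom (slot ν) μ ≡ slot ν → flag fs t ≡ f → Registers R n F (slot ν) (frame ν) →
      Inv (plug Z t) n ρ b q → ρ ≤ q → Unmoved R R′ × R′ 9 ≡ f → Up R′ M n ρ b q Z t ν μ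
    leaf-up P d fl0 plc sl bot refl (regfile r₁ r₂ r₃ r₄ r₅) i ρ≤q ((q₁ , q₂ , q₃ , q₄ , q₅) , q₉) =
      up P d fl0 plc sl (regfile (trans q₁ r₁) (trans q₂ r₂) (trans q₃ (trans r₃ (≡.sym bot)))
                                  (trans q₄ r₄) (trans q₅ r₅)) q₉ i ρ≤q

    step-sym : ∀ {k} {Z : Zip k} {a ν p a′} → Down R M n ρ b q Z (sym a) ν (sym p a′) →
      Run (program δ′) downℓ R M upℓ M λ R′ → Up R′ M n ρ b q Z (sym a) ν (sym p a′)
    step-sym {ν = ν} (down P sym _ plc@(placed z (sym e₀ _) at _ _) rg@(regfile _ _ r₃ _ _) i
        (fresh ρ≤q)) =
      map-run (leaf-up P sym (λ _ → refl) plc tt refl refl rg i ρ≤q)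
              (run-down-sym δ′ R M r₃ at e₀)

    step-lam : ∀ {k} {Z : Zip k} {s ν p t} → kind ν ≡ 0 → Down R M n ρ b q Z (lam s) ν (lam p t) →
      Run (program δ′) downℓ R M upℓ M λ R′ → Up R′ M n ρ b q Z (lam (embed s)) ν (lam p t)
    step-lam k0 (down P _ _ _ _ _ (lam k≢0)) = ⊥-elim (k≢0 k0)
    step-lam {ν = ν} k0 (down P (lam c) sz plc@(placed z (lam e₀ _ _) at _ _)
      rg@(regfile _ _ r₃ r₄ _) i (fresh ρ≤q)) =
      map-run (leaf-up P (lam c sz) (λ k≢0 → ⊥-elim (k≢0 k0)) plc tt refl refl rg i ρ≤q)
              (run-down-lam δ′ R M r₃ r₄ at e₀ (trans (kind-read z) k0))

    flag-read : ∀ {k} {Z : Zip k} {ν} {bs fs : Vec ℕ k} → Path-of m ρ bs fs ν Z → EncZ M ν → ∀ i →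
                get M (lookup bs i) 4 ≡ lookup fs i
    flag-read P z i with path-at P i
    ... | _ , _ , a with at-enc a z
    ... | es _ _ _ e₄ _ _ _ _ = e₄

    step-inert : ∀ {k} {Z : Zip k} {i ν p c} (d : Down R M n ρ b q Z (var i) ν (var p c)) →
      lookup (Down.fs d) i ≡ 0 →
      Run (program δ′) downℓ R M upℓ M λ R′ → Up R′ M n ρ b q Z (var i) ν (var p c)
    step-inert (down P _ _ _ _ _ (var _ f≢0 _)) f0 = ⊥-elim (f≢0 f0)
    step-inert {i = i} {ν} (down P (var refl) _ plc@(placed z (var e₀ e₁) at _ _)
      rg@(regfile _ _ r₃ _ _) v (fresh ρ≤q)) f0 =
      map-run (leaf-up P (var refl) (λ _ → cong bump f0) plc tt refl (cong bump f0) rg v ρ≤q)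
              (run-down-inert δ′ R M r₃ at e₀ e₁ (trans (flag-read P z i) f0))

    step-value : ∀ {k} {Z : Zip k} {i ν p c f} (d : Down R M n ρ b q Z (var i) ν (var p c)) →
      lookup (Down.fs d) i ≡ suc f → kind ν ≡ 0 →
      Run (program δ′) downℓ R M upℓ M λ R′ → Up R′ M n ρ b q Z (var i) ν (var p c)
    step-value (down P _ _ _ _ _ (var k≢0 _ _)) f1 k0 = ⊥-elim (k≢0 k0)
    step-value {i = i} {ν} (down P (var refl) _ plc@(placed z (var e₀ e₁) at _ _)
      rg@(regfile _ _ r₃ r₄ _) v (fresh ρ≤q)) f1 k0 =
      map-run (leaf-up P (var refl) (λ k≢0 → ⊥-elim (k≢0 k0)) plc tt refl (cong bump f1) rg v ρ≤q)
              (run-down-value δ′ R M r₃ r₄ at e₀ e₁ (trans (flag-read P z i) f1)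
                  (trans (kind-read z) k0))

    represented-focus : ∀ {k} {Z : Zip k} {s ν μ} → Down R M n ρ b q Z s ν μ →
                        Stored M (get M 0 1) (plug Z (embed s))
    represented-focus (down P c _ plc _ _ _) = stored-state P plc (represent-code (Placed.enc plc) c)

    stop-lam : ∀ {k} {Z : Zip k} {s ν p t} → kind ν ≢ 0 → n ≡ 0 →
               Down R M n ρ b q Z (lam s) ν (lam p t) → Halts Output downℓ R M 131
    stop-lam k refl d@(down _ _ _ (placed z (lam e₀ _ _) at _ _) (regfile r₁ _ r₃ r₄ r₅) i _) =
      after turn ≤-refl (halted (trans (Run.post turn) r₅) (represented-focus d) (stop i))
      where turn = run-stop-lam δ′ R M r₃ r₄ at e₀ (k ∘ trans (≡.sym (kind-read z))) r₁

    stop-var : ∀ {k} {Z : Zip k} {i ν p c f} → kind ν ≢ 0 → n ≡ 0 →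
      (d : Down R M n ρ b q Z (var i) ν (var p c)) → lookup (Down.fs d) i ≡ suc f →
          Halts Output downℓ R M 131
    stop-var {i = i} k refl d@(down P (var refl) _ (placed z (var e₀ e₁) at _ _)
        (regfile r₁ _ r₃ r₄ r₅) v _) f1 =
      after turn ≤-refl (halted (trans (Run.post turn) r₅) (represented-focus d) (stop v))
      where turn = run-stop-var δ′ R M r₃ r₄ at e₀ e₁ (trans (flag-read P z i) f1)
                (k ∘ trans (≡.sym (kind-read z))) r₁

  step-um : ∀ {R M n ρ b q k} {Z : Zip k} {s ν x t} → kind ν ≢ 0 →
    Down R M (suc n) ρ b q Z (lam s) ν (lam x t) →
    let split μ _ f u = unappN ν ; Z′ , u′ = unapp Z in
    ∃[ M′ ] ∃[ q′ ] Run (program δ′) downℓ R M downℓ M′ λ R′ →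
      Down R′ M′ n (suc ρ) b q′ (esZ Z′ u′) s (es x f μ u) t
  step-um {R} {M} {Z = Z} {s} {ν} {x} {t} k (down {F} P (lam c) sz (placed z e@(lam e₀ _ _) at sep <F)
    (regfile r₁ r₂ r₃ r₄ r₅) i _) =
    let z′ , e′ , at′ , sep′ = contract-lam k z at e sep
        P′ , du , f≡ , f≤ = unapp-path P k
        q′ , ρ<q′ , i′ = beta Z (embed s) (path-ready P) (path-applied P k) i
    in _ , q′ , map-run (λ (q₁ , q₂ , q₃ , q₄ , q₅) → down
          -- The flag of the new content is at most `suc ρ`, which is the bound from here on.
          (es (path-mono (n≤1+n _) P′) (done-mono (n≤1+n _) du) f≡ f≤) c
          (≤-trans (m≤m+n ∣ s ∣ 1) sz)
          (placed z′ e′ at′ sep′ (λ i o → <F i (≤-trans o (smaller i))))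
          (regfile (trans q₁ (cong (_∸ 1) r₁)) (trans q₂ r₂) q₃
                   (trans q₄ (trans next≡ (≡.sym (frame-outer ν k)))) (trans q₅ r₅))
          i′ (fresh ρ<q′))
        (run-um δ′ R M r₃ (trans r₄ frame≡) at e₀
          (λ eq → k (trans (≡.sym (kind-read z)) (trans (cong (λ a → M (a + 7)) frame≡) eq)))
          (suc-≢0 r₁) left≡ slot≡)
    where
    open Split (unappN ν) renaming (outer to μ; node to p; flg to f; right to u)
    open UnappRead (unapp-read {M} {x = x} k z at)
    perm : ∀ a b c d → a + (b + (c + d)) ≡ b + a + (c + d)
    perm = solve-∀
    smaller : ∀ i → occ t i + (δ x i + (occ u i + occZ μ i)) ≤ δ x i + occ t i + occZ ν i
    smaller i = ≤-trans (≤-reflexive (perm (occ t i) (δ x i) (occ u i) (occZ μ i)))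
      (+-monoʳ-≤ (δ x i + occ t i) (≤-trans (m≤n+m _ (δ p i)) (≤-reflexive (≡.sym (occ-unapp ν k i)))))

  record Expanded (R M : ℕ → ℕ) (n ρ b : ℕ) (ν : NodeZip) : Set where
    constructor expanded
    field
      {time b′ q′ scope} : ℕ
      {R′ M′}  : ℕ → ℕ
      {Z′}     : Zip scope
      {s′}     : Term scope
      {ν′}     : NodeZip
      {μ′}     : Node
      steps    : program δ′ ⊢ ⟪ downℓ , R , M ⟫ ⟶[ time ] ⟪ downℓ , R′ , M′ ⟫
      time≤    : time ≤ 256 + 256 * m
      b≡       : b ≡ suc b′
      weight≡  : weight ν′ ≡ weight ν
      size≤    : size μ′ ≤ m
      state    : Down R′ M′ (suc n ∸ δ′) ρ b′ q′ Z′ s′ ν′ μ′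

  quota≤ : ∀ {ρ q k ν Z i f} {bs fs : Vec ℕ k} → Path-of m ρ bs fs ν Z → Quota ρ q ν fs (var i) →
           lookup fs i ≡ suc f → suc f ≤ q
  quota≤ {i = i} P (fresh le)   eq = ≤-trans (≤-reflexive (≡.sym eq)) (≤-trans (path-flags≤ P i) le)
  quota≤ P (var _ _ le) eq = ≤-trans (≤-reflexive (≡.sym eq)) le

  after-copy : ∀ {R M R₁ M₁ n ρ b b′ q k F t₁} {Z : Zip k} {s ν ν′ u} {bs fs : Vec ℕ k} →
    t₁ ≤ 128 → program δ′ ⊢ ⟪ downℓ , R , M ⟫ ⟶[ t₁ ] ⟪ copyℓ , R₁ , M₁ ⟫ →
    Path-of m ρ bs fs ν′ Z → (C : Copied R₁ M₁ F (slot ν′) 0 u bs s) →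
    Placed (Copied.mem C) (Copied.F′ C) ν′ (Copied.copy C) →
    Registers R₁ (suc n ∸ δ′) F (slot ν′) (frame ν′) →
    b ≡ suc b′ → weight ν′ ≡ weight ν → ∣ s ∣ ≤ m → Inv (plug Z (embed s)) (suc n ∸ δ′) ρ b′ q →
    Quota ρ q ν′ fs s → Expanded R M n ρ b ν
  after-copy {s = s} t≤ steps₁ P C plc (regfile r₁ r₂ r₃ r₄ r₅) b≡ w≡ sz i quota
    with run-pop-end δ′ (Copied.regs C) (Copied.mem C) (Copied.pending≡ C) | Copied.preserved C
  ... | run steps₂ quick₂ refl | p₁ , p₃ , p₄ , p₅ =
    expanded (⟶-trans steps₁ (⟶-trans (Copied.steps C) steps₂))
      (≤-trans (+-mono-≤ t≤ (+-mono-≤ (Copied.time≤ C) quick₂))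
               (≤-trans (≤-reflexive (total ∣ s ∣)) (+-monoʳ-≤ 256 (*-monoʳ-≤ 256 sz))))
      b≡ w≡ (≤-trans (≤-reflexive (code-size (Copied.code C))) sz)
      (down P (Copied.code C) sz plc
        (regfile (trans p₁ r₁) (Copied.free≡ C) (trans p₃ r₃) (trans p₄ r₄) (trans p₅ r₅)) i quota)
    where
    total : ∀ x → 128 + (256 * x + 128) ≡ 256 + 256 * x
    total = solve-∀

  copy-content : ∀ {R M R₁ M₁ n ρ b b′ q k F t₁} {Z : Zip k} {s ν ν′ u} {bs fs : Vec ℕ k} →
    t₁ ≤ 128 → program δ′ ⊢ ⟪ downℓ , R , M ⟫ ⟶[ t₁ ] ⟪ copyℓ , R₁ , M₁ ⟫ →
    Path-of m ρ bs fs ν′ Z → EncZ M₁ ν′ → Separate (occZ ν′) → (∀ i → 1 ≤ occZ ν′ i → i < F) →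
    Enc M₁ u → Code bs u s → Separate (occ u) → (∀ i → 1 ≤ occ u i → i < F) → occ u (slotB ν′) ≡ 0 →
    Registers R₁ (suc n ∸ δ′) F (slot ν′) (frame ν′) → R₁ 6 ≡ ad (root u) → R₁ 7 ≡ slot ν′ → R₁ 8 ≡ 0 →
    b ≡ suc b′ → weight ν′ ≡ weight ν → ∣ s ∣ ≤ m → Inv (plug Z (embed s)) (suc n ∸ δ′) ρ b′ q →
    Quota ρ q ν′ fs s → Expanded R M n ρ b ν
  copy-content {s = s} {bs = bs} t≤ steps₁ P z sep ν<F e c sepu u<F ∌slot rg@(regfile _ r₂ _ _ _) r₆
      r₇ r₈ =
    after-copy t≤ steps₁ P copied (placed-copy z sep ν<F (λ {i} → mark-field {bs = bs} {i = i} e c)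
        copied) rg
    where copied = copy-code s (ready-content P z e c sepu u<F ν<F ∌slot r₂ r₆ r₇ r₈)

  step-ue : ∀ {R M n ρ b q k} {Z : Zip k} {i ν p c f} → kind ν ≢ 0 →
    (d : Down R M (suc n) ρ b q Z (var i) ν (var p c)) → lookup (Down.fs d) i ≡ suc f →
    Expanded R M n ρ b ν
  -- The flag of the variable is the number of substitutions that its chain still requires, and it
  -- is at most q; being positive, it excludes q = 0.
  step-ue {q = zero} k (down P _ _ _ _ _ quota) f1 with quota≤ P quota f1
  ... | ()
  step-ue {R} {M} {n} {ρ} {b} {suc q} {Z = Z} {i} {ν} {p} {f = f} k
    (down {F} {bs} {fs} P (var refl) sz (placed z (var e₀ e₁) at sep <F) (regfile r₁ r₂ r₃ r₄ r₅) v
        quota) f1 =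
    let μ , c , a = path-at P i
        b′ , b≡ , v′ = expand Z i (path-ready P) (path-applied P k)
          (≡.subst (λ g → Flagged g (env Z i)) f1 (path-flagged P i)) v
    in go {c = c} (floatAt Z i) (float-path P i) (float-innermost a) (weight-float (toℕ i) ν)
         (kind-float (toℕ i) ν)
         (occ-float (toℕ i) ν) (relink-at a z sep-ν) (occ-at-content a) (content-∌-slot a sep-ν) b≡ v′
         (run-expand R M c r₃ r₄ at e₀ e₁ (trans (flag-read {R} {M} {n} {ρ} {b} {q} P z i) f1)
             (k ∘ trans (≡.sym (kind-read z))) (suc-≢0 r₁)
           (at-enc a z))
    where
    f≤q : f ≤ q
    f≤q = ≤-pred (quota≤ P quota f1)
    sep-ν : Separate (occZ ν)
    sep-ν j = sep₂ {δ p j} (sep j)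
    go : ∀ {b′ c N M₁} (X : Float _) → Floated m ρ bs fs (lookup fs i) X N → proj₂ N ≡ innermost c →
      weight (proj₁ N) ≡ weight ν → kind (proj₁ N) ≡ kind ν → (∀ j → occZ (proj₁ N) j ≡ occZ ν j) →
      Relinked M M₁ ν (proj₁ N) (innermost c) → (∀ j → occ c j ≤ occZ ν j) → occ c (slotB ν) ≡ 0 →
      b ≡ suc b′ → Inv (plugFloat X) (suc n ∸ δ′) ρ b′ q →
      Run (program δ′) downℓ R M copyℓ M₁ (λ R′ →
        R′ 1 ≡ R 1 ∸ δ′ × R′ 2 ≡ R 2 × R′ 3 ≡ R 3 × R′ 4 ≡ R 4 × R′ 5 ≡ R 5 ×
        R′ 6 ≡ ad (root (innermost c)) × R′ 7 ≡ R 3 × R′ 8 ≡ 0) → Expanded R M n ρ b ν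
    go {c = c} {ν′ , _} (float Z′ _ u) (floated {bs′} {fs′} _ _ P′ du flag≡ ¬es) refl w≡ k≡ o≡
       (relinked z′ e′ slot≡ frame≡ _ _) c≤ν ∌slot b≡ v′ (run steps quick
           (q₁ , q₂ , q₃ , q₄ , q₅ , q₆ , q₇ , q₈))
      with chained-content {ν = ν′} 1≤m (k ∘ trans (≡.sym k≡)) f≤q du ¬es (trans flag≡ f1)
    ... | chained refl code size≤ quota′ =
      copy-content quick steps P′ z′ (λ j → ≤-trans (≤-reflexive (o≡ j)) (sep-ν j))
        (λ j o → <F j (m≤n⇒m≤o+n (δ p j) (≤-trans o (≤-reflexive (o≡ j)))))
        e′ code (λ j → ≤-trans (u≤ν j) (sep-ν j)) (λ j o → <F j (m≤n⇒m≤o+n (δ p j) (≤-trans o (u≤ν j))))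
        (≡.subst (λ j → occ (innermost c) j ≡ 0)
          (≡.sym (proj₁ (cell-injective {slotB ν′} {slotB ν} (slotF<8 ν′) (slotF<8 ν) slot≡)))
          (zero-≤ (occ-innermost c (slotB ν)) ∌slot))
        (regfile (trans q₁ (cong (_∸ δ′) r₁)) (trans q₂ r₂) (trans q₃ (trans r₃ (≡.sym slot≡)))
                 (trans q₄ (trans r₄ (≡.sym frame≡))) (trans q₅ r₅))
        q₆ (trans q₇ (trans r₃ (≡.sym slot≡))) q₈ b≡ w≡ size≤ v′ quota′
      where
      u≤ν : ∀ j → occ (innermost c) j ≤ occZ ν j
      u≤ν j = ≤-trans (occ-innermost c j) (c≤ν j)

  spend : ∀ {l R M l′ M′ Q c c′} → c′ < c → (r : Run (program δ′) l R M l′ M′ Q) →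
          Halts Output l′ (Run.regs r) M′ (128 * c′ + 131) → Halts Output l R M (128 * c + 131)
  spend {c = c} {c′} lt r = after r (≤-trans (≤-reflexive (total c′))
      (+-monoˡ-≤ 131 (*-monoʳ-≤ 128 lt)))
    where
    total : ∀ x → 128 + (128 * x + 131) ≡ 128 * (1 + x) + 131
    total = solve-∀

  at-once : ∀ {l R M} c → Halts Output l R M 131 → Halts Output l R M (128 * c + 131)
  at-once c (k , x , w , s , k≤ , r) = k , x , w , s , ≤-trans k≤ (m≤n+m 131 (128 * c)) , r

  -- An unexplored node is charged 3 because an application is entered, turned to its function, and
  -- left. A substitution is charged 5 m: 3 m for exploring the copy and 2 m for making it. The
  -- constant 131 is a last block and the 3 instructions that halt; g bounds the charge and makes
  -- the recursion terminate.
  downward : ∀ g {R M n ρ b q k} {Z : Zip k} {s ν μ} → Down R M n ρ b q Z s ν μ →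
    let c = weight ν + (3 * size μ + 5 * m * b) in c < g → Halts Output downℓ R M (128 * c + 131)
  upward : ∀ g {R M n ρ b q k} {Z : Zip k} {t} ν {μ} → Up R M n ρ b q Z t ν μ →
    let c = weight ν + 5 * m * b in c < g → Halts Output upℓ R M (128 * c + 131)

  leaf-upward : ∀ g {R M n ρ b q k} {Z : Zip k} {t ν μ} x →
    Run (program δ′) downℓ R M upℓ M (λ R′ → Up R′ M n ρ b q Z t ν μ) →
    weight ν + (3 * suc x + 5 * m * b) < suc g → Halts Output downℓ R M
        (128 * (weight ν + (3 * suc x + 5 * m * b)) + 131)
  leaf-upward g {b = b} {ν = ν} x turn lt =
    spend less turn (upward g ν (Run.post turn) (<-≤-trans less (≤-pred lt)))
    where
    less : weight ν + 5 * m * b < weight ν + (3 * suc x + 5 * m * b)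
    less = +-monoʳ-< (weight ν) (+-monoˡ-< (5 * m * b) (s≤s z≤n))

  downward-lam : ∀ g n {R M ρ b q k} {Z : Zip k} {s ν p t} → Dec (kind ν ≡ 0) →
    Down R M n ρ b q Z (lam s) ν (lam p t) →
    let c = weight ν + (3 * suc (size t) + 5 * m * b) in c < suc g →
            Halts Output downℓ R M (128 * c + 131)
  downward-var : ∀ g n f {R M ρ b q k} {Z : Zip k} {i ν p x}
    (d : Down R M n ρ b q Z (var i) ν (var p x)) → lookup (Down.fs d) i ≡ f → Dec (kind ν ≡ 0) →
    let c = weight ν + (3 * 1 + 5 * m * b) in c < suc g → Halts Output downℓ R M (128 * c + 131)

  downward (suc g) {b = b} {ν = ν} {app p t u} d@(down _ (app _ _) _ _ _ _ _) lt =
    let _ , turn = step-app d in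
    spend less turn (downward g (Run.post turn) (<-≤-trans less (≤-pred lt)))
    where
    total : ∀ w x y z → suc (3 * x + 2 + w + (3 * y + z)) ≡ w + (3 * (1 + x + y) + z)
    total = solve-∀
    less = ≤-reflexive (total (weight ν) (size t) (size u) (5 * m * b))
  downward (suc g) d@(down _ sym _ _ _ _ _) lt = leaf-upward g 0 (step-sym d) lt
  downward (suc g) {n = n} {ν = ν} d@(down _ (lam _) _ _ _ _ _) lt = downward-lam g n (kind ν ≟ 0) d lt
  downward (suc g) {n = n} {ν = ν} d@(down {fs = fs} _ (var {i = i} _) _ _ _ _ _) lt =
    downward-var g n (lookup fs i) d refl (kind ν ≟ 0) lt

  downward-lam g n (yes k) d lt = leaf-upward g _ (step-lam k d) lt
  downward-lam g zero {b = b} {ν = ν} {t = t} (no k) d lt =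
    at-once (weight ν + (3 * suc (size t) + 5 * m * b)) (stop-lam k refl d)
  downward-lam g (suc n) {b = b} {ν = ν} {t = t} (no k) d lt =
    let _ , _ , turn = step-um k d in
    spend less turn (downward g (Run.post turn) (<-≤-trans less (≤-pred lt)))
    where
    less : weight (outer (unappN ν)) + (3 * size t + 5 * m * b) < weight ν +
        (3 * suc (size t) + 5 * m * b)
    less = ≤-trans (≤-reflexive (cong (_+ (3 * size t + 5 * m * b)) (≡.sym (weight-unapp ν k))))
      (+-monoʳ-≤ (weight ν) (+-monoˡ-≤ (5 * m * b) (*-monoʳ-≤ 3 (n≤1+n (size t)))))

  downward-var g n zero    d eq _       lt = leaf-upward g 0 (step-inert d eq) lt
  downward-var g n (suc f) d eq (yes k) lt = leaf-upward g 0 (step-value d eq k) lt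
  downward-var g zero (suc f) {b = b} {ν = ν} d eq (no k) lt =
    at-once (weight ν + (3 * 1 + 5 * m * b)) (stop-var k refl d eq)
  downward-var g (suc n) (suc f) {b = b} {ν = ν} d eq (no k) lt = go (step-ue k d eq)
    where
    go : ∀ {R M n ρ} → Expanded R M n ρ b ν → Halts Output downℓ R M
        (128 * (weight ν + (3 * 1 + 5 * m * b)) + 131)
    go (expanded {time = t₁} {b′} {ν′ = ν′} {μ′} steps time≤ refl w≡ size≤ d′)
      with downward g d′ (≤-trans (s≤s c≤) (≤-trans less (≤-pred lt)))
      where
      c≤ : weight ν′ + (3 * size μ′ + 5 * m * b′) ≤ weight ν + (3 * m + 5 * m * b′)
      c≤ = +-mono-≤ (≤-reflexive w≡) (+-monoˡ-≤ (5 * m * b′) (*-monoʳ-≤ 3 size≤))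
      total : ∀ w m b → suc (w + (3 * m + 5 * m * b)) + (2 + 2 * m) ≡ w + (3 * 1 + 5 * m * (1 + b))
      total = solve-∀
      less : suc (weight ν + (3 * m + 5 * m * b′)) ≤ weight ν + (3 * 1 + 5 * m * suc b′)
      less = ≤-trans (m≤m+n _ (2 + 2 * m)) (≤-reflexive (total (weight ν) m b′))
    ... | k′ , c , w , s , k≤ , st , o = _ , c , w , ⟶-⇓ steps s , bound≤ , st , o
      where
      -- The 3 units of the variable and the 2 m for copying pay for the 256 + 256 m instructions,
      -- with one block of 128 to spare.
      total : ∀ w m b → 256 + 256 * m + (128 * (w + (3 * m + 5 * m * b)) + 131) + 128 ≡ 128 *
          (w + (3 * 1 + 5 * m * (1 + b))) + 131
      total = solve-∀
      bound≤ : t₁ + k′ ≤ 128 * (weight ν + (3 * 1 + 5 * m * suc b′)) + 131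
      bound≤ = ≤-trans
        (+-mono-≤ time≤ (≤-trans k≤ (+-monoˡ-≤ 131 (*-monoʳ-≤ 128
          (+-mono-≤ (≤-reflexive w≡) (+-monoˡ-≤ (5 * m * b′) (*-monoʳ-≤ 3 size≤)))))))
        (≤-trans (m≤m+n _ 128) (≤-reflexive (total (weight ν) m b′)))

  upward g {b = b} top u lt = at-once (5 * m * b) (finish u)
  upward g (es x f ν c) u@(up (es _ _ _ _) _ _ _ _ _ _ _ _) lt = upward g ν (up-es u) lt
  upward (suc g) {b = b} (fun p f ν w) u@(up (fun _ _ _ _) _ _ _ _ _ _ _ _) lt =
    spend ≤-refl turn (upward g ν (Run.post turn) (≤-pred lt))
    where turn = step-fun u
  upward (suc g) {b = b} (arg p w ν) u@(up (arg _ _ _) _ _ _ _ _ _ _ _) lt with step-arg u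
  ... | _ , _ , _ , _ , _ , turn =
    spend less turn (downward g (Run.post turn) (<-≤-trans less (≤-pred lt)))
    where
    total : ∀ w x z → suc (suc w + (3 * x + z)) ≡ 3 * x + 2 + w + z
    total = solve-∀
    less = ≤-reflexive (total (weight ν) (size w) (5 * m * b))

module Start (free′ : ℕ) (δ′ : ℕ) {Output : ETerm 0 → Set} (S : Strategy δ′ Output) (t : Term 0)
             (1≤t : 1 ≤ ∣ t ∣) where
  -- One cell is skipped so that no node has address 0, which can then mark the end of the search
  -- stack and of the copying stack.
  β = free′ + 1
  β≢0 : β ≢ 0
  β≢0 = suc-≢0 (+-comm free′ 1)
  open Layout β
  open Update β
  open Copying β β≢0 δ′
  open Machine β β≢0 δ′
  open Evaluation β β≢0 δ′ S ∣ t ∣ 1≤t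
  open Strategy S

  module _ {p n b q : ℕ} {M : ℕ → ℕ} (r : Rep M [] p (embed t)) (u : Unique (cells r))
      (old : All (_< free′) (cells r))
           (i : Inv (embed t) n 0 b q) where

    R₀ = registers (initial p n free′ M)

    M₀ = puts M 0 ((6 , 0) ∷ (7 , 0) ∷ [])

    Start-block : Set
    Start-block = Run (program δ′) 0 R₀ M copyℓ M₀ λ R′ →
      R′ 1 ≡ n × R′ 2 ≡ 8 + β × R′ 3 ≡ β + 1 × R′ 4 ≡ β × R′ 5 ≡ β × R′ 6 ≡ p × R′ 7 ≡ β + 1 × R′ 8 ≡ 0

    start-block : Start-block
    start-block = run-init δ′ R₀ M

    origin : Source t r
    origin = rep-source t r u

    open Source origin using (raw; in-cells; start≡; src; disjoint)

    raw<free : ∀ {a} → In raw a → a < free′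
    raw<free = All.lookup old ∘ in-cells

    raw<ad0 : ∀ {a} → In raw a → a < ad 0
    raw<ad0 i = <-≤-trans (raw<free i) (m≤m+n free′ 1)

    raw-≢ : ∀ {a g} → In raw a → a ≢ ad 0 + g
    raw-≢ {g = g} i = <⇒≢ (<-≤-trans (raw<ad0 i) (m≤m+n (ad 0) g))

    ready-start : (b : Start-block) → Ready-to-copy (Run.regs b) M₀ 1 (slot top) 0 raw [] [] t
    ready-start (run _ _ (_ , q₂ , _ , _ , _ , q₆ , q₇ , q₈)) = copyable
      (src-cong (λ a i → puts-below M 0 ((6 , 0) ∷ (7 , 0) ∷ []) (raw<ad0 i)) src) disjoint
      (λ i → <-≤-trans (raw<ad0 i) (ad-mono {0} {1} z≤n)) (λ i → raw-≢ i refl) (cell<ad 0 1<8 ≤-refl)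
      (λ ()) q₂ (trans q₆ start≡) q₇ q₈

    placed-start : (b : Start-block) (C : Copied (Run.regs b) M₀ 1 (slot top) 0 raw [] t) →
                   Placed (Copied.mem C) (Copied.F′ C) top (Copied.copy C)
    placed-start b C = placed-copy (top (puts-at M 0 ((6 , 0) ∷ (7 , 0) ∷ []) 6)
        (puts-at M 0 ((6 , 0) ∷ (7 , 0) ∷ []) 7))
      (δ≤1 0) (λ i o → ≤-reflexive (cong suc (≡.sym (δ-eq 0 i o))))
      (λ {i} {g} g< m → ⊥-elim (<-irrefl refl (<-≤-trans (raw<ad0 (mark-in m))
        (≤-trans (ad-mono {0} {i} z≤n) (m≤m+n (ad i) g))))) C

    -- 1027 is 387 + 640. The first and last blocks take 128 + 128 + 131; each unit of size takes
    -- 256 for loading and 384 for exploration, and 128 times 5 for each substitution.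
    start-bound : ∀ x b → 1 ≤ x → 128 + (256 * x + (128 + (128 * (3 * x + 5 * x * b) + 131))) ≤ 1027
        * ((1 + b) * x)
    start-bound x b 1≤x = begin
      128 + (256 * x + (128 + (128 * (3 * x + 5 * x * b) + 131))) ≡⟨ expand-sum x b ⟩
      387 * 1 + (640 * x + 640 * (x * b))                         ≤⟨ +-monoˡ-≤ _ (*-monoʳ-≤ 387 1≤x) ⟩
      387 * x + (640 * x + 640 * (x * b))                         ≤⟨ m≤m+n _ (387 * (x * b)) ⟩
      387 * x + (640 * x + 640 * (x * b)) + 387 * (x * b)         ≡⟨ collect x b ⟩
      1027 * ((1 + b) * x)                                        ∎
      where
      open ≤-Reasoning
      expand-sum : ∀ x b → 128 + (256 * x + (128 + (128 * (3 * x + 5 * x * b) + 131))) ≡ 387 * 1 +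
          (640 * x + 640 * (x * b))
      expand-sum = solve-∀
      collect : ∀ x b → 387 * x + (640 * x + 640 * (x * b)) + 387 * (x * b) ≡ 1027 * ((1 + b) * x)
      collect = solve-∀

    run-from-copy : (s : Start-block) (C : Copied (Run.regs s) M₀ 1 (slot top) 0 raw [] t) →
                    Placed (Copied.mem C) (Copied.F′ C) top (Copied.copy C) →
                    Halts Output 0 R₀ M (1027 * ((1 + b) * ∣ t ∣))
    run-from-copy (run steps₁ quick₁ (q₁ , q₂ , q₃ , q₄ , q₅ , _)) C plc
      with run-pop-end δ′ (Copied.regs C) (Copied.mem C) (Copied.pending≡ C) | Copied.preserved C
    ... | run steps₂ quick₂ refl | p₁ , p₃ , p₄ , p₅
      with downward _ (down top (Copied.code C) ≤-refl plc
             (regfile (trans p₁ q₁) (Copied.free≡ C) (trans p₃ q₃) (trans p₄ q₄) (trans p₅ q₅)) i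
                 (fresh z≤n)) ≤-refl
    ... | k , c , w , steps₃ , k≤ , st , o =
      _ , c , w , ⟶-⇓ steps₁ (⟶-⇓ (Copied.steps C) (⟶-⇓ steps₂ steps₃)) ,
      ≤-trans (+-mono-≤ quick₁ (+-mono-≤ (Copied.time≤ C) (+-mono-≤ quick₂
          (≤-trans k≤ (≤-reflexive size≡)))))
              (start-bound ∣ t ∣ b 1≤t) , st , o
      where
      size≡ : 128 * (3 * size (Copied.copy C) + 5 * ∣ t ∣ * b) + 131 ≡ 128 *
          (3 * ∣ t ∣ + 5 * ∣ t ∣ * b) + 131
      size≡ = cong (λ x → 128 * (3 * x + 5 * ∣ t ∣ * b) + 131) (code-size (Copied.code C))

    evaluate : Halts Output 0 R₀ M (1027 * ((1 + b) * ∣ t ∣))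
    evaluate = run-from-copy start-block copied (placed-start start-block copied)
      where copied = copy-code t (ready-start start-block)

-- The two kinds of derivations

size≥1 : ∀ {n} (t : Term n) → 1 ≤ ∣ t ∣
size≥1 (var i) = ≤-refl
size≥1 (sym a) = ≤-refl
size≥1 (lam t) = m≤n+m 1 ∣ t ∣
size≥1 (t · u) = m≤n+m 1 (∣ t ∣ + ∣ u ∣)

-- A substitution is itself a step of the derivation, so the number of steps left also bounds the
-- substitutions before the end.
useful-strategy : ∀ u → Strategy 1 (_≋ u)
useful-strategy u = record
  { Inv    = Inv
  ; stop   = λ { ((ε , refl) , _) → ≋-refl }
  ; normal = λ { f ((ε , refl) , _) → ≋-refl ; f ((s ◅ d , _) , _) → ⊥-elim (fireball-normal f s) }
  ; beta   = λ { Z t y a ((s ◅ d , refl) , le) → _ , ≤-refl ,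
                 ≡.subst (λ t → Inv t _ 0 _ 0) (≡.sym (contraction-unique Z y a (lam t) s))
                     ((d , refl) , <⇒≤ le) }
  ; expand = λ { {b = suc b} Z i y a v ((s ◅ d , refl) , s≤s le) → b , refl ,
                 ≡.subst (λ t → Inv t _ 0 _ 0) (≡.sym (contraction-unique Z y a (var v) s))
                     ((d , refl) , le) }
  }
  where
  Inv : ETerm 0 → (n R b q : ℕ) → Set
  Inv t n R b q = Σ (Star _⊸uf_ t u) (λ d → length d ≡ n) × n ≤ b

-- K is the length of the whole derivation.  Flags grow by at most one with each
-- of its steps, so at most K substitution steps separate two of them.

fireball-strategy : ∀ (K : ℕ) (u : Term 0) → Strategy 0 (λ w → w ↓ ≡ u)
fireball-strategy K u = record
  { Inv    = Inv
  ; stop   = λ { ((ε , refl) , _) → refl }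
  ; normal = λ { f ((ε , refl) , _) → refl ; f ((s ◅ d , _) , _) → ⊥-elim (fireball-no-→f f s) }
  ; beta   = λ { {n = n} Z t y a ((s ◅ d , refl) , R≤ , b≥) →
      K , ≤-trans (m≤m+n _ n) (≤-trans (≤-reflexive (≡.sym (+-suc _ n))) R≤) ,
      -- The contraction found unfolds to a `→f` step, and by determinism to the one that the
      -- derivation takes.
      (≡.subst (λ t → Σ (Star _→f_ t u) (λ d → length d ≡ n)) (→f-deterministic s (um-↓ Z t a y))
          (d , refl)) ,
      ≤-trans (≤-reflexive (≡.sym (+-suc _ n))) R≤ ,
      ≤-trans (≤-trans (≤-trans (+-monoʳ-≤ (n * suc K) (n≤1+n K))
          (≤-reflexive (+-comm (n * suc K) (suc K)))) (m≤m+n _ _)) b≥ }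
  ; expand = λ { {n = n} {b = b} {q = q} Z i y a v (d , R≤ , b≥) →
      less {plug Z (var i)} {plugFloat (floatAt Z i)} d R≤ (≡.subst (_≤ b) (+-suc (suc n * suc K) q)
      b≥) (ue-↓ Z i) }
  }
  where
  -- Up to K substitutions may follow each remaining beta step, and `suc K` leaves one to spare.
  -- `R + n` never grows, because a beta step raises R and lowers n.
  Inv : ETerm 0 → (n R b q : ℕ) → Set
  Inv t n R b q = Σ (Star _→f_ (t ↓) u) (λ d → length d ≡ n) × R + n ≤ K × n * suc K + q ≤ b

  less : ∀ {t t′ n R b q} → Σ (Star _→f_ (t ↓) u) (λ d → length d ≡ n) → R + n ≤ K →
         suc (n * suc K + q) ≤ b → t′ ↓ ≡ t ↓ → ∃[ b′ ] b ≡ suc b′ × Inv t′ n R b′ q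
  less {n = n} d R≤ (s≤s le) eq =
    _ , refl , ≡.subst (λ t → Σ (Star _→f_ t u) (λ d → length d ≡ n)) (≡.sym eq) d , R≤ , le

theorem10 : Implementable embed _⊸uf_ _≋_ (λ |d| |t| → (1 + |d|) * |t|) ×
    Implementable id _→f_ (λ w u → w ↓ ≡ u) (λ |d| |t| → (1 + |d| ^ 2) * |t|)
theorem10 =
  (program 1 , 1027 , λ t {u} d {free} (r , un , old) →
     Start.evaluate free 1 (useful-strategy u) t (size≥1 t) {q = 0} r un old ((d , refl) , ≤-refl)) ,
  (program 0 , 3081 , λ t {u} d {free} (r , un , old) →
     let n = length d
         k , c , w , s , k≤ , st , o = Start.evaluate free 0 (fireball-strategy n u) t (size≥1 t)
             {q = n} r un old
           ((≡.subst (λ t → Σ (Star _→f_ t u) (λ d → length d ≡ n)) (≡.sym (embed-↓ t)) (d , refl))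
               , ≤-refl , ≤-refl)
     in k , c , w , s , ≤-trans k≤ (quadratic n ∣ t ∣) , st , o)
  where
  -- The number of substitutions is at most n (n + 1) + n = n² + 2 n, hence at most 3 n²; 3081 is
  -- three times 1027.
  quadratic : ∀ n x → 1027 * ((1 + (n * suc n + n)) * x) ≤ 3081 * ((1 + n ^ 2) * x)
  quadratic n x = begin
    1027 * ((1 + (n * suc n + n)) * x)                ≡⟨ lhs n x ⟩
    1027 * ((1 + n * n + (n + n)) * x)                ≤⟨ *-monoʳ-≤ 1027
        (*-monoˡ-≤ x (+-monoʳ-≤ (1 + n * n) (+-mono-≤ (n≤n² n) (n≤n² n)))) ⟩
    1027 * ((1 + n * n + (n * n + n * n)) * x)        ≤⟨ *-monoʳ-≤ 1027
        (*-monoˡ-≤ x (m≤m+n (1 + n * n + (n * n + n * n)) 2)) ⟩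
    1027 * ((1 + n * n + (n * n + n * n) + 2) * x)    ≡⟨ rhs n x ⟩
    3081 * ((1 + n ^ 2) * x)                          ∎
    where
    open ≤-Reasoning
    n≤n² : ∀ n → n ≤ n * n
    n≤n² zero    = z≤n
    n≤n² (suc n) = m≤m*n (suc n) (suc n)
    lhs : ∀ n x → 1027 * ((1 + (n * (1 + n) + n)) * x) ≡ 1027 * ((1 + n * n + (n + n)) * x)
    lhs = solve-∀
    rhs : ∀ n x → 1027 * ((1 + n * n + (n * n + n * n) + 2) * x) ≡ 3081 * ((1 + n * (n * 1)) * x)
    rhs = solve-∀
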